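{- For $0\le t\le m$ let $\tau_t$ be the element of $G_N$ given (in blocks of sizes $m,r,m,m,r,m$) by $$\tau_t=\begin{bmatrix}1_m&0&0&0&0&0\\0&1_r&0&0&0_r&0\\0&0&1_m&0&0&0\\0&0&e_t&1_m&0&0\\0&0_r&0&0&1_r&0\\ e_t^*&0&0&0&0&1_m\end{bmatrix},\qquad e_t=\begin{bmatrix}1_t&0\\0&0\end{bmatrix}\in M_m(\mathbb B).$$ Then $\{\tau_t:0\le t\le m\}$ is a complete set of representatives of $P_N\backslash G_N/(G_n\times G_n)$.
   Context: $\mathbb B=\mathbb Q\oplus\mathbb Q\zeta\oplus\mathbb Q\xi\oplus\mathbb Q\zeta\xi$ is a definite quaternion algebra over $\mathbb Q$, $\zeta^2=\alpha$, $\xi^2=\beta$, $\zeta\xi=-\xi\zeta$ with $\alpha,\beta<0$ squarefree integers; for a matrix $X$ over $\mathbb B$, $X^*={}^t\overline X$ with the main involution. Let $n=2m+r$ with $m>1$, and $N=2n$. Groups of $\mathbb Q$-points: $$G_n=\{g\in\mathrm{GL}_n(\mathbb B):g^*\phi g=\phi\},\quad\phi=\begin{bmatrix}0&0&-1_m\\0&\zeta1_r&0\\1_m&0&0\end{bmatrix},$$ $$G_N=\{g\in\mathrm{GL}_N(\mathbb B):g^*J_ng=J_n\},\quad J_n=\begin{bmatrix}0&-1_n\\1_n&0\end{bmatrix}.$$ $P_N=\left\{\begin{bmatrix}a&b\\ c&d\end{bmatrix}\in G_N:c=0\right\}$ ($n\times n$ blocks) is the Siegel parabolic subgroup. $G_n\times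 G_n$ is regarded as a subgroup of $G_N$ through the doubling embedding $g_1\times g_2\mapsto R^{ -1}\mathrm{diag}[g_1,g_2]R$, where (block sizes $m,r,m,m,r,m$) $$R=\begin{bmatrix}1_m&0&0&0&0&0\\0&\frac12&0&0&-\zeta^{ -1}&0\\0&0&0&1_m&0&0\\0&0&-1_m&0&0&0\\0&-\frac12&0&0&-\zeta^{ -1}&0\\0&0&0&0&0&1_m\end{bmatrix},$$ which satisfies $R^*\mathrm{diag}[\phi,-\phi]R=J_n$.
   Formalization: Adds the hypothesis that ζ·1_r is anisotropic (x*(ζ1_r)x = 0 only for x = 0), which is automatic for r ≤ 1; whenever it fails, e.g. α = β = −1, r = 2, x = (1, ξ), a further double coset exists and the claim as stated is false. -}

module Defs where

open import Algebra.Bundles using (Ring)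
open import Data.Bool.Base using (if_then_else_; _∧_)
open import Data.Fin.Base using (Fin; toℕ; splitAt; join; _↑ˡ_; _↑ʳ_)
import Data.Fin.Base as Fin
open import Data.Fin.Properties using (_≟_; join-splitAt)
open import Data.Integer.Base as ℤ using (ℤ; Negative)
open import Data.Integer.Divisibility using (_∣_)
open import Data.Nat.Base as ℕ using (ℕ; zero; suc)
import Data.Nat.Coprimality as Coprime
open import Data.Nat.Properties using (_<?_)
open import Data.Product.Base using (_×_; _,_; ∃; ∃-syntax)
open import Data.Rational.Base as ℚ using (ℚ; 0ℚ; 1ℚ; ½)
import Data.Rational.Properties as ℚₚ
open import Data.Rational.Solver using (module +-*-Solver)
open import Data.Sum.Base using (inj₁; inj₂)
open import Data.Vec.Functional using (Vector; _++_; take; drop)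
open import Data.Vec.Functional.Properties using (lookup-++ˡ; lookup-++ʳ)
open import Function.Base using (_∘_)
open import Level using (0ℓ)
open import Relation.Binary.PropositionalEquality
  using (_≡_; refl; sym; trans; cong; cong₂; subst; isEquivalence)
open import Relation.Nullary.Decidable.Core using (does)
open import Relation.Unary using (Pred; _∈_)

SquareFree : ℤ → Set
SquareFree a = ∀ (d : ℤ) → d ℤ.* d ∣ a → ℤ.∣ d ∣ ≡ 1

module Quaternion (α β : ℤ) where

  infixl 6 _+_
  infixl 7 _*_
  infix  8 -_

  record 𝔹 : Set where
    no-eta-equality
    pattern
    constructor quat
    field
      1-part ζ-part ξ-part ζξ-part : ℚ

  private
    A B : ℚ
    A = α ℚ./ 1
    B = β ℚ./ 1

  _+_ : 𝔹 → 𝔹 → 𝔹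
  quat a b c d + quat a′ b′ c′ d′ =
    quat (a ℚ.+ a′) (b ℚ.+ b′) (c ℚ.+ c′) (d ℚ.+ d′)

  -_ : 𝔹 → 𝔹
  - quat a b c d = quat (ℚ.- a) (ℚ.- b) (ℚ.- c) (ℚ.- d)

  -- Besides the defining relations (verified below), this uses
  -- (ζξ)² = -αβ, ζ(ζξ) = αξ = -(ζξ)ζ and (ζξ)ξ = βζ = -ξ(ζξ).
  _*_ : 𝔹 → 𝔹 → 𝔹
  quat a b c d * quat a′ b′ c′ d′ = quat
    (a ℚ.* a′ ℚ.+ A ℚ.* (b ℚ.* b′) ℚ.+ B ℚ.* (c ℚ.* c′) ℚ.- A ℚ.* B ℚ.* (d ℚ.* d′))
    (a ℚ.* b′ ℚ.+ b ℚ.* a′ ℚ.+ B ℚ.* (d ℚ.* c′ ℚ.- c ℚ.* d′))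
    (a ℚ.* c′ ℚ.+ c ℚ.* a′ ℚ.+ A ℚ.* (b ℚ.* d′ ℚ.- d ℚ.* b′))
    (a ℚ.* d′ ℚ.+ d ℚ.* a′ ℚ.+ b ℚ.* c′ ℚ.- c ℚ.* b′)

  -- The main involution, fixing ℚ and negating ζ, ξ and ζξ.
  conj : 𝔹 → 𝔹
  conj (quat a b c d) = quat a (ℚ.- b) (ℚ.- c) (ℚ.- d)

  ⟨_⟩ : ℚ → 𝔹
  ⟨ q ⟩ = quat q 0ℚ 0ℚ 0ℚ

  0# 1# ζ ξ : 𝔹
  0# = ⟨ 0ℚ ⟩
  1# = ⟨ 1ℚ ⟩
  ζ  = quat 0ℚ 1ℚ 0ℚ 0ℚ
  ξ  = quat 0ℚ 0ℚ 1ℚ 0ℚ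

  quat-cong : ∀ {a a′ b b′ c c′ d d′} → a ≡ a′ → b ≡ b′ → c ≡ c′ → d ≡ d′ →
              quat a b c d ≡ quat a′ b′ c′ d′
  quat-cong refl refl refl refl = refl

  open +-*-Solver

  private
    -- Quaternions with polynomial coordinates, as input for the solver.
    record 𝔹ᵖ (n : ℕ) : Set where
      constructor quatᵖ
      field
        p₀ p₁ p₂ p₃ : Polynomial n
    open 𝔹ᵖ

    module Law {n} (A B : Polynomial n) where
      infixl 6 _⊕_
      infixl 7 _⊗_

      _⊕_ _⊗_ : 𝔹ᵖ n → 𝔹ᵖ n → 𝔹ᵖ n
      quatᵖ a b c d ⊕ quatᵖ a′ b′ c′ d′ = quatᵖ (a :+ a′) (b :+ b′) (c :+ c′) (d :+ d′)
      quatᵖ a b c d ⊗ quatᵖ a′ b′ c′ d′ = quatᵖ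
        (a :* a′ :+ A :* (b :* b′) :+ B :* (c :* c′) :- A :* B :* (d :* d′))
        (a :* b′ :+ b :* a′ :+ B :* (d :* c′ :- c :* d′))
        (a :* c′ :+ c :* a′ :+ A :* (b :* d′ :- d :* b′))
        (a :* d′ :+ d :* a′ :+ b :* c′ :- c :* b′)

      ⊝_ : 𝔹ᵖ n → 𝔹ᵖ n
      ⊝ quatᵖ a b c d = quatᵖ (:- a) (:- b) (:- c) (:- d)

      ⟪_⟫ : ℚ → 𝔹ᵖ n
      ⟪ q ⟫ = quatᵖ (con q) (con 0ℚ) (con 0ℚ) (con 0ℚ)

      ζᵖ ξᵖ : 𝔹ᵖ n
      ζᵖ = quatᵖ (con 0ℚ) (con 1ℚ) (con 0ℚ) (con 0ℚ)
      ξᵖ = quatᵖ (con 0ℚ) (con 0ℚ) (con 1ℚ) (con 0ℚ)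

      -- Equality of the coordinates selected by p.
      module _ (p : 𝔹ᵖ n → Polynomial n) where
        module _ (a b c d : Polynomial n) where
          private x = quatᵖ a b c d
          idˡ idʳ halves negneg : Polynomial n × Polynomial n
          idˡ    = p (⟪ 1ℚ ⟫ ⊗ x) := p x
          idʳ    = p (x ⊗ ⟪ 1ℚ ⟫) := p x
          halves = p (⟪ ½ ⟫ ⊗ x ⊕ ⟪ ½ ⟫ ⊗ x) := p x
          negneg = p ((⊝ ⟪ 1ℚ ⟫) ⊗ ((⊝ ⟪ 1ℚ ⟫) ⊗ x)) := p x
          module _ (a′ b′ c′ d′ : Polynomial n) where
            private y = quatᵖ a′ b′ c′ d′
            cancel₁ cancel₂ cancel₃ : Polynomial n × Polynomial n
            cancel₁ = p (⟪ ½ ⟫ ⊗ (⟪ 1ℚ ⟫ ⊗ x ⊕ (⊝ ⟪ 1ℚ ⟫) ⊗ y) ⊕ (⟪ ½ ⟫ ⊗ x ⊕ ⟪ ½ ⟫ ⊗ y)) := p x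
            cancel₂ = p ((⊝ ⟪ ½ ⟫) ⊗ (⟪ 1ℚ ⟫ ⊗ x ⊕ (⊝ ⟪ 1ℚ ⟫) ⊗ y) ⊕ (⟪ ½ ⟫ ⊗ x ⊕ ⟪ ½ ⟫ ⊗ y)) := p y
            cancel₃ = p (⟪ 1ℚ ⟫ ⊗ (⟪ ½ ⟫ ⊗ x ⊕ y) ⊕ (⊝ ⟪ 1ℚ ⟫) ⊗ ((⊝ ⟪ ½ ⟫) ⊗ x ⊕ y)) := p x
            module _ (a″ b″ c″ d″ : Polynomial n) where
              private z = quatᵖ a″ b″ c″ d″
              assoc distˡ distʳ cancel₄ : Polynomial n × Polynomial n
              assoc   = p ((x ⊗ y) ⊗ z) := p (x ⊗ (y ⊗ z))
              distˡ   = p (x ⊗ (y ⊕ z)) := p (x ⊗ y ⊕ x ⊗ z)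
              distʳ   = p ((y ⊕ z) ⊗ x) := p (y ⊗ x ⊕ z ⊗ x)
              cancel₄ = p (x ⊗ (⟪ ½ ⟫ ⊗ y ⊕ z) ⊕ x ⊗ ((⊝ ⟪ ½ ⟫) ⊗ y ⊕ z)) := p (x ⊗ z ⊕ x ⊗ z)

  *-assoc : ∀ x y z → (x * y) * z ≡ x * (y * z)
  *-assoc (quat a b c d) (quat a′ b′ c′ d′) (quat a″ b″ c″ d″) = quat-cong
    (solve 14 (λ A B → Law.assoc A B p₀) refl A B a b c d a′ b′ c′ d′ a″ b″ c″ d″)
    (solve 14 (λ A B → Law.assoc A B p₁) refl A B a b c d a′ b′ c′ d′ a″ b″ c″ d″)
    (solve 14 (λ A B → Law.assoc A B p₂) refl A B a b c d a′ b′ c′ d′ a″ b″ c″ d″)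
    (solve 14 (λ A B → Law.assoc A B p₃) refl A B a b c d a′ b′ c′ d′ a″ b″ c″ d″)

  *-distribˡ-+ : ∀ x y z → x * (y + z) ≡ x * y + x * z
  *-distribˡ-+ (quat a b c d) (quat a′ b′ c′ d′) (quat a″ b″ c″ d″) = quat-cong
    (solve 14 (λ A B → Law.distˡ A B p₀) refl A B a b c d a′ b′ c′ d′ a″ b″ c″ d″)
    (solve 14 (λ A B → Law.distˡ A B p₁) refl A B a b c d a′ b′ c′ d′ a″ b″ c″ d″)
    (solve 14 (λ A B → Law.distˡ A B p₂) refl A B a b c d a′ b′ c′ d′ a″ b″ c″ d″)
    (solve 14 (λ A B → Law.distˡ A B p₃) refl A B a b c d a′ b′ c′ d′ a″ b″ c″ d″)

  *-distribʳ-+ : ∀ x y z → (y + z) * x ≡ y * x + z * x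
  *-distribʳ-+ (quat a b c d) (quat a′ b′ c′ d′) (quat a″ b″ c″ d″) = quat-cong
    (solve 14 (λ A B → Law.distʳ A B p₀) refl A B a b c d a′ b′ c′ d′ a″ b″ c″ d″)
    (solve 14 (λ A B → Law.distʳ A B p₁) refl A B a b c d a′ b′ c′ d′ a″ b″ c″ d″)
    (solve 14 (λ A B → Law.distʳ A B p₂) refl A B a b c d a′ b′ c′ d′ a″ b″ c″ d″)
    (solve 14 (λ A B → Law.distʳ A B p₃) refl A B a b c d a′ b′ c′ d′ a″ b″ c″ d″)

  *-identityˡ : ∀ x → 1# * x ≡ x
  *-identityˡ (quat a b c d) = quat-cong
    (solve 6 (λ A B → Law.idˡ A B p₀) refl A B a b c d)
    (solve 6 (λ A B → Law.idˡ A B p₁) refl A B a b c d)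
    (solve 6 (λ A B → Law.idˡ A B p₂) refl A B a b c d)
    (solve 6 (λ A B → Law.idˡ A B p₃) refl A B a b c d)

  *-identityʳ : ∀ x → x * 1# ≡ x
  *-identityʳ (quat a b c d) = quat-cong
    (solve 6 (λ A B → Law.idʳ A B p₀) refl A B a b c d)
    (solve 6 (λ A B → Law.idʳ A B p₁) refl A B a b c d)
    (solve 6 (λ A B → Law.idʳ A B p₂) refl A B a b c d)
    (solve 6 (λ A B → Law.idʳ A B p₃) refl A B a b c d)

  𝔹-ring : Ring 0ℓ 0ℓ
  𝔹-ring = record
    { Carrier = 𝔹 ; _≈_ = _≡_ ; _+_ = _+_ ; _*_ = _*_ ; -_ = -_ ; 0# = 0# ; 1# = 1#
    ; isRing = record
      { +-isAbelianGroup = record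
        { isGroup = record
          { isMonoid = record
            { isSemigroup = record
              { isMagma = record { isEquivalence = isEquivalence ; ∙-cong = cong₂ _+_ }
              ; assoc = λ { (quat a b c d) (quat a′ b′ c′ d′) (quat a″ b″ c″ d″) →
                  quat-cong (ℚₚ.+-assoc a a′ a″) (ℚₚ.+-assoc b b′ b″)
                            (ℚₚ.+-assoc c c′ c″) (ℚₚ.+-assoc d d′ d″) }
              }
            ; identity =
                (λ { (quat a b c d) → quat-cong (ℚₚ.+-identityˡ a) (ℚₚ.+-identityˡ b)
                                                (ℚₚ.+-identityˡ c) (ℚₚ.+-identityˡ d) })
              , (λ { (quat a b c d) → quat-cong (ℚₚ.+-identityʳ a) (ℚₚ.+-identityʳ b)
                                                (ℚₚ.+-identityʳ c) (ℚₚ.+-identityʳ d) })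
            }
          ; inverse =
              (λ { (quat a b c d) → quat-cong (ℚₚ.+-inverseˡ a) (ℚₚ.+-inverseˡ b)
                                              (ℚₚ.+-inverseˡ c) (ℚₚ.+-inverseˡ d) })
            , (λ { (quat a b c d) → quat-cong (ℚₚ.+-inverseʳ a) (ℚₚ.+-inverseʳ b)
                                              (ℚₚ.+-inverseʳ c) (ℚₚ.+-inverseʳ d) })
          ; ⁻¹-cong = cong -_
          }
        ; comm = λ { (quat a b c d) (quat a′ b′ c′ d′) →
            quat-cong (ℚₚ.+-comm a a′) (ℚₚ.+-comm b b′)
                      (ℚₚ.+-comm c c′) (ℚₚ.+-comm d d′) }
        }
      ; *-cong = cong₂ _*_
      ; *-assoc = *-assoc
      ; *-identity = *-identityˡ , *-identityʳ
      ; distrib = *-distribˡ-+ , *-distribʳ-+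
      }
    }

  ζ²≡α : ζ * ζ ≡ ⟨ α ℚ./ 1 ⟩
  ζ²≡α = quat-cong
    (solve 2 (λ A B → let open Law A B in p₀ (ζᵖ ⊗ ζᵖ) := p₀ (quatᵖ A (con 0ℚ) (con 0ℚ) (con 0ℚ))) refl A B)
    (solve 2 (λ A B → let open Law A B in p₁ (ζᵖ ⊗ ζᵖ) := p₁ (quatᵖ A (con 0ℚ) (con 0ℚ) (con 0ℚ))) refl A B)
    (solve 2 (λ A B → let open Law A B in p₂ (ζᵖ ⊗ ζᵖ) := p₂ (quatᵖ A (con 0ℚ) (con 0ℚ) (con 0ℚ))) refl A B)
    (solve 2 (λ A B → let open Law A B in p₃ (ζᵖ ⊗ ζᵖ) := p₃ (quatᵖ A (con 0ℚ) (con 0ℚ) (con 0ℚ))) refl A B)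

  ξ²≡β : ξ * ξ ≡ ⟨ β ℚ./ 1 ⟩
  ξ²≡β = quat-cong
    (solve 2 (λ A B → let open Law A B in p₀ (ξᵖ ⊗ ξᵖ) := p₀ (quatᵖ B (con 0ℚ) (con 0ℚ) (con 0ℚ))) refl A B)
    (solve 2 (λ A B → let open Law A B in p₁ (ξᵖ ⊗ ξᵖ) := p₁ (quatᵖ B (con 0ℚ) (con 0ℚ) (con 0ℚ))) refl A B)
    (solve 2 (λ A B → let open Law A B in p₂ (ξᵖ ⊗ ξᵖ) := p₂ (quatᵖ B (con 0ℚ) (con 0ℚ) (con 0ℚ))) refl A B)
    (solve 2 (λ A B → let open Law A B in p₃ (ξᵖ ⊗ ξᵖ) := p₃ (quatᵖ B (con 0ℚ) (con 0ℚ) (con 0ℚ))) refl A B)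

  ζξ≡-ξζ : ζ * ξ ≡ - (ξ * ζ)
  ζξ≡-ξζ = quat-cong
    (solve 2 (λ A B → let open Law A B in p₀ (ζᵖ ⊗ ξᵖ) := p₀ (⊝ (ξᵖ ⊗ ζᵖ))) refl A B)
    (solve 2 (λ A B → let open Law A B in p₁ (ζᵖ ⊗ ξᵖ) := p₁ (⊝ (ξᵖ ⊗ ζᵖ))) refl A B)
    (solve 2 (λ A B → let open Law A B in p₂ (ζᵖ ⊗ ξᵖ) := p₂ (⊝ (ξᵖ ⊗ ζᵖ))) refl A B)
    (solve 2 (λ A B → let open Law A B in p₃ (ζᵖ ⊗ ξᵖ) := p₃ (⊝ (ξᵖ ⊗ ζᵖ))) refl A B)

  ζξ-basis : ζ * ξ ≡ quat 0ℚ 0ℚ 0ℚ 1ℚ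
  ζξ-basis = quat-cong
    (solve 2 (λ A B → let open Law A B in p₀ (ζᵖ ⊗ ξᵖ) := p₀ (quatᵖ (con 0ℚ) (con 0ℚ) (con 0ℚ) (con 1ℚ))) refl A B)
    (solve 2 (λ A B → let open Law A B in p₁ (ζᵖ ⊗ ξᵖ) := p₁ (quatᵖ (con 0ℚ) (con 0ℚ) (con 0ℚ) (con 1ℚ))) refl A B)
    (solve 2 (λ A B → let open Law A B in p₂ (ζᵖ ⊗ ξᵖ) := p₂ (quatᵖ (con 0ℚ) (con 0ℚ) (con 0ℚ) (con 1ℚ))) refl A B)
    (solve 2 (λ A B → let open Law A B in p₃ (ζᵖ ⊗ ξᵖ) := p₃ (quatᵖ (con 0ℚ) (con 0ℚ) (con 0ℚ) (con 1ℚ))) refl A B)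

  α≢0 : .{{_ : Negative α}} → ℚ.NonZero (α ℚ./ 1)
  α≢0 = lemma α
    where
    lemma : ∀ a .{{_ : Negative a}} → ℚ.NonZero (a ℚ./ 1)
    lemma ℤ.-[1+ k ] = subst ℚ.NonZero
      (sym (ℚₚ.↥p/↧p≡p (ℚ.mkℚ ℤ.-[1+ k ] 0 (Coprime.sym (Coprime.1-coprimeTo (suc k))))))
      _

  halves : ∀ x → ⟨ ½ ⟩ * x + ⟨ ½ ⟩ * x ≡ x
  halves (quat a b c d) = quat-cong
    (solve 6 (λ A B → Law.halves A B p₀) refl A B a b c d)
    (solve 6 (λ A B → Law.halves A B p₁) refl A B a b c d)
    (solve 6 (λ A B → Law.halves A B p₂) refl A B a b c d)
    (solve 6 (λ A B → Law.halves A B p₃) refl A B a b c d)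

  -1*-1* : ∀ x → (- 1#) * ((- 1#) * x) ≡ x
  -1*-1* (quat a b c d) = quat-cong
    (solve 6 (λ A B → Law.negneg A B p₀) refl A B a b c d)
    (solve 6 (λ A B → Law.negneg A B p₁) refl A B a b c d)
    (solve 6 (λ A B → Law.negneg A B p₂) refl A B a b c d)
    (solve 6 (λ A B → Law.negneg A B p₃) refl A B a b c d)

  cancel₁ : ∀ x y → ⟨ ½ ⟩ * (1# * x + (- 1#) * y) + (⟨ ½ ⟩ * x + ⟨ ½ ⟩ * y) ≡ x
  cancel₁ (quat a b c d) (quat a′ b′ c′ d′) = quat-cong
    (solve 10 (λ A B → Law.cancel₁ A B p₀) refl A B a b c d a′ b′ c′ d′)
    (solve 10 (λ A B → Law.cancel₁ A B p₁) refl A B a b c d a′ b′ c′ d′)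
    (solve 10 (λ A B → Law.cancel₁ A B p₂) refl A B a b c d a′ b′ c′ d′)
    (solve 10 (λ A B → Law.cancel₁ A B p₃) refl A B a b c d a′ b′ c′ d′)

  cancel₂ : ∀ x y → (- ⟨ ½ ⟩) * (1# * x + (- 1#) * y) + (⟨ ½ ⟩ * x + ⟨ ½ ⟩ * y) ≡ y
  cancel₂ (quat a b c d) (quat a′ b′ c′ d′) = quat-cong
    (solve 10 (λ A B → Law.cancel₂ A B p₀) refl A B a b c d a′ b′ c′ d′)
    (solve 10 (λ A B → Law.cancel₂ A B p₁) refl A B a b c d a′ b′ c′ d′)
    (solve 10 (λ A B → Law.cancel₂ A B p₂) refl A B a b c d a′ b′ c′ d′)
    (solve 10 (λ A B → Law.cancel₂ A B p₃) refl A B a b c d a′ b′ c′ d′)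

  cancel₃ : ∀ x y → 1# * (⟨ ½ ⟩ * x + y) + (- 1#) * ((- ⟨ ½ ⟩) * x + y) ≡ x
  cancel₃ (quat a b c d) (quat a′ b′ c′ d′) = quat-cong
    (solve 10 (λ A B → Law.cancel₃ A B p₀) refl A B a b c d a′ b′ c′ d′)
    (solve 10 (λ A B → Law.cancel₃ A B p₁) refl A B a b c d a′ b′ c′ d′)
    (solve 10 (λ A B → Law.cancel₃ A B p₂) refl A B a b c d a′ b′ c′ d′)
    (solve 10 (λ A B → Law.cancel₃ A B p₃) refl A B a b c d a′ b′ c′ d′)

  cancel₄ : ∀ x y z → x * (⟨ ½ ⟩ * y + z) + x * ((- ⟨ ½ ⟩) * y + z) ≡ x * z + x * z
  cancel₄ (quat a b c d) (quat a′ b′ c′ d′) (quat a″ b″ c″ d″) = quat-cong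
    (solve 14 (λ A B → Law.cancel₄ A B p₀) refl A B a b c d a′ b′ c′ d′ a″ b″ c″ d″)
    (solve 14 (λ A B → Law.cancel₄ A B p₁) refl A B a b c d a′ b′ c′ d′ a″ b″ c″ d″)
    (solve 14 (λ A B → Law.cancel₄ A B p₂) refl A B a b c d a′ b′ c′ d′ a″ b″ c″ d″)
    (solve 14 (λ A B → Law.cancel₄ A B p₃) refl A B a b c d a′ b′ c′ d′ a″ b″ c″ d″)

  ζ⁻¹ : .{{_ : Negative α}} → 𝔹
  ζ⁻¹ = quat 0ℚ ((ℚ.1/ (α ℚ./ 1)) {{α≢0}}) 0ℚ 0ℚ

  module _ .{{_ : Negative α}} where
    private
      C : ℚ
      C = (ℚ.1/ A) {{α≢0}}

      AC≡1 : ⟨ A ℚ.* C ⟩ ≡ 1#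
      AC≡1 = cong ⟨_⟩ (ℚₚ.*-inverseʳ A {{α≢0}})

    ζζ⁻¹≡1 : ζ * ζ⁻¹ ≡ 1#
    ζζ⁻¹≡1 = trans (quat-cong
      (solve 3 (λ A B C → let open Law A B in p₀ (ζᵖ ⊗ quatᵖ (con 0ℚ) C (con 0ℚ) (con 0ℚ)) := p₀ (quatᵖ (A :* C) (con 0ℚ) (con 0ℚ) (con 0ℚ))) refl A B C)
      (solve 3 (λ A B C → let open Law A B in p₁ (ζᵖ ⊗ quatᵖ (con 0ℚ) C (con 0ℚ) (con 0ℚ)) := p₁ (quatᵖ (A :* C) (con 0ℚ) (con 0ℚ) (con 0ℚ))) refl A B C)
      (solve 3 (λ A B C → let open Law A B in p₂ (ζᵖ ⊗ quatᵖ (con 0ℚ) C (con 0ℚ) (con 0ℚ)) := p₂ (quatᵖ (A :* C) (con 0ℚ) (con 0ℚ) (con 0ℚ))) refl A B C)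
      (solve 3 (λ A B C → let open Law A B in p₃ (ζᵖ ⊗ quatᵖ (con 0ℚ) C (con 0ℚ) (con 0ℚ)) := p₃ (quatᵖ (A :* C) (con 0ℚ) (con 0ℚ) (con 0ℚ))) refl A B C))
      AC≡1

    ζ⁻¹ζ≡1 : ζ⁻¹ * ζ ≡ 1#
    ζ⁻¹ζ≡1 = trans (quat-cong
      (solve 3 (λ A B C → let open Law A B in p₀ (quatᵖ (con 0ℚ) C (con 0ℚ) (con 0ℚ) ⊗ ζᵖ) := p₀ (quatᵖ (A :* C) (con 0ℚ) (con 0ℚ) (con 0ℚ))) refl A B C)
      (solve 3 (λ A B C → let open Law A B in p₁ (quatᵖ (con 0ℚ) C (con 0ℚ) (con 0ℚ) ⊗ ζᵖ) := p₁ (quatᵖ (A :* C) (con 0ℚ) (con 0ℚ) (con 0ℚ))) refl A B C)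
      (solve 3 (λ A B C → let open Law A B in p₂ (quatᵖ (con 0ℚ) C (con 0ℚ) (con 0ℚ) ⊗ ζᵖ) := p₂ (quatᵖ (A :* C) (con 0ℚ) (con 0ℚ) (con 0ℚ))) refl A B C)
      (solve 3 (λ A B C → let open Law A B in p₃ (quatᵖ (con 0ℚ) C (con 0ℚ) (con 0ℚ) ⊗ ζᵖ) := p₃ (quatᵖ (A :* C) (con 0ℚ) (con 0ℚ) (con 0ℚ))) refl A B C))
      AC≡1

    ζ⁻¹½ζ≡½ : (- ζ⁻¹) * (- (⟨ ½ ⟩ * ζ)) ≡ ⟨ ½ ⟩
    ζ⁻¹½ζ≡½ = trans (quat-cong
      (solve 3 (λ A B C → let open Law A B in p₀ ((⊝ quatᵖ (con 0ℚ) C (con 0ℚ) (con 0ℚ)) ⊗ (⊝ (⟪ ½ ⟫ ⊗ ζᵖ))) := p₀ (⟪ ½ ⟫ ⊗ quatᵖ (A :* C) (con 0ℚ) (con 0ℚ) (con 0ℚ))) refl A B C)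
      (solve 3 (λ A B C → let open Law A B in p₁ ((⊝ quatᵖ (con 0ℚ) C (con 0ℚ) (con 0ℚ)) ⊗ (⊝ (⟪ ½ ⟫ ⊗ ζᵖ))) := p₁ (⟪ ½ ⟫ ⊗ quatᵖ (A :* C) (con 0ℚ) (con 0ℚ) (con 0ℚ))) refl A B C)
      (solve 3 (λ A B C → let open Law A B in p₂ ((⊝ quatᵖ (con 0ℚ) C (con 0ℚ) (con 0ℚ)) ⊗ (⊝ (⟪ ½ ⟫ ⊗ ζᵖ))) := p₂ (⟪ ½ ⟫ ⊗ quatᵖ (A :* C) (con 0ℚ) (con 0ℚ) (con 0ℚ))) refl A B C)
      (solve 3 (λ A B C → let open Law A B in p₃ ((⊝ quatᵖ (con 0ℚ) C (con 0ℚ) (con 0ℚ)) ⊗ (⊝ (⟪ ½ ⟫ ⊗ ζᵖ))) := p₃ (⟪ ½ ⟫ ⊗ quatᵖ (A :* C) (con 0ℚ) (con 0ℚ) (con 0ℚ))) refl A B C))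
      (trans (cong (⟨ ½ ⟩ *_) AC≡1) (*-identityʳ ⟨ ½ ⟩))

    ½ζζ⁻¹≡½ : (- (⟨ ½ ⟩ * ζ)) * (- ζ⁻¹) ≡ ⟨ ½ ⟩
    ½ζζ⁻¹≡½ = trans (quat-cong
      (solve 3 (λ A B C → let open Law A B in p₀ ((⊝ (⟪ ½ ⟫ ⊗ ζᵖ)) ⊗ (⊝ quatᵖ (con 0ℚ) C (con 0ℚ) (con 0ℚ))) := p₀ (⟪ ½ ⟫ ⊗ quatᵖ (A :* C) (con 0ℚ) (con 0ℚ) (con 0ℚ))) refl A B C)
      (solve 3 (λ A B C → let open Law A B in p₁ ((⊝ (⟪ ½ ⟫ ⊗ ζᵖ)) ⊗ (⊝ quatᵖ (con 0ℚ) C (con 0ℚ) (con 0ℚ))) := p₁ (⟪ ½ ⟫ ⊗ quatᵖ (A :* C) (con 0ℚ) (con 0ℚ) (con 0ℚ))) refl A B C)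
      (solve 3 (λ A B C → let open Law A B in p₂ ((⊝ (⟪ ½ ⟫ ⊗ ζᵖ)) ⊗ (⊝ quatᵖ (con 0ℚ) C (con 0ℚ) (con 0ℚ))) := p₂ (⟪ ½ ⟫ ⊗ quatᵖ (A :* C) (con 0ℚ) (con 0ℚ) (con 0ℚ))) refl A B C)
      (solve 3 (λ A B C → let open Law A B in p₃ ((⊝ (⟪ ½ ⟫ ⊗ ζᵖ)) ⊗ (⊝ quatᵖ (con 0ℚ) C (con 0ℚ) (con 0ℚ))) := p₃ (⟪ ½ ⟫ ⊗ quatᵖ (A :* C) (con 0ℚ) (con 0ℚ) (con 0ℚ))) refl A B C))
      (trans (cong (⟨ ½ ⟩ *_) AC≡1) (*-identityʳ ⟨ ½ ⟩))

module Matrices (𝓡 : Ring 0ℓ 0ℓ) (conj : Ring.Carrier 𝓡 → Ring.Carrier 𝓡) where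

  open Ring 𝓡 renaming (sym to ≈-sym; trans to ≈-trans)
  open import Algebra.Properties.Semiring.Sum semiring
    using (sum; sum-cong-≋; sum-replicate-zero)

  Mat : ℕ → ℕ → Set
  Mat p q = Vector (Vector Carrier q) p

  infix  4 _≋_
  infixl 7 _·_
  infix  8 _ᴴ
  infixr 6 _∥_
  infixr 5 _⫽_

  private
    variable
      p p′ q q′ k : ℕ

  _≋_ : Mat p q → Mat p q → Set
  X ≋ Y = ∀ i j → X i j ≈ Y i j

  _·_ : Mat p q → Mat q k → Mat p k
  (X · Y) i j = sum (λ l → X i l * Y l j)

  _ᴴ : Mat p q → Mat q p
  (X ᴴ) i j = conj (X j i)

  𝟎 : Mat p q
  𝟎 i j = 0#

  scalar : Carrier → Mat k k
  scalar x i j = if does (i ≟ j) then x else 0#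

  𝟏 : Mat k k
  𝟏 = scalar 1#

  _∥_ : Mat p q → Mat p q′ → Mat p (q ℕ.+ q′)
  (X ∥ Y) i = X i ++ Y i

  _⫽_ : Mat p q → Mat p′ q → Mat (p ℕ.+ p′) q
  X ⫽ Y = X ++ Y

  diag : Mat p p → Mat q q → Mat (p ℕ.+ q) (p ℕ.+ q)
  diag {p} {q} X Y = (X ∥ 𝟎 {q = q}) ⫽ (𝟎 {q = p} ∥ Y)

  Inverses : Mat k k → Mat k k → Set
  Inverses X Y = (X · Y ≋ 𝟏) × (Y · X ≋ 𝟏)

  GL : ∀ k → Pred (Mat k k) 0ℓ
  GL k g = ∃ λ h → Inverses g h

  Isom : Mat k k → Pred (Mat k k) 0ℓ
  Isom {k} S g = g ∈ GL k × (g ᴴ) · S · g ≋ S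

  -- For S = ζ·1ᵣ this says that the Witt index of φ below is exactly m.  It is
  -- automatic for r ≤ 1, a definite 𝔹 being a division algebra, but it can fail
  -- for r ≥ 2: for α = β = -1 and r = 2 the column x = (1, ξ) is isotropic.
  Anisotropic : Mat k k → Set
  Anisotropic {k} S = ∀ (x : Mat k 1) → (x ᴴ) · S · x ≋ 𝟎 → x ≋ 𝟎

  infix 7 _*ᵥ_
  _*ᵥ_ : Mat p q → Vector Carrier q → Vector Carrier p
  (X *ᵥ v) i = sum (λ l → X i l * v l)

  sum-split : (f : Vector Carrier (p ℕ.+ q)) → sum f ≈ sum (take p f) + sum (drop p f)
  sum-split {zero}  f = ≈-sym (+-identityˡ _)
  sum-split {suc p} f = ≈-trans (+-congˡ (sum-split {p} (f ∘ Fin.suc))) (≈-sym (+-assoc _ _ _))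

  ∥-*ᵥ : ∀ (X : Mat k p) (Y : Mat k q) v i →
         ((X ∥ Y) *ᵥ v) i ≈ (X *ᵥ take p v) i + (Y *ᵥ drop p v) i
  ∥-*ᵥ {p = p} X Y v i = ≈-trans (sum-split {p} _) (+-cong
    (sum-cong-≋ (λ l → *-congʳ (reflexive (lookup-++ˡ (X i) (Y i) l))))
    (sum-cong-≋ (λ l → *-congʳ (reflexive (lookup-++ʳ (X i) (Y i) l)))))

  𝟎-*ᵥ : ∀ (v : Vector Carrier q) (i : Fin p) → (𝟎 *ᵥ v) i ≈ 0#
  𝟎-*ᵥ {q} v i = ≈-trans (sum-cong-≋ (λ l → zeroˡ (v l))) (sum-replicate-zero q)

  scalar-*ᵥ : ∀ x (v : Vector Carrier k) i → (scalar x *ᵥ v) i ≈ x * v i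
  scalar-*ᵥ x v Fin.zero    = ≈-trans (+-congˡ (𝟎-*ᵥ (v ∘ Fin.suc) (Fin.zero {0}))) (+-identityʳ _)
  scalar-*ᵥ x v (Fin.suc i) = ≈-trans (+-cong (zeroˡ _) (scalar-*ᵥ x (v ∘ Fin.suc) i)) (+-identityˡ _)

  *ᵥ-𝟏 : ∀ (X : Mat p q) i j → (X *ᵥ (λ l → 𝟏 l j)) i ≈ X i j
  *ᵥ-𝟏 {q = suc q} X i Fin.zero = ≈-trans
    (+-cong (*-identityʳ _) (≈-trans (sum-cong-≋ (λ l → zeroʳ (X i (Fin.suc l)))) (sum-replicate-zero q)))
    (+-identityʳ _)
  *ᵥ-𝟏 {q = suc q} X i (Fin.suc j) = ≈-trans
    (+-cong (zeroʳ _) (*ᵥ-𝟏 (λ i l → X i (Fin.suc l)) i j)) (+-identityˡ _)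

  *ᵥ-cong : ∀ (X : Mat p q) {v w} → (∀ l → v l ≈ w l) → ∀ i → (X *ᵥ v) i ≈ (X *ᵥ w) i
  *ᵥ-cong X v≈w i = sum-cong-≋ (λ l → *-congˡ (v≈w l))

  -- Block notation for the decompositions n = 2m + r = m + r + m and N = 2n.
  module Blocks (m r : ℕ) where

    private
      variable
        l : ℕ

    n N : ℕ
    n = m ℕ.+ (r ℕ.+ m)
    N = n ℕ.+ n

    ⟦_&_&_⟧ : Mat k m → Mat k r → Mat k m → Mat k n
    ⟦ a & b & c ⟧ = a ∥ b ∥ c

    ⟦_&_&_&_&_&_⟧ : Mat k m → Mat k r → Mat k m → Mat k m → Mat k r → Mat k m → Mat k N
    ⟦ a & b & c & d & e & f ⟧ = ⟦ a & b & c ⟧ ∥ ⟦ d & e & f ⟧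

    rows₃ : Mat m l → Mat r l → Mat m l → Mat n l
    rows₃ a b c = a ⫽ b ⫽ c

    rows₆ : Mat m l → Mat r l → Mat m l → Mat m l → Mat r l → Mat m l → Mat N l
    rows₆ a b c d e f = rows₃ a b c ⫽ rows₃ d e f

    ι₁ ι₃ ι₄ ι₆ : Fin m → Fin N
    ι₂ ι₅ : Fin r → Fin N
    ι₁ i = (i ↑ˡ (r ℕ.+ m)) ↑ˡ n
    ι₂ i = (m ↑ʳ (i ↑ˡ m)) ↑ˡ n
    ι₃ i = (m ↑ʳ (r ↑ʳ i)) ↑ˡ n
    ι₄ i = n ↑ʳ (i ↑ˡ (r ℕ.+ m))
    ι₅ i = n ↑ʳ (m ↑ʳ (i ↑ˡ m))
    ι₆ i = n ↑ʳ (m ↑ʳ (r ↑ʳ i))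

    +-elim : ∀ {p q} (P : Fin (p ℕ.+ q) → Set) →
             (∀ i → P (i ↑ˡ q)) → (∀ i → P (p ↑ʳ i)) → ∀ i → P i
    +-elim {p} {q} P f g i = subst P (join-splitAt p q i) (h (splitAt p i))
      where
      h : ∀ s → P (join p q s)
      h (inj₁ j) = f j
      h (inj₂ j) = g j

    ι-elim : (P : Fin N → Set) →
             (∀ i → P (ι₁ i)) → (∀ i → P (ι₂ i)) → (∀ i → P (ι₃ i)) →
             (∀ i → P (ι₄ i)) → (∀ i → P (ι₅ i)) → (∀ i → P (ι₆ i)) → ∀ i → P i
    ι-elim P a b c d e f = +-elim P
      (+-elim {m} (λ i → P (i ↑ˡ n)) a (+-elim {r} (λ i → P ((m ↑ʳ i) ↑ˡ n)) b c))
      (+-elim {m} (λ i → P (n ↑ʳ i)) d (+-elim {r} (λ i → P (n ↑ʳ (m ↑ʳ i))) e f))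

    row-*ᵥ : ∀ (a : Mat k m) (b : Mat k r) (c d : Mat k m) (e : Mat k r) (f : Mat k m) v i {v₁ v₂ v₃ v₄ v₅ v₆} →
      (a *ᵥ (v ∘ ι₁)) i ≈ v₁ → (b *ᵥ (v ∘ ι₂)) i ≈ v₂ → (c *ᵥ (v ∘ ι₃)) i ≈ v₃ →
      (d *ᵥ (v ∘ ι₄)) i ≈ v₄ → (e *ᵥ (v ∘ ι₅)) i ≈ v₅ → (f *ᵥ (v ∘ ι₆)) i ≈ v₆ →
      (⟦ a & b & c & d & e & f ⟧ *ᵥ v) i ≈ (v₁ + (v₂ + v₃)) + (v₄ + (v₅ + v₆))
    row-*ᵥ a b c d e f v i p₁ p₂ p₃ p₄ p₅ p₆ = ≈-trans (∥-*ᵥ ⟦ a & b & c ⟧ ⟦ d & e & f ⟧ v i) (+-cong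
      (≈-trans (∥-*ᵥ a (b ∥ c) _ i) (+-cong p₁ (≈-trans (∥-*ᵥ b c _ i) (+-cong p₂ p₃))))
      (≈-trans (∥-*ᵥ d (e ∥ f) _ i) (+-cong p₄ (≈-trans (∥-*ᵥ e f _ i) (+-cong p₅ p₆)))))

    module _ (a : Mat m l) (b : Mat r l) (c d : Mat m l) (e : Mat r l) (f : Mat m l)
             (v : Vector Carrier l) where
      private
        X : Mat N l
        X = rows₆ a b c d e f
        at : ∀ {p} {Y : Mat p l} {i j} → X i ≡ Y j → (X *ᵥ v) i ≡ (Y *ᵥ v) j
        at = cong (λ x → sum (λ l → x l * v l))
        up : ∀ i → X (i ↑ˡ n) ≡ rows₃ a b c i
        up = lookup-++ˡ (rows₃ a b c) (rows₃ d e f)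
        dn : ∀ i → X (n ↑ʳ i) ≡ rows₃ d e f i
        dn = lookup-++ʳ (rows₃ a b c) (rows₃ d e f)
      at₁ : ∀ i → (X *ᵥ v) (ι₁ i) ≡ (a *ᵥ v) i
      at₁ i = at {Y = a} (trans (up _) (lookup-++ˡ a (b ⫽ c) i))
      at₂ : ∀ i → (X *ᵥ v) (ι₂ i) ≡ (b *ᵥ v) i
      at₂ i = at {Y = b} (trans (up _) (trans (lookup-++ʳ a (b ⫽ c) _) (lookup-++ˡ b c i)))
      at₃ : ∀ i → (X *ᵥ v) (ι₃ i) ≡ (c *ᵥ v) i
      at₃ i = at {Y = c} (trans (up _) (trans (lookup-++ʳ a (b ⫽ c) _) (lookup-++ʳ b c i)))
      at₄ : ∀ i → (X *ᵥ v) (ι₄ i) ≡ (d *ᵥ v) i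
      at₄ i = at {Y = d} (trans (dn _) (lookup-++ˡ d (e ⫽ f) i))
      at₅ : ∀ i → (X *ᵥ v) (ι₅ i) ≡ (e *ᵥ v) i
      at₅ i = at {Y = e} (trans (dn _) (trans (lookup-++ʳ d (e ⫽ f) _) (lookup-++ˡ e f i)))
      at₆ : ∀ i → (X *ᵥ v) (ι₆ i) ≡ (f *ᵥ v) i
      at₆ i = at {Y = f} (trans (dn _) (trans (lookup-++ʳ d (e ⫽ f) _) (lookup-++ʳ e f i)))

    0+0+0≈0 : 0# + (0# + 0#) ≈ 0#
    0+0+0≈0 = ≈-trans (+-identityˡ _) (+-identityˡ _)

    only₁ : ∀ x (v : Vector Carrier N) (i : Fin m) →
      (⟦ scalar x & 𝟎 & 𝟎 & 𝟎 & 𝟎 & 𝟎 ⟧ *ᵥ v) i ≈ x * v (ι₁ i)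
    only₁ x v i = ≈-trans
      (row-*ᵥ (scalar x) 𝟎 𝟎 𝟎 𝟎 𝟎 v i
        (scalar-*ᵥ x _ i) (𝟎-*ᵥ (v ∘ ι₂) i) (𝟎-*ᵥ (v ∘ ι₃) i)
        (𝟎-*ᵥ (v ∘ ι₄) i) (𝟎-*ᵥ (v ∘ ι₅) i) (𝟎-*ᵥ (v ∘ ι₆) i))
      (≈-trans (+-cong (≈-trans (+-congˡ (+-identityʳ _)) (+-identityʳ _)) 0+0+0≈0) (+-identityʳ _))

    only₃ : ∀ x (v : Vector Carrier N) (i : Fin m) →
      (⟦ 𝟎 & 𝟎 & scalar x & 𝟎 & 𝟎 & 𝟎 ⟧ *ᵥ v) i ≈ x * v (ι₃ i)
    only₃ x v i = ≈-trans
      (row-*ᵥ 𝟎 𝟎 (scalar x) 𝟎 𝟎 𝟎 v i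
        (𝟎-*ᵥ (v ∘ ι₁) i) (𝟎-*ᵥ (v ∘ ι₂) i) (scalar-*ᵥ x _ i)
        (𝟎-*ᵥ (v ∘ ι₄) i) (𝟎-*ᵥ (v ∘ ι₅) i) (𝟎-*ᵥ (v ∘ ι₆) i))
      (≈-trans (+-cong (≈-trans (+-identityˡ _) (+-identityˡ _)) 0+0+0≈0) (+-identityʳ _))

    only₄ : ∀ x (v : Vector Carrier N) (i : Fin m) →
      (⟦ 𝟎 & 𝟎 & 𝟎 & scalar x & 𝟎 & 𝟎 ⟧ *ᵥ v) i ≈ x * v (ι₄ i)
    only₄ x v i = ≈-trans
      (row-*ᵥ 𝟎 𝟎 𝟎 (scalar x) 𝟎 𝟎 v i
        (𝟎-*ᵥ (v ∘ ι₁) i) (𝟎-*ᵥ (v ∘ ι₂) i) (𝟎-*ᵥ (v ∘ ι₃) i)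
        (scalar-*ᵥ x _ i) (𝟎-*ᵥ (v ∘ ι₅) i) (𝟎-*ᵥ (v ∘ ι₆) i))
      (≈-trans (+-cong 0+0+0≈0 (≈-trans (+-congˡ (+-identityʳ _)) (+-identityʳ _))) (+-identityˡ _))

    only₆ : ∀ x (v : Vector Carrier N) (i : Fin m) →
      (⟦ 𝟎 & 𝟎 & 𝟎 & 𝟎 & 𝟎 & scalar x ⟧ *ᵥ v) i ≈ x * v (ι₆ i)
    only₆ x v i = ≈-trans
      (row-*ᵥ 𝟎 𝟎 𝟎 𝟎 𝟎 (scalar x) v i
        (𝟎-*ᵥ (v ∘ ι₁) i) (𝟎-*ᵥ (v ∘ ι₂) i) (𝟎-*ᵥ (v ∘ ι₃) i)
        (𝟎-*ᵥ (v ∘ ι₄) i) (𝟎-*ᵥ (v ∘ ι₅) i) (scalar-*ᵥ x _ i))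
      (≈-trans (+-cong 0+0+0≈0 (≈-trans (+-identityˡ _) (+-identityˡ _))) (+-identityˡ _))

    only₂₅ : ∀ x y (v : Vector Carrier N) (i : Fin r) →
      (⟦ 𝟎 & scalar x & 𝟎 & 𝟎 & scalar y & 𝟎 ⟧ *ᵥ v) i ≈ x * v (ι₂ i) + y * v (ι₅ i)
    only₂₅ x y v i = ≈-trans
      (row-*ᵥ 𝟎 (scalar x) 𝟎 𝟎 (scalar y) 𝟎 v i
        (𝟎-*ᵥ (v ∘ ι₁) i) (scalar-*ᵥ x _ i) (𝟎-*ᵥ (v ∘ ι₃) i)
        (𝟎-*ᵥ (v ∘ ι₄) i) (scalar-*ᵥ y _ i) (𝟎-*ᵥ (v ∘ ι₆) i))
      (+-cong (≈-trans (+-identityˡ _) (+-identityʳ _)) (≈-trans (+-identityˡ _) (+-identityʳ _)))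

module Doubling (α β : ℤ) .{{_ : Negative α}} (m r : ℕ) where

  open Quaternion α β public
  open Matrices 𝔹-ring conj public
  open Blocks m r public

  φ : Mat n n
  φ = rows₃
    ⟦ 𝟎 & 𝟎        & scalar (- 1#) ⟧
    ⟦ 𝟎 & scalar ζ & 𝟎             ⟧
    ⟦ 𝟏 & 𝟎        & 𝟎             ⟧

  Jₙ : Mat N N
  Jₙ = (𝟎 {q = n} ∥ scalar (- 1#)) ⫽ (𝟏 {n} ∥ 𝟎)

  Gₙ : Pred (Mat n n) 0ℓ
  Gₙ = Isom φ

  GN : Pred (Mat N N) 0ℓ
  GN = Isom Jₙ

  PN : Pred (Mat N N) 0ℓ
  PN g = g ∈ GN × (∀ (i j : Fin n) → g (n ↑ʳ i) (j ↑ˡ n) ≡ 0#)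

  R : Mat N N
  R = rows₆
    ⟦ 𝟏 & 𝟎                & 𝟎             & 𝟎 & 𝟎              & 𝟎 ⟧
    ⟦ 𝟎 & scalar ⟨ ½ ⟩     & 𝟎             & 𝟎 & scalar (- ζ⁻¹) & 𝟎 ⟧
    ⟦ 𝟎 & 𝟎                & 𝟎             & 𝟏 & 𝟎              & 𝟎 ⟧
    ⟦ 𝟎 & 𝟎                & scalar (- 1#) & 𝟎 & 𝟎              & 𝟎 ⟧
    ⟦ 𝟎 & scalar (- ⟨ ½ ⟩) & 𝟎             & 𝟎 & scalar (- ζ⁻¹) & 𝟎 ⟧
    ⟦ 𝟎 & 𝟎                & 𝟎             & 𝟎 & 𝟎              & 𝟏 ⟧

  R⁻¹ : Mat N N
  R⁻¹ = rows₆
    ⟦ 𝟏 & 𝟎                      & 𝟎 & 𝟎             & 𝟎                      & 𝟎 ⟧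
    ⟦ 𝟎 & 𝟏                      & 𝟎 & 𝟎             & scalar (- 1#)          & 𝟎 ⟧
    ⟦ 𝟎 & 𝟎                      & 𝟎 & scalar (- 1#) & 𝟎                      & 𝟎 ⟧
    ⟦ 𝟎 & 𝟎                      & 𝟏 & 𝟎             & 𝟎                      & 𝟎 ⟧
    ⟦ 𝟎 & scalar (- (⟨ ½ ⟩ * ζ)) & 𝟎 & 𝟎             & scalar (- (⟨ ½ ⟩ * ζ)) & 𝟎 ⟧
    ⟦ 𝟎 & 𝟎                      & 𝟎 & 𝟎             & 𝟎                      & 𝟏 ⟧

  private
    at-R : ∀ v →
      (∀ i → (R *ᵥ v) (ι₁ i) ≡ 1# * v (ι₁ i)) ×
      (∀ i → (R *ᵥ v) (ι₂ i) ≡ ⟨ ½ ⟩ * v (ι₂ i) + (- ζ⁻¹) * v (ι₅ i)) ×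
      (∀ i → (R *ᵥ v) (ι₃ i) ≡ 1# * v (ι₄ i)) ×
      (∀ i → (R *ᵥ v) (ι₄ i) ≡ (- 1#) * v (ι₃ i)) ×
      (∀ i → (R *ᵥ v) (ι₅ i) ≡ (- ⟨ ½ ⟩) * v (ι₂ i) + (- ζ⁻¹) * v (ι₅ i)) ×
      (∀ i → (R *ᵥ v) (ι₆ i) ≡ 1# * v (ι₆ i))
    at-R v =
      (λ i → trans (at₁ _ _ _ _ _ _ v i) (only₁ _ v i)) ,
      (λ i → trans (at₂ _ _ _ _ _ _ v i) (only₂₅ _ _ v i)) ,
      (λ i → trans (at₃ _ _ _ _ _ _ v i) (only₄ _ v i)) ,
      (λ i → trans (at₄ _ _ _ _ _ _ v i) (only₃ _ v i)) ,
      (λ i → trans (at₅ _ _ _ _ _ _ v i) (only₂₅ _ _ v i)) ,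
      (λ i → trans (at₆ _ _ _ _ _ _ v i) (only₆ _ v i))

    -½ζ : 𝔹
    -½ζ = - (⟨ ½ ⟩ * ζ)

    at-R⁻¹ : ∀ v →
      (∀ i → (R⁻¹ *ᵥ v) (ι₁ i) ≡ 1# * v (ι₁ i)) ×
      (∀ i → (R⁻¹ *ᵥ v) (ι₂ i) ≡ 1# * v (ι₂ i) + (- 1#) * v (ι₅ i)) ×
      (∀ i → (R⁻¹ *ᵥ v) (ι₃ i) ≡ (- 1#) * v (ι₄ i)) ×
      (∀ i → (R⁻¹ *ᵥ v) (ι₄ i) ≡ 1# * v (ι₃ i)) ×
      (∀ i → (R⁻¹ *ᵥ v) (ι₅ i) ≡ -½ζ * v (ι₂ i) + -½ζ * v (ι₅ i)) ×
      (∀ i → (R⁻¹ *ᵥ v) (ι₆ i) ≡ 1# * v (ι₆ i))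
    at-R⁻¹ v =
      (λ i → trans (at₁ _ _ _ _ _ _ v i) (only₁ _ v i)) ,
      (λ i → trans (at₂ _ _ _ _ _ _ v i) (only₂₅ _ _ v i)) ,
      (λ i → trans (at₃ _ _ _ _ _ _ v i) (only₄ _ v i)) ,
      (λ i → trans (at₄ _ _ _ _ _ _ v i) (only₃ _ v i)) ,
      (λ i → trans (at₅ _ _ _ _ _ _ v i) (only₂₅ _ _ v i)) ,
      (λ i → trans (at₆ _ _ _ _ _ _ v i) (only₆ _ v i))

    1·1· : ∀ {x y} → y ≡ 1# * x → 1# * y ≡ x
    1·1· {x} {y} y≡ = trans (*-identityˡ y) (trans y≡ (*-identityˡ x))

    -1·-1· : ∀ {x y} → y ≡ (- 1#) * x → (- 1#) * y ≡ x
    -1·-1· {x} y≡ = trans (cong ((- 1#) *_) y≡) (-1*-1* x)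

    -ζ⁻¹·-½ζ· : ∀ x y → (- ζ⁻¹) * (-½ζ * x + -½ζ * y) ≡ ⟨ ½ ⟩ * x + ⟨ ½ ⟩ * y
    -ζ⁻¹·-½ζ· x y = trans (*-distribˡ-+ (- ζ⁻¹) (-½ζ * x) (-½ζ * y)) (cong₂ _+_
      (trans (sym (*-assoc (- ζ⁻¹) -½ζ x)) (cong (_* x) ζ⁻¹½ζ≡½))
      (trans (sym (*-assoc (- ζ⁻¹) -½ζ y)) (cong (_* y) ζ⁻¹½ζ≡½)))

    RR⁻¹v≡v : ∀ v i → (R *ᵥ (R⁻¹ *ᵥ v)) i ≡ v i
    RR⁻¹v≡v v =
      let r₁ , r₂ , r₃ , r₄ , r₅ , r₆ = at-R (R⁻¹ *ᵥ v)
          s₁ , s₂ , s₃ , s₄ , s₅ , s₆ = at-R⁻¹ v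
      in ι-elim (λ i → (R *ᵥ (R⁻¹ *ᵥ v)) i ≡ v i)
      (λ i → trans (r₁ i) (1·1· (s₁ i)))
      (λ i → trans (r₂ i) (trans
        (cong₂ _+_ (cong (⟨ ½ ⟩ *_) (s₂ i))
                   (trans (cong ((- ζ⁻¹) *_) (s₅ i)) (-ζ⁻¹·-½ζ· (v (ι₂ i)) (v (ι₅ i)))))
        (cancel₁ (v (ι₂ i)) (v (ι₅ i)))))
      (λ i → trans (r₃ i) (1·1· (s₄ i)))
      (λ i → trans (r₄ i) (-1·-1· (s₃ i)))
      (λ i → trans (r₅ i) (trans
        (cong₂ _+_ (cong ((- ⟨ ½ ⟩) *_) (s₂ i))
                   (trans (cong ((- ζ⁻¹) *_) (s₅ i)) (-ζ⁻¹·-½ζ· (v (ι₂ i)) (v (ι₅ i)))))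
        (cancel₂ (v (ι₂ i)) (v (ι₅ i)))))
      (λ i → trans (r₆ i) (1·1· (s₆ i)))

    R⁻¹Rv≡v : ∀ v i → (R⁻¹ *ᵥ (R *ᵥ v)) i ≡ v i
    R⁻¹Rv≡v v =
      let s₁ , s₂ , s₃ , s₄ , s₅ , s₆ = at-R⁻¹ (R *ᵥ v)
          r₁ , r₂ , r₃ , r₄ , r₅ , r₆ = at-R v
      in ι-elim (λ i → (R⁻¹ *ᵥ (R *ᵥ v)) i ≡ v i)
      (λ i → trans (s₁ i) (1·1· (r₁ i)))
      (λ i → trans (s₂ i) (trans
        (cong₂ (λ x y → 1# * x + (- 1#) * y) (r₂ i) (r₅ i))
        (cancel₃ (v (ι₂ i)) ((- ζ⁻¹) * v (ι₅ i)))))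
      (λ i → trans (s₃ i) (-1·-1· (r₄ i)))
      (λ i → trans (s₄ i) (1·1· (r₃ i)))
      (λ i → let x = (- ζ⁻¹) * v (ι₅ i)
                 ½v = trans (sym (*-assoc -½ζ (- ζ⁻¹) (v (ι₅ i)))) (cong (_* v (ι₅ i)) ½ζζ⁻¹≡½)
             in trans (s₅ i) (trans
        (cong₂ (λ x y → -½ζ * x + -½ζ * y) (r₂ i) (r₅ i)) (trans
        (cancel₄ -½ζ (v (ι₂ i)) x) (trans
        (cong₂ _+_ ½v ½v)
        (halves (v (ι₅ i)))))))
      (λ i → trans (s₆ i) (1·1· (r₆ i)))

  R-inverse : Inverses R R⁻¹
  R-inverse =
    (λ i j → trans (*ᵥ-cong R (λ l → sym (*ᵥ-𝟏 R⁻¹ l j)) i) (RR⁻¹v≡v (λ l → 𝟏 l j) i)) ,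
    (λ i j → trans (*ᵥ-cong R⁻¹ (λ l → sym (*ᵥ-𝟏 R l j)) i) (R⁻¹Rv≡v (λ l → 𝟏 l j) i))

  doubling : Mat n n → Mat n n → Mat N N
  doubling g₁ g₂ = R⁻¹ · diag g₁ g₂ · R

  e : Fin (suc m) → Mat m m
  e t i j = if does (i ≟ j) ∧ does (toℕ i <? toℕ t) then 1# else 0#

  τ : Fin (suc m) → Mat N N
  τ t = rows₆
    ⟦ 𝟏       & 𝟎 & 𝟎   & 𝟎 & 𝟎 & 𝟎 ⟧
    ⟦ 𝟎       & 𝟏 & 𝟎   & 𝟎 & 𝟎 & 𝟎 ⟧
    ⟦ 𝟎       & 𝟎 & 𝟏   & 𝟎 & 𝟎 & 𝟎 ⟧
    ⟦ 𝟎       & 𝟎 & e t & 𝟏 & 𝟎 & 𝟎 ⟧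
    ⟦ 𝟎       & 𝟎 & 𝟎   & 𝟎 & 𝟏 & 𝟎 ⟧
    ⟦ (e t) ᴴ & 𝟎 & 𝟎   & 𝟎 & 𝟎 & 𝟏 ⟧

  -- g and h lie in the same double coset of PN \ GN / (Gₙ × Gₙ).
  infix 4 _∼_
  _∼_ : Mat N N → Mat N N → Set
  g ∼ h = ∃[ p ] ∃[ g₁ ] ∃[ g₂ ]
    (p ∈ PN × g₁ ∈ Gₙ × g₂ ∈ Gₙ × p · g · doubling g₁ g₂ ≋ h)

{-# OPTIONS --safe #-}

-- Let V be the space of row vectors with the skew-hermitian form x φ⁻¹ y*.  The bottom
-- n rows of g R⁻¹ span a Lagrangian subspace L of V ⊕ (- V), which determines P_N g, and
-- G_n × G_n acts on the two summands.  The isotropic spaces L ∩ (V ⊕ 0) and L ∩ (0 ⊕ V)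
-- have the same dimension k, and L induces an isometry between W^⊥ / W for these two
-- spaces W.  Witt's theorem lifts it to an isometry u of V, after which L consists of
-- pairs differing by elements of L ∩ (V ⊕ 0).  Witt's theorem also moves the isotropic
-- spaces of two Lagrangians with the same k onto each other, and then the Lagrangians are
-- orthogonal; being maximal they coincide, so k is a complete invariant of the double
-- coset.  Anisotropy gives k ≤ m, and k = m - t for τ_t.
module Submission where

open import Algebra.Bundles using (Ring)
open import Data.Bool.Base using (Bool; true; false; _xor_; if_then_else_; _∧_; T)
open import Data.Bool.Properties using (∧-identityʳ; ∧-zeroʳ)
open import Data.Empty using (⊥; ⊥-elim)
open import Data.Fin.Base as Fin using (Fin; toℕ; splitAt; _↑ˡ_; _↑ʳ_)
open import Data.Fin.Patterns using (0F; 1F; 2F; 3F; 4F; 5F)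
import Data.Fin.Properties as Finₚ
open import Data.Integer.Base as ℤ using (ℤ; Negative)
open import Data.List.Base using (List; []; _∷_; _++_)
open import Data.Maybe.Base using (Maybe; just; nothing)
open import Data.Nat.Base as ℕ using (ℕ; zero; suc; _≤_; _<_; z≤n; s≤s)
import Data.Nat.Coprimality as Coprime
import Data.Nat.Properties as ℕₚ
open import Data.Product using (Σ; ∃!; ∃-syntax; _×_; _,_; proj₁; proj₂)
open import Data.Rational.Base as ℚ using (ℚ; 0ℚ; 1ℚ)
import Data.Rational.Properties as ℚₚ
open import Data.Rational.Solver using (module +-*-Solver)
open import Data.Sum.Base using (inj₁; inj₂)
open import Data.Unit.Base using (⊤)
open import Data.Vec.Base using (Vec; []; _∷_; lookup)
open import Data.Vec.Functional.Properties using (lookup-++ˡ; lookup-++ʳ)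
open import Function.Base using (_∘_)
open import Level using (0ℓ)
open import Relation.Binary.Definitions using (Decidable; tri<; tri≈; tri>)
open import Relation.Binary.PropositionalEquality using (_≡_; refl; subst; sym; cong; trans)
open import Relation.Nullary using (Dec; yes; no; ¬_; does)
open import Relation.Nullary.Decidable using (dec-true; dec-false)
open import Relation.Unary using (_∈_)
open import Defs


record Involution (𝓡 : Ring 0ℓ 0ℓ) : Set where
  open Ring 𝓡
  field
    conj            : Carrier → Carrier
    conj-cong       : ∀ {x y} → x ≈ y → conj x ≈ conj y
    conj-involutive : ∀ x → conj (conj x) ≈ x
    conj-+          : ∀ x y → conj (x + y) ≈ conj x + conj y
    conj-*          : ∀ x y → conj (x * y) ≈ conj y * conj x

module MatrixAlgebra (𝓡 : Ring 0ℓ 0ℓ) (involution : Involution 𝓡) where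

  open Involution involution public
  open Ring 𝓡 hiding (zero; refl; -_)
  open Ring 𝓡 using () renaming (refl to ≈-refl; sym to ≈-sym; trans to ≈-trans; -_ to neg)
  open Matrices 𝓡 conj public
  open import Algebra.Properties.Ring 𝓡
  open import Algebra.Properties.Semiring.Sum semiring
    using (sum; sum-cong-≋; sum-replicate-zero; ∑-distrib-+; ∑-comm; *-distribˡ-sum; *-distribʳ-sum)

  infixl 6 _⊞_
  infix  8 ⊟_

  private
    variable
      p q k l : ℕ

  _⊞_ : Mat p q → Mat p q → Mat p q
  (X ⊞ Y) i j = X i j + Y i j

  ⊟_ : Mat p q → Mat p q
  (⊟ X) i j = neg (X i j)

  ≋-refl : {X : Mat p q} → X ≋ X
  ≋-refl i j = ≈-refl

  ≋-sym : {X Y : Mat p q} → X ≋ Y → Y ≋ X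
  ≋-sym e i j = ≈-sym (e i j)

  ≋-trans : {X Y Z : Mat p q} → X ≋ Y → Y ≋ Z → X ≋ Z
  ≋-trans e f i j = ≈-trans (e i j) (f i j)

  conj-0 : conj 0# ≈ 0#
  conj-0 = x+x≈x⇒x≈0 _ (≈-trans (≈-sym (conj-+ 0# 0#)) (conj-cong (+-identityˡ 0#)))

  conj-1 : conj 1# ≈ 1#
  conj-1 = ≈-trans (≈-sym (*-identityʳ _)) (≈-trans (*-congˡ (≈-sym (conj-involutive 1#)))
    (≈-trans (≈-sym (conj-* (conj 1#) 1#)) (≈-trans (conj-cong (*-identityʳ _)) (conj-involutive 1#))))

  conj-neg : ∀ x → conj (neg x) ≈ neg (conj x)
  conj-neg x = +-inverseˡ-unique _ _
    (≈-trans (≈-sym (conj-+ _ _)) (≈-trans (conj-cong (-‿inverseˡ x)) conj-0))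

  conj-sum : ∀ {k} (f : Fin k → Carrier) → conj (sum f) ≈ sum (λ i → conj (f i))
  conj-sum {zero}  f = conj-0
  conj-sum {suc k} f = ≈-trans (conj-+ _ _) (+-congˡ (conj-sum (λ i → f (Fin.suc i))))

  sum-neg : ∀ {k} (f : Fin k → Carrier) → sum (λ i → neg (f i)) ≈ neg (sum f)
  sum-neg {zero}  f = ≈-sym -0#≈0#
  sum-neg {suc k} f = ≈-trans (+-congˡ (sum-neg (λ i → f (Fin.suc i)))) (-‿+-comm _ _)

  ·-cong : {X X′ : Mat p q} {Y Y′ : Mat q k} → X ≋ X′ → Y ≋ Y′ → X · Y ≋ X′ · Y′
  ·-cong e f i j = sum-cong-≋ (λ l → *-cong (e i l) (f l j))

  ·-congˡ : (Z : Mat p q) {X Y : Mat q k} → X ≋ Y → Z · X ≋ Z · Y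
  ·-congˡ Z = ·-cong (≋-refl {X = Z})

  ·-congʳ : (Z : Mat q k) {X Y : Mat p q} → X ≋ Y → X · Z ≋ Y · Z
  ·-congʳ Z e = ·-cong e (≋-refl {X = Z})

  ⊞-cong : {X X′ Y Y′ : Mat p q} → X ≋ X′ → Y ≋ Y′ → X ⊞ Y ≋ X′ ⊞ Y′
  ⊞-cong e f i j = +-cong (e i j) (f i j)

  ⊟-cong : {X X′ : Mat p q} → X ≋ X′ → ⊟ X ≋ ⊟ X′
  ⊟-cong e i j = -‿cong (e i j)

  ᴴ-cong : {X X′ : Mat p q} → X ≋ X′ → X ᴴ ≋ X′ ᴴ
  ᴴ-cong e i j = conj-cong (e j i)

  sum-cong : ∀ {k} (f g : Fin k → Carrier) → (∀ i → f i ≈ g i) → sum f ≈ sum g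
  sum-cong f g = sum-cong-≋ {x = f} {y = g}

  ·-assoc : (X : Mat p q) (Y : Mat q k) (Z : Mat k l) → (X · Y) · Z ≋ X · (Y · Z)
  ·-assoc {p} {q} {k} X Y Z i j = ≈-trans
    (sum-cong (λ b → (X · Y) i b * Z b j) (λ b → sum (λ a → X i a * Y a b * Z b j))
      (λ b → *-distribʳ-sum (Z b j) (λ a → X i a * Y a b)))
    (≈-trans (≈-sym (∑-comm (λ a b → X i a * Y a b * Z b j)))
    (sum-cong (λ a → sum (λ b → X i a * Y a b * Z b j)) (λ a → X i a * (Y · Z) a j) (λ a → ≈-trans
      (sum-cong (λ b → X i a * Y a b * Z b j) (λ b → X i a * (Y a b * Z b j)) (λ b → *-assoc _ _ _))
      (≈-sym (*-distribˡ-sum (X i a) (λ b → Y a b * Z b j))))))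

  ·-distribˡ : (X : Mat p q) (Y Z : Mat q k) → X · (Y ⊞ Z) ≋ X · Y ⊞ X · Z
  ·-distribˡ X Y Z i j = ≈-trans
    (sum-cong (λ l → X i l * (Y l j + Z l j)) (λ l → X i l * Y l j + X i l * Z l j) (λ l → distribˡ _ _ _))
    (∑-distrib-+ (λ l → X i l * Y l j) (λ l → X i l * Z l j))

  ·-distribʳ : (X Y : Mat p q) (Z : Mat q k) → (X ⊞ Y) · Z ≋ X · Z ⊞ Y · Z
  ·-distribʳ X Y Z i j = ≈-trans
    (sum-cong (λ l → (X i l + Y i l) * Z l j) (λ l → X i l * Z l j + Y i l * Z l j) (λ l → distribʳ _ _ _))
    (∑-distrib-+ (λ l → X i l * Z l j) (λ l → Y i l * Z l j))

  ⊟-·ˡ : (X : Mat p q) (Y : Mat q k) → (⊟ X) · Y ≋ ⊟ (X · Y)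
  ⊟-·ˡ X Y i j = ≈-trans
    (sum-cong (λ l → neg (X i l) * Y l j) (λ l → neg (X i l * Y l j)) (λ l → ≈-sym (-‿distribˡ-* _ _)))
    (sum-neg (λ l → X i l * Y l j))

  ⊟-·ʳ : (X : Mat p q) (Y : Mat q k) → X · (⊟ Y) ≋ ⊟ (X · Y)
  ⊟-·ʳ X Y i j = ≈-trans
    (sum-cong (λ l → X i l * neg (Y l j)) (λ l → neg (X i l * Y l j)) (λ l → ≈-sym (-‿distribʳ-* _ _)))
    (sum-neg (λ l → X i l * Y l j))

  𝟎-· : (Y : Mat q k) → 𝟎 {p = p} · Y ≋ 𝟎
  𝟎-· Y i j = 𝟎-*ᵥ (λ l → Y l j) i

  ·-𝟎 : (X : Mat p q) → X · 𝟎 {q = k} ≋ 𝟎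
  ·-𝟎 {q = q} X i j = ≈-trans
    (sum-cong (λ l → X i l * 0#) (λ l → 0#) (λ l → zeroʳ _)) (sum-replicate-zero q)

  𝟏-· : (X : Mat p q) → 𝟏 · X ≋ X
  𝟏-· X i j = ≈-trans (scalar-*ᵥ 1# (λ l → X l j) i) (*-identityˡ _)

  ·-𝟏 : (X : Mat p q) → X · 𝟏 ≋ X
  ·-𝟏 X i j = *ᵥ-𝟏 X i j

  ᴴ-involutive : (X : Mat p q) → (X ᴴ) ᴴ ≋ X
  ᴴ-involutive X i j = conj-involutive _

  ᴴ-· : (X : Mat p q) (Y : Mat q k) → (X · Y) ᴴ ≋ Y ᴴ · X ᴴ
  ᴴ-· X Y j′ i′ = ≈-trans (conj-sum (λ l → X i′ l * Y l j′))
    (sum-cong (λ l → conj (X i′ l * Y l j′)) (λ l → conj (Y l j′) * conj (X i′ l)) (λ l → conj-* _ _))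

  scalar-ᴴ : ∀ {k} x → scalar {k} x ᴴ ≋ scalar (conj x)
  scalar-ᴴ x i j with i Finₚ.≟ j | j Finₚ.≟ i
  ... | yes _    | yes _  = ≈-refl
  ... | no _     | no _   = conj-0
  ... | yes refl | no ¬p with () ← ¬p refl
  ... | no ¬p    | yes refl with () ← ¬p refl

  scalar-cong : ∀ {k x y} → x ≈ y → scalar {k} x ≋ scalar y
  scalar-cong e i j with i Finₚ.≟ j
  ... | yes _ = e
  ... | no _  = ≈-refl

  scalar-· : ∀ {k} x y → scalar {k} x · scalar y ≋ scalar (x * y)
  scalar-· x y i j = ≈-trans (scalar-*ᵥ x (λ l → scalar y l j) i) lem
    where
    lem : x * scalar y i j ≈ scalar (x * y) i j
    lem with i Finₚ.≟ j
    ... | yes _ = ≈-refl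
    ... | no _  = zeroʳ x

  scalar-neg : ∀ {k} x → scalar {k} (neg x) ≋ ⊟ scalar x
  scalar-neg x i j with i Finₚ.≟ j
  ... | yes _ = ≈-refl
  ... | no _  = ≈-sym -0#≈0#

  scalar-+ : ∀ {k} x y → scalar {k} (x + y) ≋ scalar x ⊞ scalar y
  scalar-+ x y i j with i Finₚ.≟ j
  ... | yes _ = ≈-refl
  ... | no _  = ≈-sym (+-identityˡ 0#)

  𝟏-ᴴ : ∀ {k} → 𝟏 {k} ᴴ ≋ 𝟏
  𝟏-ᴴ = ≋-trans (scalar-ᴴ 1#) (scalar-cong conj-1)

  𝟎-ᴴ : 𝟎 {p = p} {q = q} ᴴ ≋ 𝟎
  𝟎-ᴴ i j = conj-0

  -- A decision procedure for the additive category with involution of matrices: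
  -- both sides are expanded into signed sums of paths, the hypotheses are used as
  -- rewriting rules whose left-hand sides are paths, and opposite terms are cancelled.
  -- The matrix sizes are indexed by Fin o, so that composability is decidable.
  module Solver {o v} (dims : Vec ℕ o) (sig : Vec (Fin o × Fin o) v) where

    Obj : Set
    Obj = Fin o

    M : Obj → Obj → Set
    M i j = Mat (lookup dims i) (lookup dims j)

    src tgt : Fin v → Obj
    src x = proj₁ (lookup sig x)
    tgt x = proj₂ (lookup sig x)

    infixl 6 _⊕_ _⊖_
    infixl 7 _⊙_
    infix  8 ⊝_ _†
    infix  4 _⇒_

    data Expr : Obj → Obj → Set where
      var         : ∀ x → Expr (src x) (tgt x)
      𝟘           : ∀ {i j} → Expr i j
      𝕀           : ∀ {i} → Expr i i
      _⊕_ _⊖_     : ∀ {i j} → Expr i j → Expr i j → Expr i j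
      ⊝_          : ∀ {i j} → Expr i j → Expr i j
      _⊙_         : ∀ {i j k} → Expr i j → Expr j k → Expr i k
      _†          : ∀ {i j} → Expr i j → Expr j i

    data Equation : Set where
      _⇒_ : ∀ {i j} → Expr i j → Expr i j → Equation

    Env : ∀ {w} → Vec (Obj × Obj) w → Set
    Env []            = ⊤
    Env ((i , j) ∷ s) = M i j × Env s

    Variables : ∀ {w} → Vec (Obj × Obj) w → Set → Set
    Variables []            A = A
    Variables ((i , j) ∷ s) A = Expr i j → Variables s A

    at : ∀ {w} (s : Vec (Obj × Obj) w) → Env s → ∀ x → M (proj₁ (lookup s x)) (proj₂ (lookup s x))
    at (_ ∷ s) (X , ρ) Fin.zero    = X
    at (_ ∷ s) (X , ρ) (Fin.suc x) = at s ρ x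

    supply : ∀ {w A} (s : Vec (Obj × Obj) w) → (∀ x → Expr (proj₁ (lookup s x)) (proj₂ (lookup s x))) →
             Variables s A → A
    supply []      f e = e
    supply (_ ∷ s) f e = supply s (λ x → f (Fin.suc x)) (e (f Fin.zero))

    ends : Fin v → Bool → Obj × Obj
    ends x false = src x , tgt x
    ends x true  = tgt x , src x

    record Letter (i j : Obj) : Set where
      constructor letter
      field
        name    : Fin v
        adjoint : Bool
        typed   : ends name adjoint ≡ (i , j)

    infixr 5 _◂_ _⟫_

    data Path : Obj → Obj → Set where
      ε   : ∀ {i} → Path i i
      _◂_ : ∀ {i j k} → Letter i j → Path j k → Path i k

    Poly : Obj → Obj → Set
    Poly i j = List (Bool × Path i j)

    _⟫_ : ∀ {i j k} → Path i j → Path j k → Path i k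
    ε       ⟫ q = q
    (a ◂ p) ⟫ q = a ◂ (p ⟫ q)

    adjointᴸ : ∀ {i j} → Letter i j → Letter j i
    adjointᴸ (letter x false refl) = letter x true refl
    adjointᴸ (letter x true  refl) = letter x false refl

    adjointᴾ : ∀ {i j} → Path i j → Path j i
    adjointᴾ ε       = ε
    adjointᴾ (a ◂ p) = adjointᴾ p ⟫ (adjointᴸ a ◂ ε)

    mapᴾ : ∀ {i j k l} → (Path i j → Path k l) → Bool → Poly i j → Poly k l
    mapᴾ f t []            = []
    mapᴾ f t ((s , p) ∷ P) = (t xor s , f p) ∷ mapᴾ f t P

    mulᴾ : ∀ {i j k} → Poly i j → Poly j k → Poly i k
    mulᴾ []            Q = []
    mulᴾ ((s , p) ∷ P) Q = mapᴾ (p ⟫_) s Q ++ mulᴾ P Q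

    expand : ∀ {i j} → Expr i j → Poly i j
    expand (var x) = (false , (letter x false refl ◂ ε)) ∷ []
    expand 𝟘       = []
    expand 𝕀       = (false , ε) ∷ []
    expand (a ⊕ b) = expand a ++ expand b
    expand (a ⊖ b) = expand a ++ mapᴾ (λ p → p) true (expand b)
    expand (⊝ a)   = mapᴾ (λ p → p) true (expand a)
    expand (a ⊙ b) = mulᴾ (expand a) (expand b)
    expand (a †)   = mapᴾ adjointᴾ false (expand a)

    data SameLetter {i} : ∀ {j k} → Letter i j → Letter i k → Set where
      same : ∀ {j} {a : Letter i j} → SameLetter a a

    sameLetter : ∀ {i j k} (a : Letter i j) (b : Letter i k) → Maybe (SameLetter a b)
    sameLetter (letter x s eq) (letter y t eq′) with x Finₚ.≟ y
    ... | no _ = nothing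
    sameLetter (letter x false refl) (letter x false refl) | yes refl = just same
    sameLetter (letter x true  refl) (letter x true  refl) | yes refl = just same
    sameLetter (letter x false _)    (letter x true  _)    | yes refl = nothing
    sameLetter (letter x true  _)    (letter x false _)    | yes refl = nothing

    samePath : ∀ {i j} (p q : Path i j) → Maybe (p ≡ q)
    samePath ε ε = just refl
    samePath ε (_ ◂ _) = nothing
    samePath (_ ◂ _) ε = nothing
    samePath (a ◂ p) (b ◂ q) with sameLetter a b
    ... | nothing = nothing
    ... | just same with samePath p q
    ...   | nothing   = nothing
    ...   | just refl = just refl

    data Prefix {i k} : ∀ {j} → Path i j → Path i k → Set where
      prefix : ∀ {j} {l : Path i j} (q : Path j k) → Prefix l (l ⟫ q)

    prefix? : ∀ {i j k} (l : Path i j) (p : Path i k) → Maybe (Prefix l p)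
    prefix? ε p = just (prefix p)
    prefix? (_ ◂ _) ε = nothing
    prefix? (a ◂ l) (b ◂ p) with sameLetter a b
    ... | nothing = nothing
    ... | just same with prefix? l p
    ...   | nothing         = nothing
    ...   | just (prefix q) = just (prefix q)

    signed : ∀ {p q} → Bool → Mat p q → Mat p q
    signed false X = X
    signed true  X = ⊟ X

    signed-cong : ∀ {p q} s {X Y : Mat p q} → X ≋ Y → signed s X ≋ signed s Y
    signed-cong false e = e
    signed-cong true  e = ⊟-cong e

    signed-⊞ : ∀ {p q} s (X Y : Mat p q) → signed s (X ⊞ Y) ≋ signed s X ⊞ signed s Y
    signed-⊞ false X Y i j = ≈-refl
    signed-⊞ true  X Y i j = ≈-sym (-‿+-comm _ _)

    signed-xor : ∀ {p q} t s (X : Mat p q) → signed (t xor s) X ≋ signed t (signed s X)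
    signed-xor false s     X = ≋-refl
    signed-xor true  false X = ≋-refl
    signed-xor true  true  X i j = ≈-sym (-‿involutive _)

    signed-·ˡ : ∀ {p q k} s (X : Mat p q) (Y : Mat q k) → signed s X · Y ≋ signed s (X · Y)
    signed-·ˡ false X Y = ≋-refl
    signed-·ˡ true  X Y = ⊟-·ˡ X Y

    signed-·ʳ : ∀ {p q k} s (X : Mat p q) (Y : Mat q k) → X · signed s Y ≋ signed s (X · Y)
    signed-·ʳ false X Y = ≋-refl
    signed-·ʳ true  X Y = ⊟-·ʳ X Y

    signed-ᴴ : ∀ {p q} s (X : Mat p q) → signed s X ᴴ ≋ signed s (X ᴴ)
    signed-ᴴ false X = ≋-refl
    signed-ᴴ true  X i j = conj-neg _

    module Semantics (ρ : Env sig) where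

      ⟦_⟧ : ∀ {i j} → Expr i j → M i j
      ⟦ var x ⟧ = at sig ρ x
      ⟦ 𝟘 ⟧     = 𝟎
      ⟦ 𝕀 ⟧     = 𝟏
      ⟦ a ⊕ b ⟧ = ⟦ a ⟧ ⊞ ⟦ b ⟧
      ⟦ a ⊖ b ⟧ = ⟦ a ⟧ ⊞ ⊟ ⟦ b ⟧
      ⟦ ⊝ a ⟧   = ⊟ ⟦ a ⟧
      ⟦ a ⊙ b ⟧ = ⟦ a ⟧ · ⟦ b ⟧
      ⟦ a † ⟧   = ⟦ a ⟧ ᴴ

      ⟦_⟧ᴸ : ∀ {i j} → Letter i j → M i j
      ⟦ letter x false refl ⟧ᴸ = at sig ρ x
      ⟦ letter x true  refl ⟧ᴸ = at sig ρ x ᴴ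

      ⟦_⟧ᴾ : ∀ {i j} → Path i j → M i j
      ⟦ ε ⟧ᴾ     = 𝟏
      ⟦ a ◂ p ⟧ᴾ = ⟦ a ⟧ᴸ · ⟦ p ⟧ᴾ

      ⟦_⟧ˢ : ∀ {i j} → Poly i j → M i j
      ⟦ [] ⟧ˢ          = 𝟎
      ⟦ (s , p) ∷ P ⟧ˢ = signed s ⟦ p ⟧ᴾ ⊞ ⟦ P ⟧ˢ

      ⟫-sound : ∀ {i j k} (p : Path i j) (q : Path j k) → ⟦ p ⟫ q ⟧ᴾ ≋ ⟦ p ⟧ᴾ · ⟦ q ⟧ᴾ
      ⟫-sound ε       q = ≋-sym (𝟏-· ⟦ q ⟧ᴾ)
      ⟫-sound (a ◂ p) q = ≋-trans (·-cong ≋-refl (⟫-sound p q)) (≋-sym (·-assoc ⟦ a ⟧ᴸ ⟦ p ⟧ᴾ ⟦ q ⟧ᴾ))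

      adjointᴸ-sound : ∀ {i j} (a : Letter i j) → ⟦ adjointᴸ a ⟧ᴸ ≋ ⟦ a ⟧ᴸ ᴴ
      adjointᴸ-sound (letter x false refl) = ≋-refl
      adjointᴸ-sound (letter x true  refl) = ≋-sym (ᴴ-involutive _)

      adjointᴾ-sound : ∀ {i j} (p : Path i j) → ⟦ adjointᴾ p ⟧ᴾ ≋ ⟦ p ⟧ᴾ ᴴ
      adjointᴾ-sound ε       = ≋-sym 𝟏-ᴴ
      adjointᴾ-sound (a ◂ p) = ≋-trans (⟫-sound (adjointᴾ p) _)
        (≋-trans (·-cong (adjointᴾ-sound p) (≋-trans (·-𝟏 ⟦ adjointᴸ a ⟧ᴸ) (adjointᴸ-sound a))) (≋-sym (ᴴ-· ⟦ a ⟧ᴸ ⟦ p ⟧ᴾ)))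

      ++-sound : ∀ {i j} (P Q : Poly i j) → ⟦ P ++ Q ⟧ˢ ≋ ⟦ P ⟧ˢ ⊞ ⟦ Q ⟧ˢ
      ++-sound []            Q i j = ≈-sym (+-identityˡ _)
      ++-sound ((s , p) ∷ P) Q i j = ≈-trans (+-congˡ (++-sound P Q i j)) (≈-sym (+-assoc _ _ _))

      mapᴾ-sound : ∀ {i j k l} (f : Path i j → Path k l) (F : M i j → M k l) →
        (∀ p → ⟦ f p ⟧ᴾ ≋ F ⟦ p ⟧ᴾ) → (∀ s X → signed s (F X) ≋ F (signed s X)) →
        F 𝟎 ≋ 𝟎 → (∀ X Y → F (X ⊞ Y) ≋ F X ⊞ F Y) →
        ∀ t P → ⟦ mapᴾ f t P ⟧ˢ ≋ signed t (F ⟦ P ⟧ˢ)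
      mapᴾ-sound f F onPath onSign on0 on+ false [] = ≋-sym on0
      mapᴾ-sound f F onPath onSign on0 on+ true  [] i j = ≈-sym (≈-trans (-‿cong (on0 i j)) -0#≈0#)
      mapᴾ-sound f F onPath onSign on0 on+ t ((s , p) ∷ P) = ≋-trans
        (⊞-cong (≋-trans (signed-xor t s _) (signed-cong t
                  (≋-trans (signed-cong s (onPath p)) (onSign s _))))
                (mapᴾ-sound f F onPath onSign on0 on+ t P))
        (≋-trans (≋-sym (signed-⊞ t _ _)) (signed-cong t (≋-sym (on+ _ _))))

      resign-sound : ∀ {i j} t (P : Poly i j) → ⟦ mapᴾ (λ p → p) t P ⟧ˢ ≋ signed t ⟦ P ⟧ˢ
      resign-sound = mapᴾ-sound (λ p → p) (λ X → X) (λ _ → ≋-refl) (λ _ _ → ≋-refl) ≋-refl (λ _ _ → ≋-refl)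

      mulᴾ-sound : ∀ {i j k} (P : Poly i j) (Q : Poly j k) → ⟦ mulᴾ P Q ⟧ˢ ≋ ⟦ P ⟧ˢ · ⟦ Q ⟧ˢ
      mulᴾ-sound []            Q = ≋-sym (𝟎-· ⟦ Q ⟧ˢ)
      mulᴾ-sound ((s , p) ∷ P) Q = ≋-trans (++-sound (mapᴾ (p ⟫_) s Q) _)
        (≋-trans (⊞-cong
          (≋-trans (mapᴾ-sound (p ⟫_) (⟦ p ⟧ᴾ ·_) (⟫-sound p) (λ s X → ≋-sym (signed-·ʳ s ⟦ p ⟧ᴾ X))
                     (·-𝟎 ⟦ p ⟧ᴾ) (·-distribˡ ⟦ p ⟧ᴾ) s Q)
                   (≋-sym (signed-·ˡ s ⟦ p ⟧ᴾ ⟦ Q ⟧ˢ)))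
          (mulᴾ-sound P Q)) (≋-sym (·-distribʳ (signed s ⟦ p ⟧ᴾ) ⟦ P ⟧ˢ ⟦ Q ⟧ˢ)))

      expand-sound : ∀ {i j} (e : Expr i j) → ⟦ expand e ⟧ˢ ≋ ⟦ e ⟧
      expand-sound (var x) i j = ≈-trans (+-identityʳ _) (·-𝟏 (at sig ρ x) i j)
      expand-sound 𝟘           = ≋-refl
      expand-sound 𝕀       i j = +-identityʳ _
      expand-sound (a ⊕ b) = ≋-trans (++-sound (expand a) _) (⊞-cong (expand-sound a) (expand-sound b))
      expand-sound (a ⊖ b) = ≋-trans (++-sound (expand a) _)
        (⊞-cong (expand-sound a) (≋-trans (resign-sound true (expand b)) (⊟-cong (expand-sound b))))
      expand-sound (⊝ a)   = ≋-trans (resign-sound true (expand a)) (⊟-cong (expand-sound a))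
      expand-sound (a ⊙ b) = ≋-trans (mulᴾ-sound (expand a) _) (·-cong (expand-sound a) (expand-sound b))
      expand-sound (a †)   = ≋-trans
        (mapᴾ-sound adjointᴾ _ᴴ adjointᴾ-sound (λ s X → ≋-sym (signed-ᴴ s X)) 𝟎-ᴴ (λ _ _ i j → conj-+ _ _)
          false (expand a))
        (ᴴ-cong (expand-sound a))

      record Rule : Set where
        constructor rule
        field
          {from to} : Obj
          redex     : Path from to
          reduct    : Poly from to
          sound     : ⟦ redex ⟧ᴾ ≋ ⟦ reduct ⟧ˢ

      Reduct : ∀ {i j} → Path i j → Set
      Reduct p = Σ (Poly _ _) λ P → ⟦ p ⟧ᴾ ≋ ⟦ P ⟧ˢ

      contractHead : Rule → ∀ {i j} (p : Path i j) → Maybe (Reduct p)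
      contractHead (rule {f} l P sound) {i} p with f Finₚ.≟ i
      ... | no _ = nothing
      ... | yes refl with prefix? l p
      ...   | nothing         = nothing
      ...   | just (prefix q) = just (mulᴾ P ((false , q) ∷ []) ,
        ≋-trans (⟫-sound l q) (≋-trans (·-cong sound λ i j → ≈-sym (+-identityʳ _)) (≋-sym (mulᴾ-sound P _))))

      contract : Rule → ∀ {i j} (p : Path i j) → Maybe (Reduct p)
      contract r p with contractHead r p
      contract r p       | just red = just red
      contract r ε       | nothing  = nothing
      contract r (a ◂ p) | nothing with contract r p
      ... | nothing      = nothing
      ... | just (P , e) = just (mapᴾ (a ◂_) false P ,
        ≋-trans (·-cong ≋-refl e) (≋-sym (mapᴾ-sound (a ◂_) (⟦ a ⟧ᴸ ·_) (λ _ → ≋-refl)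
          (λ s X → ≋-sym (signed-·ʳ s ⟦ a ⟧ᴸ X)) (·-𝟎 ⟦ a ⟧ᴸ) (·-distribˡ ⟦ a ⟧ᴸ) false P)))

      contractAny : List Rule → ∀ {i j} (p : Path i j) → Maybe (Reduct p)
      contractAny []       p = nothing
      contractAny (r ∷ rs) p with contract r p
      ... | just red = just red
      ... | nothing  = contractAny rs p

      Equal : ∀ {i j} → Poly i j → Set
      Equal P = Σ (Poly _ _) λ Q → ⟦ P ⟧ˢ ≋ ⟦ Q ⟧ˢ

      remove : ∀ {i j} s (p : Path i j) (P : Poly i j) → Maybe (Σ (Poly i j) λ Q → signed s ⟦ p ⟧ᴾ ⊞ ⟦ P ⟧ˢ ≋ ⟦ Q ⟧ˢ)
      remove s p [] = nothing
      remove s p ((t , q) ∷ P) with s xor t in opposite | samePath p q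
      ... | true | just refl = just (P , λ i j →
        ≈-trans (≈-sym (+-assoc _ _ _)) (≈-trans (+-congʳ (cancel s t opposite i j)) (+-identityˡ _)))
        where
        cancel : ∀ s t → s xor t ≡ true → signed s ⟦ p ⟧ᴾ ⊞ signed t ⟦ p ⟧ᴾ ≋ 𝟎
        cancel false true  _ i j = -‿inverseʳ _
        cancel true  false _ i j = -‿inverseˡ _
      ... | _ | _ with remove s p P
      ...   | nothing      = nothing
      ...   | just (Q , e) = just ((t , q) ∷ Q , λ i j →
        ≈-trans (≈-sym (+-assoc _ _ _)) (≈-trans (+-congʳ (+-comm _ _))
          (≈-trans (+-assoc _ _ _) (+-congˡ (e i j)))))

      add : ∀ {i j} s (p : Path i j) (P : Poly i j) → Equal ((s , p) ∷ P)
      add s p P with remove s p P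
      ... | just red = red
      ... | nothing  = (s , p) ∷ P , ≋-refl

      normalise : List Rule → ℕ → ∀ {i j} (P : Poly i j) → Equal P
      normalise rs zero    P  = P , ≋-refl
      normalise rs (suc f) [] = [] , ≋-refl
      normalise rs (suc f) ((s , p) ∷ P) with contractAny rs p
      ... | nothing =
        let Q  , e  = normalise rs f P
            Q′ , e′ = add s p Q
        in Q′ , ≋-trans (⊞-cong ≋-refl e) e′
      ... | just (R , d) =
        let Q , e = normalise rs f (mapᴾ (λ p → p) s R ++ P)
        in Q , ≋-trans (⊞-cong (≋-trans (signed-cong s d) (≋-sym (resign-sound s R))) ≋-refl) (≋-trans (≋-sym (++-sound (mapᴾ (λ p → p) s R) P)) e)

      Holds : Equation → Set
      Holds (a ⇒ b) = ⟦ a ⟧ ≋ ⟦ b ⟧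

      AllHold : List Equation → Set
      AllHold []       = ⊤
      AllHold (h ∷ hs) = Holds h × AllHold hs

      orient : ∀ {i j} (P Q : Poly i j) → ⟦ P ⟧ˢ ≋ ⟦ Q ⟧ˢ → List Rule → List Rule
      orient ((false , p) ∷ []) Q e rs = rule p Q (λ i j → ≈-trans (≈-sym (+-identityʳ _)) (e i j)) ∷ rs
      orient _                  Q e rs = rs

      -- The adjoint of a rule for a single adjoint letter, such as Φ† ⇒ ⊝ Φ, would
      -- undo it and is left out.
      orientAdjoint : ∀ {i j} (P Q : Poly i j) → ⟦ P ⟧ˢ ≋ ⟦ Q ⟧ˢ → List Rule → List Rule
      orientAdjoint ((_ , (letter _ false _ ◂ ε)) ∷ []) Q e rs = rs
      orientAdjoint P                                   Q e rs = orient P Q e rs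

      rules : (hs : List Equation) → AllHold hs → List Rule
      rules []             _        = []
      rules ((a ⇒ b) ∷ hs) (e , es) =
        orient (expand a) (expand b) (≋-trans (expand-sound a) (≋-trans e (≋-sym (expand-sound b))))
        (orientAdjoint (expand (a †)) (expand (b †))
          (≋-trans (expand-sound (a †)) (≋-trans (ᴴ-cong e) (≋-sym (expand-sound (b †)))))
        (rules hs es))

      null : ∀ {i j} → Poly i j → Bool
      null []      = true
      null (_ ∷ _) = false

      difference : (hs : List Equation) → AllHold hs → ∀ {i j} (a b : Expr i j) → Equal (expand (a ⊖ b))
      difference hs es a b = normalise (rules hs es) 1000 (expand (a ⊖ b))

      solved : (hs : List Equation) → AllHold hs → Equation → Bool
      solved hs es (a ⇒ b) = null (proj₁ (difference hs es a b))

      conclude : ∀ hs es eq → T (solved hs es eq) → Holds eq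
      conclude hs es (a ⇒ b) t with difference hs es a b
      ... | [] , e = λ i j → x∙y⁻¹≈ε⇒x≈y _ _ (≈-trans (≈-sym (expand-sound (a ⊖ b) i j)) (e i j))

  open Solver using (𝟘; 𝕀; _⊕_; ⊝_; _⊖_; _⊙_; _†; _⇒_) public

  infix 3 _⊢_
  data Sequent {o v} (dims : Vec ℕ o) (sig : Vec (Fin o × Fin o) v) : Set where
    _⊢_ : List (Solver.Equation dims sig) → Solver.Equation dims sig → Sequent dims sig

  hypotheses : ∀ {o v} {dims : Vec ℕ o} {sig : Vec (Fin o × Fin o) v} →
               Sequent dims sig → List (Solver.Equation dims sig)
  hypotheses (hs ⊢ _) = hs

  goal : ∀ {o v} {dims : Vec ℕ o} {sig : Vec (Fin o × Fin o) v} →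
         Sequent dims sig → Solver.Equation dims sig
  goal (_ ⊢ c) = c

  module _ {o v} (dims : Vec ℕ o) (sig : Vec (Fin o × Fin o) v) where
    open Solver dims sig using (Variables; Env; var; supply; module Semantics)
    open Semantics using (AllHold; Holds; solved; conclude)

    instantiate : Variables sig (Sequent dims sig) → Sequent dims sig
    instantiate f = supply sig var f

    solve : (f : Variables sig (Sequent dims sig)) (ρ : Env sig) (es : AllHold ρ (hypotheses (instantiate f))) →
            {_ : T (solved ρ (hypotheses (instantiate f)) es (goal (instantiate f)))} →
            Holds ρ (goal (instantiate f))
    solve f ρ es {t} = conclude ρ (hypotheses (instantiate f)) es (goal (instantiate f)) t

module BlockAlgebra (𝓡 : Ring 0ℓ 0ℓ) (involution : Involution 𝓡) where

  open MatrixAlgebra 𝓡 involution public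
  open Ring 𝓡 hiding (zero; refl; -_; sym; trans)
  open Ring 𝓡 using () renaming (refl to ≈-refl; sym to ≈-sym; trans to ≈-trans)

  private
    variable
      p q k l : ℕ

  sel : (Fin p → Fin q) → Mat p q
  sel f i = 𝟏 (f i)

  upper : Mat p (p ℕ.+ q)
  upper {q = q} = sel (_↑ˡ q)

  lower : Mat q (p ℕ.+ q)
  lower {p = p} = sel (p ↑ʳ_)

  sel-· : (f : Fin p → Fin q) (X : Mat q k) → sel f · X ≋ X ∘ f
  sel-· f X i j = 𝟏-· X (f i) j

  sel-orthonormal : (f : Fin p → Fin q) → (∀ {i j} → f i ≡ f j → i ≡ j) → sel f · sel f ᴴ ≋ 𝟏
  sel-orthonormal f inj i j = ≈-trans (sel-· f (sel f ᴴ) i j) (≈-trans (𝟏-ᴴ (f i) (f j)) lem)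
    where
    lem : 𝟏 (f i) (f j) ≈ 𝟏 i j
    lem with f i Finₚ.≟ f j | i Finₚ.≟ j
    ... | yes _ | yes _ = ≈-refl
    ... | no _  | no _  = ≈-refl
    ... | yes e | no ¬e = ⊥-elim (¬e (inj e))
    ... | no ¬e | yes e = ⊥-elim (¬e (cong f e))

  sel-orthogonal : (f : Fin p → Fin q) (g : Fin k → Fin q) → (∀ i j → ¬ f i ≡ g j) → sel f · sel g ᴴ ≋ 𝟎
  sel-orthogonal f g disjoint i j = ≈-trans (sel-· f (sel g ᴴ) i j) (≈-trans (𝟏-ᴴ (f i) (g j)) lem)
    where
    lem : 𝟏 (f i) (g j) ≈ 0#
    lem with f i Finₚ.≟ g j
    ... | yes e = ⊥-elim (disjoint i j e)
    ... | no _  = ≈-refl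

  ↑ˡ≢↑ʳ : ∀ (i : Fin p) (j : Fin q) → ¬ i ↑ˡ q ≡ p ↑ʳ j
  ↑ˡ≢↑ʳ {p} {q} i j e with trans (sym (Finₚ.splitAt-↑ˡ p i q)) (trans (cong (splitAt p) e) (Finₚ.splitAt-↑ʳ p q j))
  ... | ()

  upper-upperᴴ : upper {p} {q} · upper ᴴ ≋ 𝟏
  upper-upperᴴ {q = q} = sel-orthonormal (_↑ˡ q) (Finₚ.↑ˡ-injective q _ _)

  lower-lowerᴴ : lower {q} {p} · lower ᴴ ≋ 𝟏
  lower-lowerᴴ {p = p} = sel-orthonormal (p ↑ʳ_) (Finₚ.↑ʳ-injective p _ _)

  upper-lowerᴴ : upper {p} {q} · lower ᴴ ≋ 𝟎
  upper-lowerᴴ {p} {q} = sel-orthogonal (_↑ˡ q) (p ↑ʳ_) ↑ˡ≢↑ʳ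

  rows-ext : {X Y : Mat (p ℕ.+ q) k} → upper · X ≋ upper · Y → lower · X ≋ lower · Y → X ≋ Y
  rows-ext {p} {q} {k} {X} {Y} eᵘ eˡ i j = subst (λ i → X i j ≈ Y i j) (Finₚ.join-splitAt p q i) (go (splitAt p i))
    where
    go : ∀ s → X (Fin.join p q s) j ≈ Y (Fin.join p q s) j
    go (inj₁ i) = ≈-trans (≈-sym (sel-· (_↑ˡ q) X i j)) (≈-trans (eᵘ i j) (sel-· (_↑ˡ q) Y i j))
    go (inj₂ i) = ≈-trans (≈-sym (sel-· (p ↑ʳ_) X i j)) (≈-trans (eˡ i j) (sel-· (p ↑ʳ_) Y i j))

  ∥-split : (X : Mat p q) (Y : Mat p k) → X ∥ Y ≋ X · upper ⊞ Y · lower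
  ∥-split X Y i j = ≈-trans (≈-sym (·-𝟏 (X ∥ Y) i j)) (∥-*ᵥ X Y (λ l → 𝟏 l j) i)

  upper-⫽ : (X : Mat p k) (Y : Mat q k) → upper · (X ⫽ Y) ≋ X
  upper-⫽ {q = q} X Y i j = ≈-trans (sel-· (_↑ˡ q) (X ⫽ Y) i j) (reflexive (cong (λ x → x j) (lookup-++ˡ X Y i)))

  lower-⫽ : (X : Mat p k) (Y : Mat q k) → lower · (X ⫽ Y) ≋ Y
  lower-⫽ {p} X Y i j = ≈-trans (sel-· (p ↑ʳ_) (X ⫽ Y) i j) (reflexive (cong (λ x → x j) (lookup-++ʳ X Y i)))

  blocks-resolution : upper {p} {q} ᴴ · upper ⊞ lower {q} {p} ᴴ · lower ≋ 𝟏
  blocks-resolution {p} {q} = rows-ext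
    (solve (p ∷ q ∷ p ℕ.+ q ∷ []) ((0F , 2F) ∷ (1F , 2F) ∷ [])
      (λ U L → (U ⊙ U † ⇒ 𝕀) ∷ (U ⊙ L † ⇒ 𝟘) ∷ []
             ⊢ U ⊙ (U † ⊙ U ⊕ L † ⊙ L) ⇒ U ⊙ 𝕀)
      (upper , lower , _) (upper-upperᴴ , upper-lowerᴴ , _))
    (solve (p ∷ q ∷ p ℕ.+ q ∷ []) ((0F , 2F) ∷ (1F , 2F) ∷ [])
      (λ U L → (L ⊙ L † ⇒ 𝕀) ∷ (U ⊙ L † ⇒ 𝟘) ∷ []
             ⊢ L ⊙ (U † ⊙ U ⊕ L † ⊙ L) ⇒ L ⊙ 𝕀)
      (upper , lower , _) (lower-lowerᴴ {p = p} , upper-lowerᴴ , _))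

  upper-diag : (X : Mat p p) (Y : Mat q q) → upper {p} {q} · diag X Y ≋ X · upper
  upper-diag {p} {q} X Y = ≋-trans (upper-⫽ (X ∥ 𝟎 {q = q}) (𝟎 {q = p} ∥ Y)) (≋-trans (∥-split X 𝟎)
    (solve (p ∷ q ∷ p ℕ.+ q ∷ []) ((0F , 0F) ∷ (0F , 2F) ∷ (1F , 2F) ∷ [])
      (λ X U L → [] ⊢ X ⊙ U ⊕ 𝟘 ⊙ L ⇒ X ⊙ U) (X , upper , lower , _) _))

  lower-diag : (X : Mat p p) (Y : Mat q q) → lower {q} {p} · diag X Y ≋ Y · lower
  lower-diag {p} {q} X Y = ≋-trans (lower-⫽ (X ∥ 𝟎 {q = q}) (𝟎 {q = p} ∥ Y)) (≋-trans (∥-split 𝟎 Y)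
    (solve (p ∷ q ∷ p ℕ.+ q ∷ []) ((1F , 1F) ∷ (0F , 2F) ∷ (1F , 2F) ∷ [])
      (λ Y U L → [] ⊢ 𝟘 ⊙ U ⊕ Y ⊙ L ⇒ Y ⊙ L) (Y , upper , lower , _) _))

record IsDivision (𝓡 : Ring 0ℓ 0ℓ) (involution : Involution 𝓡) : Set where
  open Ring 𝓡
  open Involution involution
  field
    _≈?_      : Decidable _≈_
    1≉0       : ¬ 1# ≈ 0#
    inverse   : ∀ x → ¬ x ≈ 0# → ∃[ y ] (x * y ≈ 1#) × (y * x ≈ 1#)
    -- For x = 0 this asks for a nonzero symmetric element; it replaces division by 2.
    skew-half : ∀ x → conj x ≈ - x → ∃[ z ] (¬ z ≈ 0#) × (z ≈ x + conj z)

module LinearAlgebra (𝓡 : Ring 0ℓ 0ℓ) (involution : Involution 𝓡) (division : IsDivision 𝓡 involution) where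

  open IsDivision division public
  open BlockAlgebra 𝓡 involution public
  open Ring 𝓡 hiding (zero; refl; -_; sym; trans)
  open Ring 𝓡 using () renaming (refl to ≈-refl; sym to ≈-sym; trans to ≈-trans)

  private
    variable
      p q k l : ℕ

  scalar-1×1 : (c : Mat 1 1) → c ≋ scalar (c 0F 0F)
  scalar-1×1 c 0F 0F = ≈-refl

  inverse-1×1 : (c : Mat 1 1) → ¬ c ≋ 𝟎 → ∃[ d ] (c · d ≋ 𝟏) × (d · c ≋ 𝟏)
  inverse-1×1 c c≉0 with inverse (c 0F 0F) (λ e → c≉0 λ { 0F 0F → e })
  ... | y , e , f = scalar y ,
    ≋-trans (·-congʳ (scalar y) (scalar-1×1 c)) (≋-trans (scalar-· _ y) (scalar-cong e)) ,
    ≋-trans (·-congˡ (scalar y) (scalar-1×1 c)) (≋-trans (scalar-· y _) (scalar-cong f))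

  zero? : (X : Mat p q) → Dec (X ≋ 𝟎)
  zero? X = Finₚ.all? λ i → Finₚ.all? λ j → X i j ≈? 0#

  nonzero-row : (x : Mat 1 q) → ¬ x ≋ 𝟎 → ∃[ j ] ∃[ c ] x · (sel {p = 1} (λ _ → j) ᴴ · c) ≋ 𝟏
  nonzero-row {q} x x≉0 with Finₚ.¬∀⟶∃¬ q _ (λ j → x 0F j ≈? 0#) (λ e → x≉0 λ { 0F → e })
  ... | j , xj≉0 = let c , e , _ = inverse-1×1 (x · sel (λ _ → j) ᴴ) (λ e → xj≉0 (≈-trans (≈-sym entry) (e 0F 0F)))
                   in j , c , ≋-trans (≋-sym (·-assoc x (sel (λ _ → j) ᴴ) c)) e
    where
    entry : (x · sel {p = 1} (λ _ → j) ᴴ) 0F 0F ≈ x 0F j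
    entry = ≈-trans (*ᵥ-cong x (λ l → 𝟏-ᴴ l j) 0F) (*ᵥ-𝟏 x 0F j)

  record Factorization (X : Mat p q) (ρ : ℕ) : Set where
    field
      F : Mat p ρ
      G : Mat ρ q
      E : Mat ρ p
      H : Mat q ρ
      X≋FG : X ≋ F · G
      EF≋𝟏 : E · F ≋ 𝟏
      GH≋𝟏 : G · H ≋ 𝟏

  rowwise : (X : Mat (p ℕ.+ q) k) → X ≋ upper {p} {q} ᴴ · (upper {p} {q} · X) ⊞ lower {q} {p} ᴴ · (lower {q} {p} · X)
  rowwise {p} {q} {k} X = ≋-trans (≋-sym (𝟏-· X)) (≋-trans (·-congʳ X (≋-sym (blocks-resolution {p} {q})))
    (solve (p ∷ q ∷ p ℕ.+ q ∷ k ∷ []) ((0F , 2F) ∷ (1F , 2F) ∷ (2F , 3F) ∷ [])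
      (λ U L X → [] ⊢ (U † ⊙ U ⊕ L † ⊙ L) ⊙ X ⇒ U † ⊙ (U ⊙ X) ⊕ L † ⊙ (L ⊙ X)) (upper , lower {q} {p} , X , _) _))

  ⊞⊟≋𝟎 : {X Y : Mat p q} → X ⊞ ⊟ Y ≋ 𝟎 → X ≋ Y
  ⊞⊟≋𝟎 {p} {q} {X} {Y} e = ≋-trans
    (solve (p ∷ q ∷ []) ((0F , 1F) ∷ (0F , 1F) ∷ []) (λ X Y → [] ⊢ X ⇒ (X ⊖ Y) ⊕ Y) (X , Y , _) _)
    (≋-trans (⊞-cong e ≋-refl) (solve (p ∷ q ∷ []) ((0F , 1F) ∷ []) (λ Y → [] ⊢ 𝟘 ⊕ Y ⇒ Y) (Y , _) _))

  extend-dependent : (X : Mat (suc p) q) {ρ : ℕ} (f : Factorization (lower {p} {1} · X) ρ) →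
    let open Factorization f ; x = upper {1} · X in x ⊞ ⊟ (x · H · G) ≋ 𝟎 → Factorization X ρ
  extend-dependent {p} {q} X {ρ} f e = record
    { F = upper ᴴ · y ⊞ lower ᴴ · F ; G = G ; E = E · lower ; H = H
    ; X≋FG = ≋-trans (rowwise {1} X)
        (solve (1 ∷ p ∷ suc p ∷ q ∷ ρ ∷ [])
          ((0F , 2F) ∷ (1F , 2F) ∷ (2F , 3F) ∷ (1F , 4F) ∷ (4F , 3F) ∷ (0F , 4F) ∷ [])
          (λ U L X F G y → (U ⊙ X ⇒ y ⊙ G) ∷ (L ⊙ X ⇒ F ⊙ G) ∷ []
            ⊢ U † ⊙ (U ⊙ X) ⊕ L † ⊙ (L ⊙ X) ⇒ (U † ⊙ y ⊕ L † ⊙ F) ⊙ G)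
          (upper , lower , X , F , G , y , _) (⊞⊟≋𝟎 e , X≋FG , _))
    ; EF≋𝟏 = solve (1 ∷ p ∷ suc p ∷ ρ ∷ [])
          ((0F , 2F) ∷ (1F , 2F) ∷ (1F , 3F) ∷ (3F , 1F) ∷ (0F , 3F) ∷ [])
          (λ U L F E y → (E ⊙ F ⇒ 𝕀) ∷ (U ⊙ L † ⇒ 𝟘) ∷ (L ⊙ L † ⇒ 𝕀) ∷ []
            ⊢ (E ⊙ L) ⊙ (U † ⊙ y ⊕ L † ⊙ F) ⇒ 𝕀)
          (upper , lower , F , E , y , _) (EF≋𝟏 , upper-lowerᴴ {1} , lower-lowerᴴ {p} {1} , _)
    ; GH≋𝟏 = GH≋𝟏 }
    where
    open Factorization f
    y = (upper {1} · X) · H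

  extend-independent : (X : Mat (suc p) q) {ρ : ℕ} (f : Factorization (lower {p} {1} · X) ρ) →
    let open Factorization f ; x = upper {1} · X in
    (w : Mat q 1) → (x ⊞ ⊟ (x · H · G)) · w ≋ 𝟏 → Factorization X (suc ρ)
  extend-independent {p} {q} X {ρ} f w e = record
    { F = upper ᴴ · (upper ⊞ y · lower) ⊞ lower ᴴ · (F · lower)
    ; G = upper {1} ᴴ · x′ ⊞ lower ᴴ · G
    ; E = upper ᴴ · (upper ⊞ ⊟ (y · E · lower)) ⊞ lower ᴴ · (E · lower)
    ; H = (w ⊞ ⊟ (H · (G · w))) · upper ⊞ H · lower
    ; X≋FG = ≋-trans (rowwise {1} X)
        (solve (1 ∷ p ∷ suc p ∷ q ∷ ρ ∷ suc ρ ∷ [])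
          ((0F , 2F) ∷ (1F , 2F) ∷ (2F , 3F) ∷ (1F , 4F) ∷ (4F , 3F) ∷ (3F , 4F) ∷ (0F , 5F) ∷ (4F , 5F) ∷ [])
          (λ U L X F G H U′ L′ → (L ⊙ X ⇒ F ⊙ G) ∷ (U′ ⊙ U′ † ⇒ 𝕀) ∷ (U′ ⊙ L′ † ⇒ 𝟘) ∷ (L′ ⊙ L′ † ⇒ 𝕀) ∷ []
            ⊢ U † ⊙ (U ⊙ X) ⊕ L † ⊙ (L ⊙ X) ⇒ (U † ⊙ (U′ ⊕ ((U ⊙ X) ⊙ H) ⊙ L′) ⊕ L † ⊙ (F ⊙ L′)) ⊙
               (U′ † ⊙ ((U ⊙ X) ⊖ (U ⊙ X) ⊙ H ⊙ G) ⊕ L′ † ⊙ G))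
          (upper , lower , X , F , G , H , upper , lower , _)
          (X≋FG , upper-upperᴴ {1} , upper-lowerᴴ {1} , lower-lowerᴴ {ρ} {1} , _))
    ; EF≋𝟏 = ≋-trans (solve (1 ∷ p ∷ suc p ∷ ρ ∷ suc ρ ∷ [])
          ((0F , 2F) ∷ (1F , 2F) ∷ (1F , 3F) ∷ (3F , 1F) ∷ (0F , 3F) ∷ (0F , 4F) ∷ (3F , 4F) ∷ [])
          (λ U L F E y U′ L′ → (E ⊙ F ⇒ 𝕀) ∷ (U ⊙ U † ⇒ 𝕀) ∷ (U ⊙ L † ⇒ 𝟘) ∷ (L ⊙ L † ⇒ 𝕀) ∷ []
            ⊢ (U′ † ⊙ (U ⊖ y ⊙ E ⊙ L) ⊕ L′ † ⊙ (E ⊙ L)) ⊙ (U † ⊙ (U′ ⊕ y ⊙ L′) ⊕ L † ⊙ (F ⊙ L′))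
              ⇒ U′ † ⊙ U′ ⊕ L′ † ⊙ L′)
          (upper , lower , F , E , y , upper , lower , _)
          (EF≋𝟏 , upper-upperᴴ {1} , upper-lowerᴴ {1} , lower-lowerᴴ {p} {1} , _))
        (blocks-resolution {1})
    ; GH≋𝟏 = ≋-trans (solve (1 ∷ q ∷ ρ ∷ suc ρ ∷ [])
          ((0F , 1F) ∷ (2F , 1F) ∷ (1F , 2F) ∷ (1F , 0F) ∷ (0F , 3F) ∷ (2F , 3F) ∷ [])
          (λ x′ G H w U L → (G ⊙ H ⇒ 𝕀) ∷ (x′ ⊙ H ⇒ 𝟘) ∷ (x′ ⊙ w ⇒ 𝕀) ∷ []
            ⊢ (U † ⊙ x′ ⊕ L † ⊙ G) ⊙ ((w ⊖ H ⊙ (G ⊙ w)) ⊙ U ⊕ H ⊙ L) ⇒ U † ⊙ U ⊕ L † ⊙ L)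
          (x′ , G , H , w , upper , lower , _) (GH≋𝟏 , x′H≋𝟎 , e , _))
        (blocks-resolution {1}) }
    where
    open Factorization f
    x y x′ : Mat 1 _
    x = upper {1} · X
    y = x · H
    x′ = x ⊞ ⊟ (x · H · G)
    x′H≋𝟎 : x′ · H ≋ 𝟎
    x′H≋𝟎 = solve (1 ∷ q ∷ ρ ∷ []) ((0F , 1F) ∷ (2F , 1F) ∷ (1F , 2F) ∷ [])
      (λ x G H → (G ⊙ H ⇒ 𝕀) ∷ [] ⊢ (x ⊖ x ⊙ H ⊙ G) ⊙ H ⇒ 𝟘) (x , G , H , _) (GH≋𝟏 , _)

  factorize : ∀ p (X : Mat p q) → ∃[ ρ ] Factorization X ρ
  factorize zero    X = 0 , record { F = λ () ; G = λ () ; E = λ () ; H = λ _ () ; X≋FG = λ () ; EF≋𝟏 = λ () ; GH≋𝟏 = λ () }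
  factorize (suc p) X with factorize p (lower {p} {1} · X)
  ... | ρ , f with zero? (let open Factorization f ; x = upper {1} · X in x ⊞ ⊟ (x · H · G))
  ...   | yes e = ρ , extend-dependent X f e
  ...   | no ¬e = let j , c , e = nonzero-row _ ¬e in suc ρ , extend-independent X f _ e

  idempotent-factorization : {e : Mat p p} → e · e ≋ e → ∀ {ρ} (f : Factorization e ρ) →
    let open Factorization f in G · F ≋ 𝟏
  idempotent-factorization {p} {e} ee {ρ} f = ≋-trans
    (solve (p ∷ ρ ∷ []) ((0F , 1F) ∷ (1F , 0F) ∷ (1F , 0F) ∷ (0F , 1F) ∷ [])
      (λ F G E H → (E ⊙ F ⇒ 𝕀) ∷ (G ⊙ H ⇒ 𝕀) ∷ [] ⊢ G ⊙ F ⇒ E ⊙ (F ⊙ G) ⊙ (F ⊙ G) ⊙ H)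
      (F , G , E , H , _) (EF≋𝟏 , GH≋𝟏 , _))
    (≋-trans (solve (p ∷ ρ ∷ []) ((0F , 1F) ∷ (1F , 0F) ∷ (1F , 0F) ∷ (0F , 1F) ∷ (0F , 0F) ∷ [])
      (λ F G E H e → (F ⊙ G ⇒ e) ∷ (e ⊙ e ⇒ e) ∷ [] ⊢ E ⊙ (F ⊙ G) ⊙ (F ⊙ G) ⊙ H ⇒ E ⊙ (F ⊙ G) ⊙ H)
      (F , G , E , H , e , _) (≋-sym X≋FG , ee , _))
    (solve (p ∷ ρ ∷ []) ((0F , 1F) ∷ (1F , 0F) ∷ (1F , 0F) ∷ (0F , 1F) ∷ [])
      (λ F G E H → (E ⊙ F ⇒ 𝕀) ∷ (G ⊙ H ⇒ 𝕀) ∷ [] ⊢ E ⊙ (F ⊙ G) ⊙ H ⇒ 𝕀)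
      (F , G , E , H , _) (EF≋𝟏 , GH≋𝟏 , _)))
    where open Factorization f

  hyperplane : (b : Mat 1 (suc k)) → Σ (Mat k (suc k)) λ E → Σ (Mat (suc k) k) λ F → (E · F ≋ 𝟏) × (b · F ≋ 𝟎)
  hyperplane {k} b with zero? b
  ... | yes e = lower {k} {1} , lower {k} {1} ᴴ , lower-lowerᴴ {k} {1} ,
    ≋-trans (·-congʳ (lower {k} {1} ᴴ) e) (𝟎-· (lower {k} {1} ᴴ))
  ... | no ¬e = let j , c , e = nonzero-row b ¬e in avoiding j c e
    where
    avoiding : ∀ j (c : Mat 1 1) → b · (sel {p = 1} (λ _ → j) ᴴ · c) ≋ 𝟏 →
               Σ (Mat k (suc k)) λ E → Σ (Mat (suc k) k) λ F → (E · F ≋ 𝟏) × (b · F ≋ 𝟎)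
    avoiding j c e = S , S ᴴ ⊞ ⊟ (s ᴴ · c · b · S ᴴ) ,
      solve (1 ∷ k ∷ suc k ∷ []) ((0F , 2F) ∷ (0F , 2F) ∷ (0F , 0F) ∷ (1F , 2F) ∷ [])
        (λ s b c S → (S ⊙ S † ⇒ 𝕀) ∷ (S ⊙ s † ⇒ 𝟘) ∷ [] ⊢ S ⊙ (S † ⊖ (s † ⊙ c) ⊙ b ⊙ S †) ⇒ 𝕀)
        (s , b , c , S , _)
        (sel-orthonormal (Fin.punchIn j) (Finₚ.punchIn-injective j _ _) ,
         sel-orthogonal (Fin.punchIn j) (λ _ → j) (λ i _ → Finₚ.punchInᵢ≢i j i) , _) ,
      solve (1 ∷ k ∷ suc k ∷ []) ((0F , 2F) ∷ (0F , 2F) ∷ (0F , 0F) ∷ (1F , 2F) ∷ [])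
        (λ s b c S → (b ⊙ s † ⊙ c ⇒ 𝕀) ∷ [] ⊢ b ⊙ (S † ⊖ (s † ⊙ c) ⊙ b ⊙ S †) ⇒ 𝟘)
        (s , b , c , S , _) (≋-trans (·-assoc b (s ᴴ) c) e , _)
      where
      S : Mat k (suc k)
      S = sel (Fin.punchIn j)
      s : Mat 1 (suc k)
      s = sel (λ _ → j)

  right-invertible⇒≤ : ∀ p q (A : Mat p q) (B : Mat q p) → A · B ≋ 𝟏 → p ≤ q
  right-invertible⇒≤ zero    q       A B e = z≤n
  right-invertible⇒≤ (suc p) zero    A B e = ⊥-elim (1≉0 (≈-sym (e 0F 0F)))
  right-invertible⇒≤ (suc p) (suc q) A B e =
    let E , F , EF , bF = hyperplane (upper {1} · B)
    in s≤s (right-invertible⇒≤ p q (E · (A · lower {q} {1} ᴴ)) (lower {q} {1} · B · F)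
      (solve (1 ∷ p ∷ suc p ∷ q ∷ suc q ∷ [])
        ((0F , 4F) ∷ (3F , 4F) ∷ (2F , 4F) ∷ (4F , 2F) ∷ (1F , 2F) ∷ (2F , 1F) ∷ [])
        (λ U L A B E F → (L † ⊙ L ⇒ 𝕀 ⊖ U † ⊙ U) ∷ (A ⊙ B ⇒ 𝕀) ∷ (E ⊙ F ⇒ 𝕀) ∷ (U ⊙ B ⊙ F ⇒ 𝟘) ∷ []
          ⊢ (E ⊙ (A ⊙ L †)) ⊙ (L ⊙ B ⊙ F) ⇒ 𝕀)
        (upper , lower , A , B , E , F , _)
        (≋-trans (solve (1 ∷ q ∷ suc q ∷ []) ((0F , 2F) ∷ (1F , 2F) ∷ [])
           (λ U L → [] ⊢ L † ⊙ L ⇒ (U † ⊙ U ⊕ L † ⊙ L) ⊖ U † ⊙ U) (upper , lower , _) _)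
           (⊞-cong (blocks-resolution {1}) ≋-refl) , e , EF , bF , _)))

  left-inverse : ∀ {k} {A B : Mat k k} → A · B ≋ 𝟏 → B · A ≋ 𝟏
  left-inverse {k} {A} {B} AB = let ρ , f = factorize k (𝟏 ⊞ ⊟ (B · A)) in go ρ f
    where
    go : ∀ ρ → Factorization (𝟏 ⊞ ⊟ (B · A)) ρ → B · A ≋ 𝟏
    go zero    f = ≋-sym (⊞⊟≋𝟎 {X = 𝟏} {B · A} (Factorization.X≋FG f))
    go (suc ρ) f = ⊥-elim (ℕₚ.m+1+n≰m k (right-invertible⇒≤ (k ℕ.+ suc ρ) k
      (upper ᴴ · A ⊞ lower ᴴ · G) (B · upper ⊞ F · lower) (≋-trans
      (solve (k ∷ suc ρ ∷ k ℕ.+ suc ρ ∷ [])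
        ((0F , 2F) ∷ (1F , 2F) ∷ (0F , 0F) ∷ (0F , 0F) ∷ (0F , 1F) ∷ (1F , 0F) ∷ [])
        (λ U L A B F G → (A ⊙ B ⇒ 𝕀) ∷ (G ⊙ F ⇒ 𝕀) ∷ (A ⊙ F ⇒ 𝟘) ∷ (G ⊙ B ⇒ 𝟘) ∷ []
          ⊢ (U † ⊙ A ⊕ L † ⊙ G) ⊙ (B ⊙ U ⊕ F ⊙ L) ⇒ U † ⊙ U ⊕ L † ⊙ L)
        (upper , lower , A , B , F , G , _) (AB , idempotent-factorization idem f , AF , GB , _))
      (blocks-resolution {k} {suc ρ}))))
      where
      open Factorization f
      idem : (𝟏 ⊞ ⊟ (B · A)) · (𝟏 ⊞ ⊟ (B · A)) ≋ 𝟏 ⊞ ⊟ (B · A)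
      idem = solve (k ∷ []) ((0F , 0F) ∷ (0F , 0F) ∷ [])
        (λ A B → (A ⊙ B ⇒ 𝕀) ∷ [] ⊢ (𝕀 ⊖ B ⊙ A) ⊙ (𝕀 ⊖ B ⊙ A) ⇒ 𝕀 ⊖ B ⊙ A) (A , B , _) (AB , _)
      AF : A · F ≋ 𝟎
      AF = ≋-trans
        (solve (k ∷ suc ρ ∷ []) ((0F , 0F) ∷ (0F , 1F) ∷ (1F , 0F) ∷ (0F , 1F) ∷ [])
          (λ A F G H → (G ⊙ H ⇒ 𝕀) ∷ [] ⊢ A ⊙ F ⇒ A ⊙ (F ⊙ G) ⊙ H) (A , F , G , H , _) (GH≋𝟏 , _))
        (solve (k ∷ suc ρ ∷ []) ((0F , 0F) ∷ (0F , 0F) ∷ (0F , 1F) ∷ (1F , 0F) ∷ (0F , 1F) ∷ [])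
          (λ A B F G H → (F ⊙ G ⇒ 𝕀 ⊖ B ⊙ A) ∷ (A ⊙ B ⇒ 𝕀) ∷ [] ⊢ A ⊙ (F ⊙ G) ⊙ H ⇒ 𝟘)
          (A , B , F , G , H , _) (≋-sym X≋FG , AB , _))
      GB : G · B ≋ 𝟎
      GB = ≋-trans
        (solve (k ∷ suc ρ ∷ []) ((0F , 0F) ∷ (0F , 1F) ∷ (1F , 0F) ∷ (1F , 0F) ∷ [])
          (λ B F G E → (E ⊙ F ⇒ 𝕀) ∷ [] ⊢ G ⊙ B ⇒ E ⊙ (F ⊙ G) ⊙ B) (B , F , G , E , _) (EF≋𝟏 , _))
        (solve (k ∷ suc ρ ∷ []) ((0F , 0F) ∷ (0F , 0F) ∷ (0F , 1F) ∷ (1F , 0F) ∷ (1F , 0F) ∷ [])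
          (λ A B F G E → (F ⊙ G ⇒ 𝕀 ⊖ B ⊙ A) ∷ (A ⊙ B ⇒ 𝕀) ∷ [] ⊢ E ⊙ (F ⊙ G) ⊙ B ⇒ 𝟘)
          (A , B , F , G , E , _) (≋-sym X≋FG , AB , _))

  rank-≤ : {X : Mat p q} {ρ σ : ℕ} → Factorization X ρ → Factorization X σ → ρ ≤ σ
  rank-≤ {p} {q} {X} {ρ} {σ} f g = right-invertible⇒≤ ρ σ (f.E · g.F) (g.G · f.H)
    (≋-trans (solve (p ∷ q ∷ ρ ∷ σ ∷ []) ((2F , 0F) ∷ (0F , 3F) ∷ (3F , 1F) ∷ (1F , 2F) ∷ (0F , 1F) ∷ [])
      (λ E F G H X → (F ⊙ G ⇒ X) ∷ [] ⊢ (E ⊙ F) ⊙ (G ⊙ H) ⇒ E ⊙ X ⊙ H)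
      (f.E , g.F , g.G , f.H , X , _) (≋-sym g.X≋FG , _))
    (solve (p ∷ q ∷ ρ ∷ []) ((2F , 0F) ∷ (0F , 2F) ∷ (2F , 1F) ∷ (1F , 2F) ∷ (0F , 1F) ∷ [])
      (λ E F G H X → (X ⇒ F ⊙ G) ∷ (E ⊙ F ⇒ 𝕀) ∷ (G ⊙ H ⇒ 𝕀) ∷ [] ⊢ E ⊙ X ⊙ H ⇒ 𝕀)
      (f.E , f.F , f.G , f.H , X , _) (f.X≋FG , f.EF≋𝟏 , f.GH≋𝟏 , _)))
    where
    module f = Factorization f
    module g = Factorization g

  rank-unique : {X : Mat p q} {ρ σ : ℕ} → Factorization X ρ → Factorization X σ → ρ ≡ σ
  rank-unique f g = ℕₚ.≤-antisym (rank-≤ f g) (rank-≤ g f)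

  record Complement {ρ} (F : Mat p ρ) (E : Mat ρ p) (k : ℕ) : Set where
    field
      F₁ : Mat p k
      E₁ : Mat k p
      E₁F₁≋𝟏 : E₁ · F₁ ≋ 𝟏
      E₁F≋𝟎  : E₁ · F ≋ 𝟎
      EF₁≋𝟎  : E · F₁ ≋ 𝟎
      split   : F₁ · E₁ ≋ 𝟏 ⊞ ⊟ (F · E)

  complement : ∀ {ρ} {F : Mat p ρ} {E : Mat ρ p} → E · F ≋ 𝟏 → ∃[ k ] Complement F E k
  complement {p} {ρ} {F} {E} EF = let k , f = factorize p (𝟏 ⊞ ⊟ (F · E)) in k , fromFactorization f
    where
    fromFactorization : ∀ {k} → Factorization (𝟏 ⊞ ⊟ (F · E)) k → Complement F E k
    fromFactorization {k} f = record
      { F₁ = f.F ; E₁ = f.G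
      ; E₁F₁≋𝟏 = idempotent-factorization (solve (p ∷ ρ ∷ []) ((0F , 1F) ∷ (1F , 0F) ∷ [])
          (λ F E → (E ⊙ F ⇒ 𝕀) ∷ [] ⊢ (𝕀 ⊖ F ⊙ E) ⊙ (𝕀 ⊖ F ⊙ E) ⇒ 𝕀 ⊖ F ⊙ E) (F , E , _) (EF , _)) f
      ; E₁F≋𝟎 = ≋-trans
        (solve (p ∷ ρ ∷ k ∷ []) ((0F , 1F) ∷ (0F , 2F) ∷ (2F , 0F) ∷ (2F , 0F) ∷ [])
          (λ F F₁ E₁ E′ → (E′ ⊙ F₁ ⇒ 𝕀) ∷ [] ⊢ E₁ ⊙ F ⇒ E′ ⊙ (F₁ ⊙ E₁) ⊙ F) (F , f.F , f.G , f.E , _) (f.EF≋𝟏 , _))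
        (solve (p ∷ ρ ∷ k ∷ []) ((0F , 1F) ∷ (1F , 0F) ∷ (0F , 2F) ∷ (2F , 0F) ∷ (2F , 0F) ∷ [])
          (λ F E F₁ E₁ E′ → (F₁ ⊙ E₁ ⇒ 𝕀 ⊖ F ⊙ E) ∷ (E ⊙ F ⇒ 𝕀) ∷ [] ⊢ E′ ⊙ (F₁ ⊙ E₁) ⊙ F ⇒ 𝟘)
          (F , E , f.F , f.G , f.E , _) (≋-sym f.X≋FG , EF , _))
      ; EF₁≋𝟎 = ≋-trans
        (solve (p ∷ ρ ∷ k ∷ []) ((1F , 0F) ∷ (0F , 2F) ∷ (2F , 0F) ∷ (0F , 2F) ∷ [])
          (λ E F₁ E₁ H′ → (E₁ ⊙ H′ ⇒ 𝕀) ∷ [] ⊢ E ⊙ F₁ ⇒ E ⊙ (F₁ ⊙ E₁) ⊙ H′) (E , f.F , f.G , f.H , _) (f.GH≋𝟏 , _))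
        (solve (p ∷ ρ ∷ k ∷ []) ((0F , 1F) ∷ (1F , 0F) ∷ (0F , 2F) ∷ (2F , 0F) ∷ (0F , 2F) ∷ [])
          (λ F E F₁ E₁ H′ → (F₁ ⊙ E₁ ⇒ 𝕀 ⊖ F ⊙ E) ∷ (E ⊙ F ⇒ 𝕀) ∷ [] ⊢ E ⊙ (F₁ ⊙ E₁) ⊙ H′ ⇒ 𝟘)
          (F , E , f.F , f.G , f.H , _) (≋-sym f.X≋FG , EF , _))
      ; split = ≋-sym f.X≋FG }
      where module f = Factorization f

  complement-size : ∀ {ρ k} {F : Mat p ρ} {E : Mat ρ p} → E · F ≋ 𝟏 → Complement F E k → ρ ℕ.+ k ≡ p
  complement-size {p} {ρ} {k} {F} {E} EF c = ℕₚ.≤-antisym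
    (right-invertible⇒≤ _ _ (upper ᴴ · E ⊞ lower ᴴ · E₁) (F · upper ⊞ F₁ · lower) (≋-trans
      (solve (p ∷ ρ ∷ k ∷ ρ ℕ.+ k ∷ []) ((1F , 3F) ∷ (2F , 3F) ∷ (0F , 1F) ∷ (1F , 0F) ∷ (0F , 2F) ∷ (2F , 0F) ∷ [])
        (λ U L F E F₁ E₁ → (E ⊙ F ⇒ 𝕀) ∷ (E₁ ⊙ F₁ ⇒ 𝕀) ∷ (E₁ ⊙ F ⇒ 𝟘) ∷ (E ⊙ F₁ ⇒ 𝟘) ∷ []
          ⊢ (U † ⊙ E ⊕ L † ⊙ E₁) ⊙ (F ⊙ U ⊕ F₁ ⊙ L) ⇒ U † ⊙ U ⊕ L † ⊙ L)
        (upper , lower , F , E , F₁ , E₁ , _) (EF , E₁F₁≋𝟏 , E₁F≋𝟎 , EF₁≋𝟎 , _))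
      (blocks-resolution {ρ})))
    (right-invertible⇒≤ _ _ (F · upper ⊞ F₁ · lower) (upper ᴴ · E ⊞ lower ᴴ · E₁)
      (solve (p ∷ ρ ∷ k ∷ ρ ℕ.+ k ∷ []) ((1F , 3F) ∷ (2F , 3F) ∷ (0F , 1F) ∷ (1F , 0F) ∷ (0F , 2F) ∷ (2F , 0F) ∷ [])
        (λ U L F E F₁ E₁ → (F₁ ⊙ E₁ ⇒ 𝕀 ⊖ F ⊙ E) ∷ (U ⊙ U † ⇒ 𝕀) ∷ (U ⊙ L † ⇒ 𝟘) ∷ (L ⊙ L † ⇒ 𝕀) ∷ []
          ⊢ (F ⊙ U ⊕ F₁ ⊙ L) ⊙ (U † ⊙ E ⊕ L † ⊙ E₁) ⇒ 𝕀)
        (upper , lower , F , E , F₁ , E₁ , _) (split , upper-upperᴴ , upper-lowerᴴ , lower-lowerᴴ {k} {ρ} , _)))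
    where open Complement c

  trivial-left-kernel⇒right-inverse : (Y : Mat p q) →
    (∀ {l} (Z : Mat l p) → Z · Y ≋ 𝟎 → Z ≋ 𝟎) → ∃[ Y′ ] Y · Y′ ≋ 𝟏
  trivial-left-kernel⇒right-inverse {p} {q} Y ker =
    let ρ , f = factorize p Y ; k , c = complement (Factorization.EF≋𝟏 f) in H f · E f , prf f c
    where
    open Factorization
    prf : ∀ {ρ k} (f : Factorization Y ρ) → Complement (F f) (E f) k → Y · (H f · E f) ≋ 𝟏
    prf {ρ} {k} f c = ≋-trans
      (solve (p ∷ q ∷ ρ ∷ k ∷ []) ((0F , 1F) ∷ (0F , 2F) ∷ (2F , 1F) ∷ (2F , 0F) ∷ (1F , 2F) ∷ [])
        (λ Y F G E H → (Y ⇒ F ⊙ G) ∷ (G ⊙ H ⇒ 𝕀) ∷ [] ⊢ Y ⊙ (H ⊙ E) ⇒ F ⊙ E)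
        (Y , F f , G f , E f , H f , _) (X≋FG f , GH≋𝟏 f , _))
      (≋-sym (⊞⊟≋𝟎 {X = 𝟏} {F f · E f} (≋-trans (≋-sym split) (≋-trans (·-congˡ F₁ E₁≋𝟎) (·-𝟎 F₁)))))
      where
      open Complement c
      E₁≋𝟎 : E₁ ≋ 𝟎
      E₁≋𝟎 = ker E₁ (solve (p ∷ q ∷ ρ ∷ k ∷ []) ((0F , 1F) ∷ (0F , 2F) ∷ (2F , 1F) ∷ (3F , 0F) ∷ [])
        (λ Y F G E₁ → (Y ⇒ F ⊙ G) ∷ (E₁ ⊙ F ⇒ 𝟘) ∷ [] ⊢ E₁ ⊙ Y ⇒ 𝟘) (Y , F f , G f , E₁ , _) (X≋FG f , E₁F≋𝟎 , _))

module SkewHermitian (𝓡 : Ring 0ℓ 0ℓ) (involution : Involution 𝓡) (division : IsDivision 𝓡 involution) where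

  open LinearAlgebra 𝓡 involution division public
  open Ring 𝓡 hiding (zero; refl; -_; sym; trans)
  open Ring 𝓡 using () renaming (sym to ≈-sym; trans to ≈-trans)

  ⊟≋𝟎 : ∀ {p q} {X : Mat p q} → ⊟ X ≋ 𝟎 → X ≋ 𝟎
  ⊟≋𝟎 {X = X} e i j = ≈-trans (≈-sym (-‿involutive _)) (≈-trans (-‿cong (e i j)) -0#≈0#)
    where open import Algebra.Properties.Ring 𝓡

  ᴴ≋𝟎 : ∀ {p q} {X : Mat p q} → X ᴴ ≋ 𝟎 → X ≋ 𝟎
  ᴴ≋𝟎 {X = X} e i j = ≈-trans (≈-sym (conj-involutive _)) (≈-trans (conj-cong (e j i)) conj-0)

  cancel-invertible : ∀ {p q k l} {s : Mat p q} {t : Mat q p} {c : Mat q l} {d : Mat l q} {X : Mat l k} →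
    t · s ≋ 𝟏 → d · c ≋ 𝟏 → s · (c · X) ≋ 𝟎 → X ≋ 𝟎
  cancel-invertible {p} {q} {k} {l} {s} {t} {c} {d} {X} ts dc e = ≋-trans
    (solve (p ∷ q ∷ l ∷ k ∷ []) ((0F , 1F) ∷ (1F , 0F) ∷ (1F , 2F) ∷ (2F , 1F) ∷ (2F , 3F) ∷ [])
      (λ s t c d X → (t ⊙ s ⇒ 𝕀) ∷ (d ⊙ c ⇒ 𝕀) ∷ [] ⊢ X ⇒ d ⊙ (t ⊙ (s ⊙ (c ⊙ X))))
      (s , t , c , d , X , _) (ts , dc , _))
    (≋-trans (·-congˡ d (≋-trans (·-congˡ t e) (·-𝟎 t))) (·-𝟎 d))

  record Form (n : ℕ) : Set where
    field
      Φ Ψ   : Mat n n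
      skew  : Φ ᴴ ≋ ⊟ Φ
      ΦΨ≋𝟏  : Φ · Ψ ≋ 𝟏
      ΨΦ≋𝟏  : Ψ · Φ ≋ 𝟏

  module Isometries {n : ℕ} (form : Form n) where

    open Form form public

    Isometry : Mat n n → Set
    Isometry g = g · Φ · g ᴴ ≋ Φ

    _⁻¹ : Mat n n → Mat n n
    g ⁻¹ = Φ · g ᴴ · Ψ

    inverseʳ : ∀ {g} → Isometry g → g · g ⁻¹ ≋ 𝟏
    inverseʳ {g} e = solve (n ∷ []) ((0F , 0F) ∷ (0F , 0F) ∷ (0F , 0F) ∷ [])
      (λ g Φ Ψ → (g ⊙ Φ ⊙ g † ⇒ Φ) ∷ (Φ ⊙ Ψ ⇒ 𝕀) ∷ [] ⊢ g ⊙ (Φ ⊙ g † ⊙ Ψ) ⇒ 𝕀) (g , Φ , Ψ , _) (e , ΦΨ≋𝟏 , _)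

    inverseˡ : ∀ {g} → Isometry g → g ⁻¹ · g ≋ 𝟏
    inverseˡ e = left-inverse (inverseʳ e)

    ∘-isometry : ∀ {g h} → Isometry g → Isometry h → Isometry (g · h)
    ∘-isometry {g} {h} e f = solve (n ∷ []) ((0F , 0F) ∷ (0F , 0F) ∷ (0F , 0F) ∷ [])
      (λ g h Φ → (g ⊙ Φ ⊙ g † ⇒ Φ) ∷ (h ⊙ Φ ⊙ h † ⇒ Φ) ∷ [] ⊢ (g ⊙ h) ⊙ Φ ⊙ (g ⊙ h) † ⇒ Φ) (g , h , Φ , _) (e , f , _)

    ⁻¹-isometry : ∀ {g} → Isometry g → Isometry (g ⁻¹)
    ⁻¹-isometry {g} e = ≋-trans
      (·-congʳ (i ᴴ) (·-congˡ i (≋-sym e)))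
      (solve (n ∷ []) ((0F , 0F) ∷ (0F , 0F) ∷ (0F , 0F) ∷ [])
      (λ g i Φ → (i ⊙ g ⇒ 𝕀) ∷ [] ⊢ i ⊙ (g ⊙ Φ ⊙ g †) ⊙ i † ⇒ Φ) (g , i , Φ , _) (inverseˡ e , _))
      where
      i : Mat n n
      i = g ⁻¹

    -- Acts on row vectors by x ↦ x - h(x , w) c w, where h(x , y) = x Φ yᴴ.
    reflection : Mat 1 n → Mat 1 1 → Mat n n
    reflection w c = 𝟏 ⊞ ⊟ (Φ · w ᴴ · c · w)

    reflection-isometry : ∀ w {c d} → c · d ≋ 𝟏 → d ≋ w · Φ · w ᴴ ⊞ d ᴴ → Isometry (reflection w c)
    reflection-isometry w {c} {d} cd e = solve (1 ∷ n ∷ []) ((0F , 1F) ∷ (0F , 0F) ∷ (0F , 0F) ∷ (1F , 1F) ∷ [])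
      (λ w c d Φ → (Φ † ⇒ ⊝ Φ) ∷ (w ⊙ Φ ⊙ w † ⇒ d ⊖ d †) ∷ (c ⊙ d ⇒ 𝕀) ∷ []
        ⊢ (𝕀 ⊖ Φ ⊙ w † ⊙ c ⊙ w) ⊙ Φ ⊙ (𝕀 ⊖ Φ ⊙ w † ⊙ c ⊙ w) † ⇒ Φ)
      (w , c , d , Φ , _) (skew , ≋-trans
        (solve (1 ∷ n ∷ []) ((0F , 1F) ∷ (0F , 0F) ∷ (1F , 1F) ∷ [])
          (λ w d Φ → [] ⊢ w ⊙ Φ ⊙ w † ⇒ (w ⊙ Φ ⊙ w † ⊕ d †) ⊖ d †) (w , d , Φ , _) _)
        (⊞-cong (≋-sym e) (≋-refl {X = ⊟ (d ᴴ)})) , cd , _)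

    Transports : ∀ {k} → Mat k n → Mat 1 n → Mat 1 n → Set
    Transports A x y = Σ (Mat n n) λ g → Isometry g × (A · g ≋ A) × (x · g ≋ y)

    module _ {k : ℕ} {A : Mat k n} {x y : Mat 1 n}
             (xx≋yy : x · Φ · x ᴴ ≋ y · Φ · y ᴴ) (Ax≋Ay : A · Φ · x ᴴ ≋ A · Φ · y ᴴ) where

      transport-by-reflection : ¬ x · Φ · (x ⊞ ⊟ y) ᴴ ≋ 𝟎 → Transports A x y
      transport-by-reflection ≉0 =
        let c , dc , cd = inverse-1×1 _ ≉0
        in reflection w c ,
          reflection-isometry w {c} {d} cd (solve (1 ∷ n ∷ []) ((0F , 1F) ∷ (0F , 1F) ∷ (1F , 1F) ∷ [])
            (λ x y Φ → (Φ † ⇒ ⊝ Φ) ∷ (x ⊙ Φ ⊙ x † ⇒ y ⊙ Φ ⊙ y †) ∷ []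
              ⊢ x ⊙ Φ ⊙ (x ⊖ y) † ⇒ (x ⊖ y) ⊙ Φ ⊙ (x ⊖ y) † ⊕ (x ⊙ Φ ⊙ (x ⊖ y) †) †)
            (x , y , Φ , _) (skew , xx≋yy , _)) ,
          solve (1 ∷ n ∷ k ∷ []) ((2F , 1F) ∷ (0F , 1F) ∷ (0F , 1F) ∷ (0F , 0F) ∷ (1F , 1F) ∷ [])
            (λ A x y c Φ → (A ⊙ Φ ⊙ x † ⇒ A ⊙ Φ ⊙ y †) ∷ []
              ⊢ A ⊙ (𝕀 ⊖ Φ ⊙ (x ⊖ y) † ⊙ c ⊙ (x ⊖ y)) ⇒ A)
            (A , x , y , c , Φ , _) (Ax≋Ay , _) ,
          ≋-trans (solve (1 ∷ n ∷ []) ((0F , 1F) ∷ (0F , 1F) ∷ (0F , 0F) ∷ (0F , 0F) ∷ (1F , 1F) ∷ [])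
            (λ x w d c Φ → (x ⊙ Φ ⊙ w † ⇒ d) ∷ (d ⊙ c ⇒ 𝕀) ∷ []
              ⊢ x ⊙ (𝕀 ⊖ Φ ⊙ w † ⊙ c ⊙ w) ⇒ x ⊖ w)
            (x , w , d , c , Φ , _) (≋-refl {X = d} , dc , _))
          (solve (1 ∷ n ∷ []) ((0F , 1F) ∷ (0F , 1F) ∷ []) (λ x y → [] ⊢ x ⊖ (x ⊖ y) ⇒ y) (x , y , _) _)
        where
        w : Mat 1 n
        w = x ⊞ ⊟ y
        d : Mat 1 1
        d = x · Φ · w ᴴ

    separating-column : ∀ {k} {A : Mat k n} {x y : Mat 1 n} {u v : Mat n 1} →
      x · u ≋ 𝟏 → A · u ≋ 𝟎 → y · v ≋ 𝟏 → A · v ≋ 𝟎 →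
      Σ (Mat n 1) λ s → (¬ x · s ≋ 𝟎) × (¬ y · s ≋ 𝟎) × (A · s ≋ 𝟎)
    separating-column {k} {A} {x} {y} {u} {v} xu Au yv Av = go (zero? (y · u)) (zero? (x · v))
      where
      𝟏≉𝟎 : ∀ {X : Mat 1 1} → X ≋ 𝟏 → ¬ X ≋ 𝟎
      𝟏≉𝟎 e f = 1≉0 (≈-trans (≈-sym (e 0F 0F)) (f 0F 0F))
      go : Dec (y · u ≋ 𝟎) → Dec (x · v ≋ 𝟎) →
           Σ (Mat n 1) λ s → (¬ x · s ≋ 𝟎) × (¬ y · s ≋ 𝟎) × (A · s ≋ 𝟎)
      go (no yu) _       = u , 𝟏≉𝟎 xu , yu , Au
      go (yes _) (no xv) = v , xv , 𝟏≉𝟎 yv , Av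
      go (yes yu) (yes xv) = u ⊞ v ,
        𝟏≉𝟎 (solve (1 ∷ n ∷ []) ((0F , 1F) ∷ (1F , 0F) ∷ (1F , 0F) ∷ [])
          (λ x u v → (x ⊙ u ⇒ 𝕀) ∷ (x ⊙ v ⇒ 𝟘) ∷ [] ⊢ x ⊙ (u ⊕ v) ⇒ 𝕀) (x , u , v , _) (xu , xv , _)) ,
        𝟏≉𝟎 (solve (1 ∷ n ∷ []) ((0F , 1F) ∷ (1F , 0F) ∷ (1F , 0F) ∷ [])
          (λ y u v → (y ⊙ v ⇒ 𝕀) ∷ (y ⊙ u ⇒ 𝟘) ∷ [] ⊢ y ⊙ (u ⊕ v) ⇒ 𝕀) (y , u , v , _) (yv , yu , _)) ,
        solve (1 ∷ n ∷ k ∷ []) ((2F , 1F) ∷ (1F , 0F) ∷ (1F , 0F) ∷ [])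
          (λ A u v → (A ⊙ v ⇒ 𝟘) ∷ (A ⊙ u ⇒ 𝟘) ∷ [] ⊢ A ⊙ (u ⊕ v) ⇒ 𝟘) (A , u , v , _) (Av , Au , _)

    reflection-coefficient : (w : Mat 1 n) →
      Σ (Mat 1 1) λ c → Σ (Mat 1 1) λ d → (c · d ≋ 𝟏) × (d · c ≋ 𝟏) × (d ≋ w · Φ · w ᴴ ⊞ d ᴴ)
    reflection-coefficient w =
      let z , z≉0 , e = skew-half (h 0F 0F) (h-skew 0F 0F)
          c , dc , cd = inverse-1×1 (scalar z) (λ f → z≉0 (f 0F 0F))
      in c , scalar z , cd , dc , λ { 0F 0F → e }
      where
      h : Mat 1 1
      h = w · Φ · w ᴴ
      h-skew : h ᴴ ≋ ⊟ h
      h-skew = solve (1 ∷ n ∷ []) ((0F , 1F) ∷ (1F , 1F) ∷ [])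
        (λ w Φ → (Φ † ⇒ ⊝ Φ) ∷ [] ⊢ (w ⊙ Φ ⊙ w †) † ⇒ ⊝ (w ⊙ Φ ⊙ w †)) (w , Φ , _) (skew , _)

    -- If h(x , x - y) = 0, no reflection takes x to y, but a reflection fixing A
    -- takes x to some x₁ with h(x₁ , x₁ - y) ≠ 0.
    transport : ∀ {k} {A : Mat k n} {x y : Mat 1 n} {u v : Mat n 1} →
      x · Φ · x ᴴ ≋ y · Φ · y ᴴ → A · Φ · x ᴴ ≋ A · Φ · y ᴴ →
      x · u ≋ 𝟏 → A · u ≋ 𝟎 → y · v ≋ 𝟏 → A · v ≋ 𝟎 → Transports A x y
    transport {k} {A} {x} {y} {u} {v} xx Ax xu Au yv Av = go (zero? (x · Φ · (x ⊞ ⊟ y) ᴴ))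
      where
      go : Dec (x · Φ · (x ⊞ ⊟ y) ᴴ ≋ 𝟎) → Transports A x y
      go (no ≉0)  = transport-by-reflection xx Ax ≉0
      go (yes d≋0) =
        let s , xs , ys , As = separating-column xu Au yv Av
            c , d , cd , dc , e = reflection-coefficient ((Ψ · s) ᴴ)
        in via s xs ys As c d cd dc e
        where
        via : ∀ s → ¬ x · s ≋ 𝟎 → ¬ y · s ≋ 𝟎 → A · s ≋ 𝟎 →
              ∀ c d → c · d ≋ 𝟏 → d · c ≋ 𝟏 → d ≋ (Ψ · s) ᴴ · Φ · ((Ψ · s) ᴴ) ᴴ ⊞ d ᴴ → Transports A x y
        via s xs ys As c d cd dc e =
          let g₂ , iso₂ , fix₂ , move₂ = transport-by-reflection {A = A} {x₁} {y} x₁x₁ Ax₁ x₁≉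
          in g · g₂ , ∘-isometry iso iso₂ ,
             solve (n ∷ k ∷ []) ((1F , 0F) ∷ (0F , 0F) ∷ (0F , 0F) ∷ [])
               (λ A g g₂ → (A ⊙ g ⇒ A) ∷ (A ⊙ g₂ ⇒ A) ∷ [] ⊢ A ⊙ (g ⊙ g₂) ⇒ A) (A , g , g₂ , _) (fix , fix₂ , _) ,
             ≋-trans (≋-sym (·-assoc x g g₂)) move₂
          where
          w : Mat 1 n
          w = (Ψ · s) ᴴ
          g : Mat n n
          g = reflection w c
          x₁ : Mat 1 n
          x₁ = x · g
          iso : Isometry g
          iso = reflection-isometry w {c} {d} cd e
          Φwᴴ : Φ · w ᴴ ≋ s
          Φwᴴ = solve (1 ∷ n ∷ []) ((1F , 1F) ∷ (1F , 1F) ∷ (1F , 0F) ∷ [])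
            (λ Φ Ψ s → (Φ ⊙ Ψ ⇒ 𝕀) ∷ [] ⊢ Φ ⊙ (Ψ ⊙ s) † † ⇒ s) (Φ , Ψ , s , _) (ΦΨ≋𝟏 , _)
          fix : A · g ≋ A
          fix = solve (1 ∷ n ∷ k ∷ []) ((2F , 1F) ∷ (1F , 0F) ∷ (0F , 1F) ∷ (0F , 0F) ∷ (1F , 1F) ∷ [])
            (λ A s w c Φ → (Φ ⊙ w † ⇒ s) ∷ (A ⊙ s ⇒ 𝟘) ∷ []
              ⊢ A ⊙ (𝕀 ⊖ Φ ⊙ w † ⊙ c ⊙ w) ⇒ A) (A , s , w , c , Φ , _) (Φwᴴ , As , _)
          x₁x₁ : x₁ · Φ · x₁ ᴴ ≋ y · Φ · y ᴴ
          x₁x₁ = ≋-trans (solve (1 ∷ n ∷ []) ((0F , 1F) ∷ (1F , 1F) ∷ (1F , 1F) ∷ [])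
            (λ x g Φ → (g ⊙ Φ ⊙ g † ⇒ Φ) ∷ [] ⊢ (x ⊙ g) ⊙ Φ ⊙ (x ⊙ g) † ⇒ x ⊙ Φ ⊙ x †) (x , g , Φ , _) (iso , _)) xx
          Ax₁ : A · Φ · x₁ ᴴ ≋ A · Φ · y ᴴ
          Ax₁ = ≋-trans (·-congʳ (x₁ ᴴ) (·-congʳ Φ (≋-sym fix)))
            (≋-trans (solve (1 ∷ n ∷ k ∷ []) ((0F , 1F) ∷ (1F , 1F) ∷ (1F , 1F) ∷ (2F , 1F) ∷ [])
              (λ x g Φ A → (g ⊙ Φ ⊙ g † ⇒ Φ) ∷ [] ⊢ (A ⊙ g) ⊙ Φ ⊙ (x ⊙ g) † ⇒ A ⊙ Φ ⊙ x †)
              (x , g , Φ , A , _) (iso , _)) Ax)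
          value : x₁ · Φ · (x₁ ⊞ ⊟ y) ᴴ ≋ ⊟ ((x · s) · (c · (y · s) ᴴ))
          value = ≋-trans (solve (1 ∷ n ∷ []) ((0F , 1F) ∷ (0F , 1F) ∷ (1F , 1F) ∷ (1F , 1F) ∷ [])
              (λ x y g Φ → (g ⊙ Φ ⊙ g † ⇒ Φ) ∷ [] ⊢ (x ⊙ g) ⊙ Φ ⊙ (x ⊙ g ⊖ y) † ⇒ x ⊙ Φ ⊙ x † ⊖ x ⊙ g ⊙ Φ ⊙ y †)
              (x , y , g , Φ , _) (iso , _))
            (solve (1 ∷ n ∷ []) ((0F , 1F) ∷ (0F , 1F) ∷ (1F , 1F) ∷ (1F , 0F) ∷ (0F , 1F) ∷ (0F , 0F) ∷ [])
              (λ x y Φ s w c → (Φ ⊙ w † ⇒ s) ∷ (w ⊙ Φ ⇒ ⊝ (s †)) ∷ (x ⊙ Φ ⊙ y † ⇒ x ⊙ Φ ⊙ x †) ∷ []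
                ⊢ x ⊙ Φ ⊙ x † ⊖ x ⊙ (𝕀 ⊖ Φ ⊙ w † ⊙ c ⊙ w) ⊙ Φ ⊙ y † ⇒ ⊝ ((x ⊙ s) ⊙ (c ⊙ (y ⊙ s) †)))
              (x , y , Φ , s , w , c , _) (Φwᴴ , wΦ , xy , _))
            where
            wΦ : w · Φ ≋ ⊟ (s ᴴ)
            wΦ = ≋-trans (solve (1 ∷ n ∷ []) ((0F , 1F) ∷ (1F , 1F) ∷ [])
              (λ w Φ → (Φ † ⇒ ⊝ Φ) ∷ [] ⊢ w ⊙ Φ ⇒ ⊝ ((Φ ⊙ w †) †)) (w , Φ , _) (skew , _)) (⊟-cong (ᴴ-cong Φwᴴ))
            xy : x · Φ · y ᴴ ≋ x · Φ · x ᴴ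
            xy = ≋-sym (⊞⊟≋𝟎 {X = x · Φ · x ᴴ} (≋-trans (solve (1 ∷ n ∷ []) ((0F , 1F) ∷ (0F , 1F) ∷ (1F , 1F) ∷ [])
              (λ x y Φ → [] ⊢ x ⊙ Φ ⊙ x † ⊖ x ⊙ Φ ⊙ y † ⇒ x ⊙ Φ ⊙ (x ⊖ y) †) (x , y , Φ , _) _) d≋0))
          x₁≉ : ¬ x₁ · Φ · (x₁ ⊞ ⊟ y) ᴴ ≋ 𝟎
          x₁≉ f = let t , _ , ts = inverse-1×1 (x · s) xs in ys
            (ᴴ≋𝟎 (cancel-invertible {s = x · s} {t} {c} {d} {(y · s) ᴴ} ts dc (⊟≋𝟎 (≋-trans (≋-sym value) f))))

    witt : ∀ k {M M′ : Mat k n} {N N′ : Mat n k} → M · N ≋ 𝟏 → M′ · N′ ≋ 𝟏 →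
           M · Φ · M ᴴ ≋ M′ · Φ · M′ ᴴ → Σ (Mat n n) λ g → Isometry g × (M · g ≋ M′)
    witt zero {M} {M′} _ _ _ = 𝟏 ,
      solve (n ∷ []) ((0F , 0F) ∷ []) (λ Φ → [] ⊢ 𝕀 ⊙ Φ ⊙ 𝕀 † ⇒ Φ) (Φ , _) _ , λ ()
    witt (suc k) {M} {M′} {N} {N′} MN M′N′ e =
      let g , iso , move = witt k {l · M} {l · M′} {N · l ᴴ} {N′ · l ᴴ}
            (restrict M N MN) (restrict M′ N′ M′N′)
            (solve (n ∷ k ∷ suc k ∷ []) ((1F , 2F) ∷ (2F , 0F) ∷ (2F , 0F) ∷ (0F , 0F) ∷ [])
              (λ l M M′ Φ → (M ⊙ Φ ⊙ M † ⇒ M′ ⊙ Φ ⊙ M′ †) ∷ []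
                ⊢ (l ⊙ M) ⊙ Φ ⊙ (l ⊙ M) † ⇒ (l ⊙ M′) ⊙ Φ ⊙ (l ⊙ M′) †) (l , M , M′ , Φ , _) (e , _))
          g′ , iso′ , fix′ , move′ = first g iso move
      in g · g′ , ∘-isometry iso iso′ , rows-ext {1} {k} {X = M · (g · g′)} {M′}
        (≋-trans (solve (n ∷ 1 ∷ suc k ∷ []) ((1F , 2F) ∷ (2F , 0F) ∷ (0F , 0F) ∷ (0F , 0F) ∷ [])
           (λ u M g g′ → [] ⊢ u ⊙ (M ⊙ (g ⊙ g′)) ⇒ ((u ⊙ M) ⊙ g) ⊙ g′) (u , M , g , g′ , _) _) move′)
        (≋-trans (solve (n ∷ k ∷ suc k ∷ []) ((1F , 2F) ∷ (2F , 0F) ∷ (0F , 0F) ∷ (0F , 0F) ∷ [])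
           (λ l M g g′ → [] ⊢ l ⊙ (M ⊙ (g ⊙ g′)) ⇒ ((l ⊙ M) ⊙ g) ⊙ g′) (l , M , g , g′ , _) _)
           (≋-trans (·-congʳ g′ move) fix′))
      where
      u : Mat 1 (suc k)
      u = upper {1}
      l : Mat k (suc k)
      l = lower {k} {1}
      restrict : ∀ (M : Mat (suc k) n) (N : Mat n (suc k)) → M · N ≋ 𝟏 → (l · M) · (N · l ᴴ) ≋ 𝟏
      restrict M N e = solve (n ∷ k ∷ suc k ∷ []) ((1F , 2F) ∷ (2F , 0F) ∷ (0F , 2F) ∷ [])
        (λ l M N → (M ⊙ N ⇒ 𝕀) ∷ (l ⊙ l † ⇒ 𝕀) ∷ [] ⊢ (l ⊙ M) ⊙ (N ⊙ l †) ⇒ 𝕀) (l , M , N , _) (e , lower-lowerᴴ {k} {1} , _)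
      first : ∀ g → Isometry g → (l · M) · g ≋ l · M′ → Transports (l · M′) ((u · M) · g) (u · M′)
      first g iso move = transport {A = l · M′} {(u · M) · g} {u · M′} {g ⁻¹ · N · u ᴴ} {N′ · u ᴴ}
        (solve (n ∷ 1 ∷ suc k ∷ []) ((1F , 2F) ∷ (2F , 0F) ∷ (2F , 0F) ∷ (0F , 0F) ∷ (0F , 0F) ∷ [])
          (λ u M M′ Φ g → (g ⊙ Φ ⊙ g † ⇒ Φ) ∷ (M ⊙ Φ ⊙ M † ⇒ M′ ⊙ Φ ⊙ M′ †) ∷ []
            ⊢ ((u ⊙ M) ⊙ g) ⊙ Φ ⊙ ((u ⊙ M) ⊙ g) † ⇒ (u ⊙ M′) ⊙ Φ ⊙ (u ⊙ M′) †)
          (u , M , M′ , Φ , g , _) (iso , e , _))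
        (≋-trans (·-congʳ (((u · M) · g) ᴴ) (·-congʳ Φ (≋-sym move)))
          (solve (n ∷ 1 ∷ suc k ∷ k ∷ []) ((1F , 2F) ∷ (3F , 2F) ∷ (2F , 0F) ∷ (2F , 0F) ∷ (0F , 0F) ∷ (0F , 0F) ∷ [])
          (λ u l M M′ Φ g → (g ⊙ Φ ⊙ g † ⇒ Φ) ∷ (M ⊙ Φ ⊙ M † ⇒ M′ ⊙ Φ ⊙ M′ †) ∷ []
            ⊢ ((l ⊙ M) ⊙ g) ⊙ Φ ⊙ ((u ⊙ M) ⊙ g) † ⇒ (l ⊙ M′) ⊙ Φ ⊙ (u ⊙ M′) †)
          (u , l , M , M′ , Φ , g , _) (iso , e , _)))
        (solve (n ∷ 1 ∷ suc k ∷ []) ((1F , 2F) ∷ (2F , 0F) ∷ (0F , 2F) ∷ (0F , 0F) ∷ (0F , 0F) ∷ [])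
          (λ u M N g i → (g ⊙ i ⇒ 𝕀) ∷ (M ⊙ N ⇒ 𝕀) ∷ (u ⊙ u † ⇒ 𝕀) ∷ []
            ⊢ ((u ⊙ M) ⊙ g) ⊙ (i ⊙ N ⊙ u †) ⇒ 𝕀)
          (u , M , N , g , g ⁻¹ , _) (inverseʳ iso , MN , upper-upperᴴ {1} , _))
        (≋-trans (·-congʳ (g ⁻¹ · N · u ᴴ) (≋-sym move))
          (solve (n ∷ 1 ∷ suc k ∷ k ∷ []) ((1F , 2F) ∷ (3F , 2F) ∷ (2F , 0F) ∷ (0F , 2F) ∷ (0F , 0F) ∷ (0F , 0F) ∷ [])
          (λ u l M N g i → (g ⊙ i ⇒ 𝕀) ∷ (M ⊙ N ⇒ 𝕀) ∷ (u ⊙ l † ⇒ 𝟘) ∷ []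
            ⊢ ((l ⊙ M) ⊙ g) ⊙ (i ⊙ N ⊙ u †) ⇒ 𝟘)
          (u , l , M , N , g , g ⁻¹ , _) (inverseʳ iso , MN , upper-lowerᴴ {1} , _)))
        (solve (n ∷ 1 ∷ suc k ∷ []) ((1F , 2F) ∷ (2F , 0F) ∷ (0F , 2F) ∷ [])
          (λ u M N → (M ⊙ N ⇒ 𝕀) ∷ (u ⊙ u † ⇒ 𝕀) ∷ [] ⊢ (u ⊙ M) ⊙ (N ⊙ u †) ⇒ 𝕀)
          (u , M′ , N′ , _) (M′N′ , upper-upperᴴ {1} , _))
        (solve (n ∷ 1 ∷ suc k ∷ k ∷ []) ((1F , 2F) ∷ (3F , 2F) ∷ (2F , 0F) ∷ (0F , 2F) ∷ [])
          (λ u l M N → (M ⊙ N ⇒ 𝕀) ∷ (u ⊙ l † ⇒ 𝟘) ∷ [] ⊢ (l ⊙ M) ⊙ (N ⊙ u †) ⇒ 𝟘)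
          (u , l , M′ , N′ , _) (M′N′ , upper-lowerᴴ {1} , _))

module DoubledSpace (𝓡 : Ring 0ℓ 0ℓ) (involution : Involution 𝓡) (division : IsDivision 𝓡 involution) where

  open SkewHermitian 𝓡 involution division public

  orthogonal-ranks : ∀ {a b n} {A : Mat a n} {A′ : Mat n a} {B : Mat n b} {B′ : Mat b n} →
    A · A′ ≋ 𝟏 → B′ · B ≋ 𝟏 → A · B ≋ 𝟎 → a ℕ.+ b ≤ n
  orthogonal-ranks {a} {b} {n} {A} {A′} {B} {B′} e f o = right-invertible⇒≤ (a ℕ.+ b) n
    (upper ᴴ · A ⊞ lower ᴴ · (B′ ⊞ ⊟ (B′ · A′ · A))) (A′ · upper ⊞ B · lower)
    (≋-trans (solve (a ∷ b ∷ n ∷ a ℕ.+ b ∷ [])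
      ((0F , 3F) ∷ (1F , 3F) ∷ (0F , 2F) ∷ (2F , 0F) ∷ (2F , 1F) ∷ (1F , 2F) ∷ [])
      (λ U L A A′ B B′ → (A ⊙ A′ ⇒ 𝕀) ∷ (B′ ⊙ B ⇒ 𝕀) ∷ (A ⊙ B ⇒ 𝟘) ∷ []
        ⊢ (U † ⊙ A ⊕ L † ⊙ (B′ ⊖ B′ ⊙ A′ ⊙ A)) ⊙ (A′ ⊙ U ⊕ B ⊙ L) ⇒ U † ⊙ U ⊕ L † ⊙ L)
      (upper , lower , A , A′ , B , B′ , _) (e , f , o , _))
    (blocks-resolution {a} {b}))

  module Lagrangians {n : ℕ} (form : Form n) where

    open Isometries form public

    -- The rows of [X | Y] form a basis of a Lagrangian subspace of V ⊕ (- V), where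
    -- V is the row space with the form x Φ yᴴ.
    record Lagrangian (X Y : Mat n n) : Set where
      field
        X′ Y′     : Mat n n
        basis     : X · X′ ⊞ Y · Y′ ≋ 𝟏
        isotropic : X · Φ · X ᴴ ≋ Y · Φ · Y ᴴ

    swap : ∀ {X Y} → Lagrangian X Y → Lagrangian Y X
    swap {X} {Y} L = record
      { X′ = Y′ ; Y′ = X′ ; isotropic = ≋-sym isotropic
      ; basis = ≋-trans (solve (n ∷ []) ((0F , 0F) ∷ (0F , 0F) ∷ []) (λ A B → [] ⊢ B ⊕ A ⇒ A ⊕ B)
                  (X · X′ , Y · Y′ , _) _) basis }
      where open Lagrangian L

    -- The rows of E₁ Y form a basis of the intersection with 0 ⊕ V.
    module Kernel {X Y : Mat n n} (L : Lagrangian X Y) {ρ k : ℕ} (f : Factorization X ρ)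
                  (c : Complement (Factorization.F f) (Factorization.E f) k) where

      open Lagrangian L
      open Factorization f
      open Complement c

      E₁X≋𝟎 : E₁ · X ≋ 𝟎
      E₁X≋𝟎 = solve (n ∷ ρ ∷ k ∷ []) ((0F , 0F) ∷ (0F , 1F) ∷ (1F , 0F) ∷ (2F , 0F) ∷ [])
        (λ X F G E₁ → (X ⇒ F ⊙ G) ∷ (E₁ ⊙ F ⇒ 𝟘) ∷ [] ⊢ E₁ ⊙ X ⇒ 𝟘) (X , F , G , E₁ , _) (X≋FG , E₁F≋𝟎 , _)

      independent : E₁ · Y · (Y′ · F₁) ≋ 𝟏
      independent = ≋-trans
        (solve (n ∷ k ∷ []) ((0F , 0F) ∷ (0F , 0F) ∷ (0F , 0F) ∷ (0F , 0F) ∷ (1F , 0F) ∷ (0F , 1F) ∷ [])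
          (λ X X′ Y Y′ E₁ F₁ → (E₁ ⊙ X ⇒ 𝟘) ∷ [] ⊢ E₁ ⊙ Y ⊙ (Y′ ⊙ F₁) ⇒ E₁ ⊙ (X ⊙ X′ ⊕ Y ⊙ Y′) ⊙ F₁)
          (X , X′ , Y , Y′ , E₁ , F₁ , _) (E₁X≋𝟎 , _))
        (≋-trans (·-congʳ F₁ (·-congˡ E₁ basis))
        (solve (n ∷ k ∷ []) ((1F , 0F) ∷ (0F , 1F) ∷ [])
          (λ E₁ F₁ → (E₁ ⊙ F₁ ⇒ 𝕀) ∷ [] ⊢ E₁ ⊙ 𝕀 ⊙ F₁ ⇒ 𝕀) (E₁ , F₁ , _) (E₁F₁≋𝟏 , _)))

      orthogonal : E₁ · Y · Φ · Y ᴴ ≋ 𝟎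
      orthogonal = solve (n ∷ k ∷ []) ((0F , 0F) ∷ (0F , 0F) ∷ (1F , 0F) ∷ (0F , 0F) ∷ [])
        (λ X Y E₁ Φ → (Y ⊙ Φ ⊙ Y † ⇒ X ⊙ Φ ⊙ X †) ∷ (E₁ ⊙ X ⇒ 𝟘) ∷ [] ⊢ E₁ ⊙ Y ⊙ Φ ⊙ Y † ⇒ 𝟘)
        (X , Y , E₁ , Φ , _) (≋-sym isotropic , E₁X≋𝟎 , _)

      kernel-rank : ∀ {σ} → Factorization Y σ → k ℕ.+ σ ≤ n
      kernel-rank {σ} g = orthogonal-ranks {A = E₁ · Y} {Y′ · F₁} {Φ · g.G ᴴ} {g.H ᴴ · Ψ} independent
        (solve (n ∷ σ ∷ []) ((0F , 0F) ∷ (0F , 0F) ∷ (1F , 0F) ∷ (0F , 1F) ∷ [])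
          (λ Φ Ψ G H → (Ψ ⊙ Φ ⇒ 𝕀) ∷ (G ⊙ H ⇒ 𝕀) ∷ [] ⊢ (H † ⊙ Ψ) ⊙ (Φ ⊙ G †) ⇒ 𝕀)
          (Φ , Ψ , g.G , g.H , _) (ΨΦ≋𝟏 , g.GH≋𝟏 , _))
        (≋-trans (solve (n ∷ σ ∷ k ∷ []) ((0F , 0F) ∷ (0F , 0F) ∷ (2F , 0F) ∷ (1F , 0F) ∷ (0F , 1F) ∷ (1F , 0F) ∷ [])
          (λ Φ Y E₁ E F G → (E ⊙ F ⇒ 𝕀) ∷ []
            ⊢ (E₁ ⊙ Y) ⊙ (Φ ⊙ G †) ⇒ E₁ ⊙ Y ⊙ Φ ⊙ ((E ⊙ F) ⊙ G) †)
          (Φ , Y , E₁ , g.E , g.F , g.G , _) (g.EF≋𝟏 , _))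
        (≋-trans (solve (n ∷ σ ∷ k ∷ []) ((0F , 0F) ∷ (0F , 0F) ∷ (2F , 0F) ∷ (1F , 0F) ∷ (0F , 1F) ∷ (1F , 0F) ∷ [])
          (λ Φ Y E₁ E F G → (F ⊙ G ⇒ Y) ∷ [] ⊢ E₁ ⊙ Y ⊙ Φ ⊙ ((E ⊙ F) ⊙ G) † ⇒ E₁ ⊙ Y ⊙ Φ ⊙ Y † ⊙ E †)
          (Φ , Y , E₁ , g.E , g.F , g.G , _) (≋-sym g.X≋FG , _))
        (≋-trans (·-congʳ (g.E ᴴ) orthogonal) (𝟎-· (g.E ᴴ)))))
        where module g = Factorization g

    -- [X | Y u] and [X | X + B P] agree: up to isometries a Lagrangian is determined by
    -- the dimension k of its intersection with V ⊕ 0, which is spanned by P.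
    record NormalForm (X Y : Mat n n) (k : ℕ) : Set where
      field
        u          : Mat n n
        P          : Mat k n
        P′         : Mat n k
        B          : Mat n k
        isometry   : Isometry u
        PP′≋𝟏      : P · P′ ≋ 𝟏
        PΦPᴴ≋𝟎     : P · Φ · P ᴴ ≋ 𝟎
        PΦXᴴ≋𝟎     : P · Φ · X ᴴ ≋ 𝟎
        XΦPᴴ≋𝟎     : X · Φ · P ᴴ ≋ 𝟎
        Yu≋X+BP    : Y · u ≋ X ⊞ B · P

    module _ {X Y : Mat n n} (L : Lagrangian X Y) {ρ σ k : ℕ}
             (f : Factorization X ρ) (c : Complement (Factorization.F f) (Factorization.E f) k)
             (g : Factorization Y σ) (d : Complement (Factorization.F g) (Factorization.E g) k) where

      private
        open Lagrangian L
        module f = Factorization f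
        module c = Complement c
        module g = Factorization g
        module d = Complement d
        module K = Kernel L f c
        module K′ = Kernel (swap L) g d

        P Q : Mat k n
        P = d.E₁ · X
        Q = c.E₁ · Y

        A : Mat k ρ
        A = d.E₁ · f.F

        A′ C : Mat ρ k
        A′ = f.G · X′ · d.F₁
        C = A′ · (𝟏 ⊞ d.E₁ · c.F₁)

        Ỹ : Mat ρ n
        Ỹ = f.E · Y ⊞ C · Q

        AA′≋𝟏 : A · A′ ≋ 𝟏
        AA′≋𝟏 = ≋-trans
          (solve (n ∷ ρ ∷ k ∷ []) ((2F , 0F) ∷ (0F , 2F) ∷ (0F , 1F) ∷ (1F , 0F) ∷ (0F , 0F) ∷ (0F , 0F) ∷ [])
            (λ E₁ F₁ F G X X′ → (F ⊙ G ⇒ X) ∷ [] ⊢ (E₁ ⊙ F) ⊙ (G ⊙ X′ ⊙ F₁) ⇒ E₁ ⊙ X ⊙ (X′ ⊙ F₁))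
            (d.E₁ , d.F₁ , f.F , f.G , X , X′ , _) (≋-sym f.X≋FG , _))
          K′.independent

        AỸ≋Q : A · Ỹ ≋ Q
        AỸ≋Q = solve (n ∷ ρ ∷ k ∷ [])
          ((2F , 0F) ∷ (0F , 1F) ∷ (1F , 0F) ∷ (0F , 2F) ∷ (2F , 0F) ∷ (1F , 2F) ∷ (0F , 0F) ∷ [])
          (λ D₁ F E F₁ E₁ A′ Y → (F ⊙ E ⇒ 𝕀 ⊖ F₁ ⊙ E₁) ∷ (D₁ ⊙ F ⊙ A′ ⇒ 𝕀) ∷ (D₁ ⊙ Y ⇒ 𝟘) ∷ []
            ⊢ (D₁ ⊙ F) ⊙ (E ⊙ Y ⊕ (A′ ⊙ (𝕀 ⊕ D₁ ⊙ F₁)) ⊙ (E₁ ⊙ Y)) ⇒ E₁ ⊙ Y)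
          (d.E₁ , f.F , f.E , c.F₁ , c.E₁ , A′ , Y , _)
          (≋-trans (solve (n ∷ ρ ∷ []) ((0F , 1F) ∷ (1F , 0F) ∷ [])
             (λ F E → [] ⊢ F ⊙ E ⇒ 𝕀 ⊖ (𝕀 ⊖ F ⊙ E)) (f.F , f.E , _) _)
             (⊞-cong (≋-refl {X = 𝟏}) (⊟-cong (≋-sym c.split))) , AA′≋𝟏 , K′.E₁X≋𝟎 , _)

        gram : f.G · Φ · f.G ᴴ ≋ Ỹ · Φ · Ỹ ᴴ
        gram = ≋-trans
          (solve (n ∷ ρ ∷ []) ((0F , 0F) ∷ (0F , 0F) ∷ (0F , 1F) ∷ (1F , 0F) ∷ (1F , 0F) ∷ [])
            (λ X Φ F G E → (X ⇒ F ⊙ G) ∷ (E ⊙ F ⇒ 𝕀) ∷ [] ⊢ G ⊙ Φ ⊙ G † ⇒ E ⊙ (X ⊙ Φ ⊙ X †) ⊙ E †)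
            (X , Φ , f.F , f.G , f.E , _) (f.X≋FG , f.EF≋𝟏 , _))
          (≋-trans (·-congʳ (f.E ᴴ) (·-congˡ f.E isotropic))
          (solve (n ∷ ρ ∷ k ∷ []) ((0F , 0F) ∷ (0F , 0F) ∷ (1F , 0F) ∷ (1F , 2F) ∷ (2F , 0F) ∷ [])
            (λ Y Φ E C E₁ → (E₁ ⊙ Y ⊙ Φ ⊙ Y † ⇒ 𝟘) ∷ (Y ⊙ Φ ⊙ Y † ⊙ E₁ † ⇒ 𝟘) ∷ []
              ⊢ E ⊙ (Y ⊙ Φ ⊙ Y †) ⊙ E † ⇒ (E ⊙ Y ⊕ C ⊙ (E₁ ⊙ Y)) ⊙ Φ ⊙ (E ⊙ Y ⊕ C ⊙ (E₁ ⊙ Y)) †)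
            (Y , Φ , f.E , C , c.E₁ , _) (K.orthogonal ,
            solve (n ∷ ρ ∷ k ∷ []) ((0F , 0F) ∷ (0F , 0F) ∷ (0F , 0F) ∷ (2F , 0F) ∷ [])
              (λ X Y Φ E₁ → (Y ⊙ Φ ⊙ Y † ⇒ X ⊙ Φ ⊙ X †) ∷ (E₁ ⊙ X ⇒ 𝟘) ∷ [] ⊢ Y ⊙ Φ ⊙ Y † ⊙ E₁ † ⇒ 𝟘)
              (X , Y , Φ , c.E₁ , _) (≋-sym isotropic , K.E₁X≋𝟎 , _) , _)))

        trivial-kernel : ∀ {l} (Z : Mat l ρ) → Z · Ỹ ≋ 𝟎 → Z ≋ 𝟎
        trivial-kernel {l} Z e = ≋-trans Z≋SA (≋-trans (·-congʳ A S≋𝟎) (𝟎-· A))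
          where
          U : Mat l n
          U = Z · (f.E ⊞ C · c.E₁)
          S : Mat l k
          S = U · d.F₁
          UY≋𝟎 : U · Y ≋ 𝟎
          UY≋𝟎 = ≋-trans (solve (n ∷ ρ ∷ k ∷ l ∷ []) ((3F , 1F) ∷ (1F , 0F) ∷ (1F , 2F) ∷ (2F , 0F) ∷ (0F , 0F) ∷ [])
            (λ Z E C E₁ Y → [] ⊢ (Z ⊙ (E ⊕ C ⊙ E₁)) ⊙ Y ⇒ Z ⊙ (E ⊙ Y ⊕ C ⊙ (E₁ ⊙ Y)))
            (Z , f.E , C , c.E₁ , Y , _) _) e
          UF≋𝟎 : U · g.F ≋ 𝟎
          UF≋𝟎 = solve (n ∷ σ ∷ l ∷ []) ((2F , 0F) ∷ (0F , 0F) ∷ (0F , 1F) ∷ (1F , 0F) ∷ (0F , 1F) ∷ [])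
            (λ U Y F G H → (F ⇒ Y ⊙ H) ∷ (U ⊙ Y ⇒ 𝟘) ∷ [] ⊢ U ⊙ F ⇒ 𝟘) (U , Y , g.F , g.G , g.H , _)
            (solve (n ∷ σ ∷ []) ((0F , 0F) ∷ (0F , 1F) ∷ (1F , 0F) ∷ (0F , 1F) ∷ [])
              (λ Y F G H → (Y ⇒ F ⊙ G) ∷ (G ⊙ H ⇒ 𝕀) ∷ [] ⊢ F ⇒ Y ⊙ H) (Y , g.F , g.G , g.H , _)
              (g.X≋FG , g.GH≋𝟏 , _) , UY≋𝟎 , _)
          Z≋SA : Z ≋ S · A
          Z≋SA = ≋-trans (solve (n ∷ ρ ∷ k ∷ l ∷ [])
              ((3F , 1F) ∷ (1F , 0F) ∷ (1F , 2F) ∷ (2F , 0F) ∷ (0F , 1F) ∷ [])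
              (λ Z E C E₁ F → (E ⊙ F ⇒ 𝕀) ∷ (E₁ ⊙ F ⇒ 𝟘) ∷ [] ⊢ Z ⇒ (Z ⊙ (E ⊕ C ⊙ E₁)) ⊙ F)
              (Z , f.E , C , c.E₁ , f.F , _) (f.EF≋𝟏 , c.E₁F≋𝟎 , _))
            (solve (n ∷ ρ ∷ σ ∷ k ∷ l ∷ []) ((4F , 0F) ∷ (0F , 1F) ∷ (0F , 2F) ∷ (2F , 0F) ∷ (0F , 3F) ∷ (3F , 0F) ∷ [])
              (λ U F F′ E′ F₁′ E₁′ → (F₁′ ⊙ E₁′ ⇒ 𝕀 ⊖ F′ ⊙ E′) ∷ (U ⊙ F′ ⇒ 𝟘) ∷ []
                ⊢ U ⊙ F ⇒ (U ⊙ F₁′) ⊙ (E₁′ ⊙ F))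
              (U , f.F , g.F , g.E , d.F₁ , d.E₁ , _) (d.split , UF≋𝟎 , _))
          S≋𝟎 : S ≋ 𝟎
          S≋𝟎 = ≋-trans (solve (n ∷ ρ ∷ k ∷ l ∷ []) ((3F , 2F) ∷ (2F , 1F) ∷ (1F , 0F) ∷ (2F , 0F) ∷ (0F , 2F) ∷ [])
              (λ S A Ỹ Q Q′ → (A ⊙ Ỹ ⇒ Q) ∷ (Q ⊙ Q′ ⇒ 𝕀) ∷ [] ⊢ S ⇒ S ⊙ A ⊙ Ỹ ⊙ Q′)
              (S , A , Ỹ , Q , Y′ · c.F₁ , _) (AỸ≋Q , K.independent , _))
            (≋-trans (·-congʳ (Y′ · c.F₁) (≋-trans (·-congʳ Ỹ (≋-sym Z≋SA)) e)) (𝟎-· (Y′ · c.F₁)))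

      normalForm : NormalForm X Y k
      normalForm =
        let Ỹ′ , ỸỸ′ = trivial-left-kernel⇒right-inverse Ỹ trivial-kernel
            h , iso , move = witt ρ {f.G} {Ỹ} {f.H} {Ỹ′} f.GH≋𝟏 ỸỸ′ gram
        in via h iso move
        where
        via : ∀ h → Isometry h → f.G · h ≋ Ỹ → NormalForm X Y k
        via h iso move = record
          { u = h ⁻¹ ; P = P ; P′ = X′ · d.F₁ ; B = c.F₁ ⊞ ⊟ (f.F · C)
          ; isometry = ⁻¹-isometry iso
          ; PP′≋𝟏 = K′.independent
          ; PΦXᴴ≋𝟎 = K′.orthogonal
          ; PΦPᴴ≋𝟎 = solve (n ∷ k ∷ []) ((0F , 0F) ∷ (0F , 0F) ∷ (1F , 0F) ∷ [])
              (λ X Φ E₁ → (E₁ ⊙ X ⊙ Φ ⊙ X † ⇒ 𝟘) ∷ [] ⊢ (E₁ ⊙ X) ⊙ Φ ⊙ (E₁ ⊙ X) † ⇒ 𝟘)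
              (X , Φ , d.E₁ , _) (K′.orthogonal , _)
          ; XΦPᴴ≋𝟎 = ≋-trans (solve (n ∷ k ∷ []) ((0F , 0F) ∷ (0F , 0F) ∷ (1F , 0F) ∷ [])
              (λ X Φ P → (Φ † ⇒ ⊝ Φ) ∷ [] ⊢ X ⊙ Φ ⊙ P † ⇒ ⊝ ((P ⊙ Φ ⊙ X †) †))
              (X , Φ , P , _) (skew , _))
              (≋-trans (⊟-cong (ᴴ-cong K′.orthogonal))
                (solve (n ∷ k ∷ []) [] ([] ⊢ ⊝ (𝟘 {i = 1F} {0F} †) ⇒ 𝟘) _ _))
          ; Yu≋X+BP = ≋-trans (·-congʳ (h ⁻¹) Y≋)
              (solve (n ∷ k ∷ []) ((0F , 0F) ∷ (0F , 1F) ∷ (1F , 0F) ∷ (0F , 0F) ∷ (0F , 0F) ∷ [])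
              (λ X B P h i → (h ⊙ i ⇒ 𝕀) ∷ [] ⊢ ((X ⊕ B ⊙ P) ⊙ h) ⊙ i ⇒ X ⊕ B ⊙ P)
              (X , B , P , h , h ⁻¹ , _) (inverseʳ iso , _)) }
          where
          B : Mat n k
          B = c.F₁ ⊞ ⊟ (f.F · C)
          Y≋ : Y ≋ (X ⊞ B · P) · h
          Y≋ = ≋-trans (solve (n ∷ ρ ∷ k ∷ [])
            ((0F , 0F) ∷ (0F , 1F) ∷ (1F , 0F) ∷ (0F , 2F) ∷ (2F , 0F) ∷ (1F , 2F) ∷ [])
            (λ Y F E F₁ E₁ C → (F₁ ⊙ E₁ ⇒ 𝕀 ⊖ F ⊙ E) ∷ []
              ⊢ Y ⇒ F ⊙ (E ⊙ Y ⊕ C ⊙ (E₁ ⊙ Y)) ⊕ (F₁ ⊖ F ⊙ C) ⊙ (E₁ ⊙ Y))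
            (Y , f.F , f.E , c.F₁ , c.E₁ , C , _) (c.split , _))
            (solve (n ∷ ρ ∷ k ∷ []) ((0F , 0F) ∷ (0F , 1F) ∷ (1F , 0F) ∷ (0F , 2F) ∷ (2F , 0F) ∷
                (2F , 0F) ∷ (1F , 0F) ∷ (2F , 1F) ∷ (0F , 0F) ∷ [])
              (λ X F G B P Q Ỹ A h → (Ỹ ⇒ G ⊙ h) ∷ (Q ⇒ P ⊙ h) ∷ (F ⊙ G ⇒ X) ∷ []
                ⊢ F ⊙ Ỹ ⊕ B ⊙ Q ⇒ (X ⊕ B ⊙ P) ⊙ h)
              (X , f.F , f.G , B , P , Q , Ỹ , A , h , _)
              (≋-sym move , ≋-trans (≋-sym AỸ≋Q) (≋-trans (·-congˡ A (≋-sym move))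
                (solve (n ∷ ρ ∷ k ∷ []) ((0F , 0F) ∷ (0F , 1F) ∷ (1F , 0F) ∷ (2F , 0F) ∷ (0F , 0F) ∷ [])
                  (λ X F G E₁ h → (F ⊙ G ⇒ X) ∷ [] ⊢ (E₁ ⊙ F) ⊙ (G ⊙ h) ⇒ (E₁ ⊙ X) ⊙ h)
                  (X , f.F , f.G , d.E₁ , h , _) (≋-sym f.X≋FG , _))) , ≋-sym f.X≋FG , _))

    lagrangian-normalForm : ∀ {X Y} → Lagrangian X Y → ∀ {ρ} → Factorization X ρ →
                            ∃[ k ] (ρ ℕ.+ k ≡ n) × NormalForm X Y k
    lagrangian-normalForm {X} {Y} L {ρ} f =
      let k , c = complement (Factorization.EF≋𝟏 f)
          σ , g = factorize n Y
          l , d = complement (Factorization.EF≋𝟏 g)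
          ρ+k≡n = complement-size (Factorization.EF≋𝟏 f) c
          σ+l≡n = complement-size (Factorization.EF≋𝟏 g) d
          k≤l = compare (Kernel.kernel-rank L f c g) σ+l≡n
          l≤k = compare (Kernel.kernel-rank (swap L) g d f) ρ+k≡n
      in k , ρ+k≡n , normalForm L f c g (subst (Complement _ _) (ℕₚ.≤-antisym l≤k k≤l) d)
      where
      compare : ∀ {k l σ} → k ℕ.+ σ ≤ n → σ ℕ.+ l ≡ n → k ≤ l
      compare {k} {l} {σ} k+σ≤n refl = ℕₚ.+-cancelˡ-≤ σ k l (subst (_≤ σ ℕ.+ l) (ℕₚ.+-comm k σ) k+σ≤n)

    lagrangians-orthogonal : ∀ {X Y X̃ Ỹ k} → NormalForm X Y k → NormalForm X̃ Ỹ k →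
      Σ (Mat n n) λ g₁ → Σ (Mat n n) λ g₂ → Isometry g₁ × Isometry g₂ ×
        (X · Φ · (X̃ · g₁) ᴴ ≋ Y · Φ · (Ỹ · g₂) ᴴ)
    lagrangians-orthogonal {X} {Y} {X̃} {Ỹ} {k} N Ñ =
      let g , iso , move = witt k {Ñ.P} {N.P} {Ñ.P′} {N.P′} Ñ.PP′≋𝟏 N.PP′≋𝟏
            (≋-trans Ñ.PΦPᴴ≋𝟎 (≋-sym N.PΦPᴴ≋𝟎))
      in g , Ñ.u · g · N.u ⁻¹ , iso ,
         ∘-isometry (∘-isometry Ñ.isometry iso) (⁻¹-isometry N.isometry) , via g iso move
      where
      module N = NormalForm N
      module Ñ = NormalForm Ñ
      Y≋ : Y ≋ (X ⊞ N.B · N.P) · N.u ⁻¹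
      Y≋ = ≋-trans (solve (n ∷ []) ((0F , 0F) ∷ (0F , 0F) ∷ (0F , 0F) ∷ [])
        (λ Y u i → (u ⊙ i ⇒ 𝕀) ∷ [] ⊢ Y ⇒ (Y ⊙ u) ⊙ i) (Y , N.u , N.u ⁻¹ , _) (inverseʳ N.isometry , _))
        (·-congʳ (N.u ⁻¹) N.Yu≋X+BP)
      via : ∀ g → Isometry g → Ñ.P · g ≋ N.P → X · Φ · (X̃ · g) ᴴ ≋ Y · Φ · (Ỹ · (Ñ.u · g · N.u ⁻¹)) ᴴ
      via g iso move = solve (n ∷ k ∷ [])
        ((0F , 0F) ∷ (0F , 0F) ∷ (0F , 0F) ∷ (0F , 0F) ∷ (0F , 0F) ∷ (0F , 0F) ∷ (0F , 0F) ∷ (0F , 0F) ∷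
         (1F , 0F) ∷ (1F , 0F) ∷ (0F , 1F) ∷ (0F , 1F) ∷ [])
        (λ X Y X̃ Ỹ Φ g ũ i P P̃ B B̃ →
          (Y ⇒ (X ⊕ B ⊙ P) ⊙ i) ∷ (Ỹ ⊙ ũ ⇒ X̃ ⊕ B̃ ⊙ P̃) ∷ (i ⊙ Φ ⊙ i † ⇒ Φ) ∷ (P ⇒ P̃ ⊙ g) ∷ (g ⊙ Φ ⊙ g † ⇒ Φ) ∷
          (P̃ ⊙ Φ ⊙ X̃ † ⇒ 𝟘) ∷ (P̃ ⊙ Φ ⊙ P̃ † ⇒ 𝟘) ∷ (X ⊙ Φ ⊙ g † ⊙ P̃ † ⇒ 𝟘) ∷ []
          ⊢ X ⊙ Φ ⊙ (X̃ ⊙ g) † ⇒ Y ⊙ Φ ⊙ (Ỹ ⊙ (ũ ⊙ g ⊙ i)) †)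
        (X , Y , X̃ , Ỹ , Φ , g , Ñ.u , N.u ⁻¹ , N.P , Ñ.P , N.B , Ñ.B , _)
        (Y≋ , Ñ.Yu≋X+BP , ⁻¹-isometry N.isometry , ≋-sym move , iso , Ñ.PΦXᴴ≋𝟎 , Ñ.PΦPᴴ≋𝟎 ,
         ≋-trans (solve (n ∷ k ∷ []) ((0F , 0F) ∷ (0F , 0F) ∷ (0F , 0F) ∷ (1F , 0F) ∷ [])
           (λ X Φ g P̃ → [] ⊢ X ⊙ Φ ⊙ g † ⊙ P̃ † ⇒ X ⊙ Φ ⊙ (P̃ ⊙ g) †) (X , Φ , g , Ñ.P , _) _)
           (≋-trans (·-congˡ (X · Φ) (ᴴ-cong move)) N.XΦPᴴ≋𝟎) , _)

module DoublingGroup (𝓡 : Ring 0ℓ 0ℓ) (involution : Involution 𝓡) (division : IsDivision 𝓡 involution) where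

  open DoubledSpace 𝓡 involution division public

  isom-intro : ∀ {k} {S T g : Mat k k} → T · S ≋ 𝟏 → g ᴴ · S · g ≋ S → g ∈ Isom S
  isom-intro {k} {S} {T} {g} TS e = (T · (g ᴴ · S) , left-inverse ig , ig) , e
    where
    ig : T · (g ᴴ · S) · g ≋ 𝟏
    ig = solve (k ∷ []) ((0F , 0F) ∷ (0F , 0F) ∷ (0F , 0F) ∷ [])
      (λ S T g → (g † ⊙ S ⊙ g ⇒ S) ∷ (T ⊙ S ⇒ 𝕀) ∷ [] ⊢ T ⊙ (g † ⊙ S) ⊙ g ⇒ 𝕀) (S , T , g , _) (e , TS , _)

  isom-dual : ∀ {k} {S T g : Mat k k} → S · T ≋ 𝟏 → T · S ≋ 𝟏 → g ᴴ · S · g ≋ S → g · T · g ᴴ ≋ T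
  isom-dual {k} {S} {T} {g} ST TS e = let (i , gi , _) , _ = isom-intro TS e in
    ≋-trans (solve (k ∷ []) ((0F , 0F) ∷ (0F , 0F) ∷ (0F , 0F) ∷ [])
      (λ S T g → (S ⊙ T ⇒ 𝕀) ∷ [] ⊢ g ⊙ T ⊙ g † ⇒ g ⊙ (T ⊙ (g † ⊙ S)) ⊙ T) (S , T , g , _) (ST , _))
    (≋-trans (·-congʳ T gi) (𝟏-· T))

  module _ {n : ℕ} (form : Form n) where

    open Lagrangians form

    isotropic-rank : ∀ {m k} {A : Mat m n} {A′ : Mat n m} {P : Mat k n} {P′ : Mat n k} →
      A · A′ ≋ 𝟏 → A · Φ · A ᴴ ≋ 𝟎 →
      (∀ (v : Mat 1 n) → A · Φ · v ᴴ ≋ 𝟎 → v · Φ · v ᴴ ≋ 𝟎 → Σ (Mat 1 m) λ c → v ≋ c · A) →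
      P · P′ ≋ 𝟏 → P · Φ · P ᴴ ≋ 𝟎 → k ≤ m
    isotropic-rank {m} {k} {A} {A′} {P} {P′} AA′ AΦA maximal PP′ PΦP = ℕₚ.≮⇒≥ impossible
      where
      impossible : ¬ m < k
      impossible m<k =
        let g , iso , move = witt m {l · S · P} {A} {P′ · S ᴴ · l ᴴ} {A′}
              (solve (n ∷ k ∷ suc m ∷ m ∷ []) ((1F , 0F) ∷ (0F , 1F) ∷ (2F , 1F) ∷ (3F , 2F) ∷ [])
                (λ P P′ S l → (P ⊙ P′ ⇒ 𝕀) ∷ (S ⊙ S † ⇒ 𝕀) ∷ (l ⊙ l † ⇒ 𝕀) ∷ []
                  ⊢ (l ⊙ S ⊙ P) ⊙ (P′ ⊙ S † ⊙ l †) ⇒ 𝕀)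
                (P , P′ , S , l , _) (PP′ , SSᴴ , lower-lowerᴴ {m} {1} , _)) AA′
              (≋-trans (solve (n ∷ k ∷ suc m ∷ m ∷ []) ((1F , 0F) ∷ (2F , 1F) ∷ (3F , 2F) ∷ (0F , 0F) ∷ [])
                (λ P S l Φ → (P ⊙ Φ ⊙ P † ⇒ 𝟘) ∷ [] ⊢ (l ⊙ S ⊙ P) ⊙ Φ ⊙ (l ⊙ S ⊙ P) † ⇒ 𝟘)
                (P , S , l , Φ , _) (PΦP , _)) (≋-sym AΦA))
        in contradictory g iso move
        where
        S : Mat (suc m) k
        S = sel (λ i → Fin.inject≤ i m<k)
        SSᴴ : S · S ᴴ ≋ 𝟏
        SSᴴ = sel-orthonormal (λ i → Fin.inject≤ i m<k) (λ {i} {j} e → Finₚ.inject≤-injective m<k m<k i j e)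
        l : Mat m (suc m)
        l = lower {m} {1}
        u : Mat 1 (suc m)
        u = upper {1} {m}
        contradictory : ∀ g → Isometry g → l · S · P · g ≋ A → ⊥
        contradictory g iso move =
          let c , e = maximal (u · S · P · g)
                (≋-trans (·-congʳ ((u · S · P · g) ᴴ) (·-congʳ Φ (≋-sym move)))
                (solve (n ∷ k ∷ suc m ∷ m ∷ 1 ∷ [])
                  ((1F , 0F) ∷ (2F , 1F) ∷ (3F , 2F) ∷ (4F , 2F) ∷ (0F , 0F) ∷ (0F , 0F) ∷ [])
                  (λ P S l u Φ g → (g ⊙ Φ ⊙ g † ⇒ Φ) ∷ (P ⊙ Φ ⊙ P † ⇒ 𝟘) ∷ []
                    ⊢ (l ⊙ S ⊙ P ⊙ g) ⊙ Φ ⊙ (u ⊙ S ⊙ P ⊙ g) † ⇒ 𝟘)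
                  (P , S , l , u , Φ , g , _) (iso , PΦP , _)))
                (solve (n ∷ k ∷ suc m ∷ 1 ∷ [])
                  ((1F , 0F) ∷ (2F , 1F) ∷ (3F , 2F) ∷ (0F , 0F) ∷ (0F , 0F) ∷ [])
                  (λ P S u Φ g → (g ⊙ Φ ⊙ g † ⇒ Φ) ∷ (P ⊙ Φ ⊙ P † ⇒ 𝟘) ∷ []
                    ⊢ (u ⊙ S ⊙ P ⊙ g) ⊙ Φ ⊙ (u ⊙ S ⊙ P ⊙ g) † ⇒ 𝟘)
                  (P , S , u , Φ , g , _) (iso , PΦP , _))
          in 1≉0 (collapse c e 0F 0F)
          where
          collapse : ∀ (c : Mat 1 m) → u · S · P · g ≋ c · A → 𝟏 {1} ≋ 𝟎
          collapse c e = ≋-trans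
            (solve (n ∷ k ∷ suc m ∷ 1 ∷ [])
              ((1F , 0F) ∷ (0F , 1F) ∷ (2F , 1F) ∷ (3F , 2F) ∷ (0F , 0F) ∷ (0F , 0F) ∷ [])
              (λ P P′ S u g i → (g ⊙ i ⇒ 𝕀) ∷ (P ⊙ P′ ⇒ 𝕀) ∷ (S ⊙ S † ⇒ 𝕀) ∷ (u ⊙ u † ⇒ 𝕀) ∷ []
                ⊢ 𝕀 ⇒ (u ⊙ S ⊙ P ⊙ g) ⊙ (i ⊙ P′ ⊙ S † ⊙ u †))
              (P , P′ , S , u , g , g ⁻¹ , _) (inverseʳ iso , PP′ , SSᴴ , upper-upperᴴ {1} , _))
            (≋-trans (·-congʳ (g ⁻¹ · P′ · S ᴴ · u ᴴ) (≋-trans e (·-congˡ c (≋-sym move))))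
            (solve (n ∷ k ∷ suc m ∷ 1 ∷ m ∷ [])
              ((1F , 0F) ∷ (0F , 1F) ∷ (2F , 1F) ∷ (3F , 2F) ∷ (4F , 2F) ∷ (3F , 4F) ∷ (0F , 0F) ∷ (0F , 0F) ∷ [])
              (λ P P′ S u l c g i → (g ⊙ i ⇒ 𝕀) ∷ (P ⊙ P′ ⇒ 𝕀) ∷ (S ⊙ S † ⇒ 𝕀) ∷ (u ⊙ l † ⇒ 𝟘) ∷ []
                ⊢ (c ⊙ (l ⊙ S ⊙ P ⊙ g)) ⊙ (i ⊙ P′ ⊙ S † ⊙ u †) ⇒ 𝟘)
              (P , P′ , S , u , l , c , g , g ⁻¹ , _) (inverseʳ iso , PP′ , SSᴴ , upper-lowerᴴ {1} , _)))

    module Doubled {J R R⁻¹ : Mat (n ℕ.+ n) (n ℕ.+ n)}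
      (J≋ : J ≋ lower {n} {n} ᴴ · upper {n} {n} ⊞ ⊟ (upper {n} {n} ᴴ · lower {n} {n}))
      (RR⁻¹≋𝟏 : R · R⁻¹ ≋ 𝟏) (R⁻¹R≋𝟏 : R⁻¹ · R ≋ 𝟏)
      (RᴴΔR≋J : R ᴴ · (upper {n} {n} ᴴ · Ψ · upper {n} {n} ⊞ ⊟ (lower {n} {n} ᴴ · Ψ · lower {n} {n})) · R ≋ J)
      where

      private
        N : ℕ
        N = n ℕ.+ n
        u l : Mat n N
        u = upper {n} {n}
        l = lower {n} {n}
        uuᴴ : u · u ᴴ ≋ 𝟏
        uuᴴ = upper-upperᴴ {n} {n}
        llᴴ : l · l ᴴ ≋ 𝟏
        llᴴ = lower-lowerᴴ {n} {n}
        ulᴴ : u · l ᴴ ≋ 𝟎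
        ulᴴ = upper-lowerᴴ {n} {n}
        uᴴu : u ᴴ · u ≋ 𝟏 ⊞ ⊟ (l ᴴ · l)
        uᴴu = ≋-trans (solve (n ∷ N ∷ []) ((0F , 1F) ∷ (0F , 1F) ∷ [])
          (λ u l → [] ⊢ u † ⊙ u ⇒ (u † ⊙ u ⊕ l † ⊙ l) ⊖ l † ⊙ l) (u , l , _) _)
          (⊞-cong (blocks-resolution {n} {n}) (≋-refl {X = ⊟ (l ᴴ · l)}))

      J′ Δ Δ′ : Mat N N
      J′ = u ᴴ · l ⊞ ⊟ (l ᴴ · u)
      Δ  = u ᴴ · Ψ · u ⊞ ⊟ (l ᴴ · Ψ · l)
      Δ′ = u ᴴ · Φ · u ⊞ ⊟ (l ᴴ · Φ · l)

      JJ′≋𝟏 : J · J′ ≋ 𝟏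
      JJ′≋𝟏 = solve (n ∷ N ∷ []) ((0F , 1F) ∷ (0F , 1F) ∷ (1F , 1F) ∷ [])
        (λ u l J → (J ⇒ l † ⊙ u ⊖ u † ⊙ l) ∷ (u † ⊙ u ⇒ 𝕀 ⊖ l † ⊙ l) ∷ (u ⊙ u † ⇒ 𝕀) ∷ (u ⊙ l † ⇒ 𝟘) ∷ (l ⊙ l † ⇒ 𝕀) ∷ []
          ⊢ J ⊙ (u † ⊙ l ⊖ l † ⊙ u) ⇒ 𝕀) (u , l , J , _) (J≋ , uᴴu , uuᴴ , ulᴴ , llᴴ , _)

      J′J≋𝟏 : J′ · J ≋ 𝟏
      J′J≋𝟏 = left-inverse {A = J} {J′} JJ′≋𝟏

      ΔΔ′≋𝟏 : Δ · Δ′ ≋ 𝟏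
      ΔΔ′≋𝟏 = solve (n ∷ N ∷ []) ((0F , 1F) ∷ (0F , 1F) ∷ (0F , 0F) ∷ (0F , 0F) ∷ [])
        (λ u l Φ Ψ → (u ⊙ u † ⇒ 𝕀) ∷ (u ⊙ l † ⇒ 𝟘) ∷ (l ⊙ l † ⇒ 𝕀) ∷ (Ψ ⊙ Φ ⇒ 𝕀) ∷ (u † ⊙ u ⇒ 𝕀 ⊖ l † ⊙ l) ∷ []
          ⊢ (u † ⊙ Ψ ⊙ u ⊖ l † ⊙ Ψ ⊙ l) ⊙ (u † ⊙ Φ ⊙ u ⊖ l † ⊙ Φ ⊙ l) ⇒ 𝕀)
        (u , l , Φ , Ψ , _) (uuᴴ , ulᴴ , llᴴ , ΨΦ≋𝟏 , uᴴu , _)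

      R⁻¹Δ′R⁻ᴴ≋J′ : R⁻¹ · Δ′ · R⁻¹ ᴴ ≋ J′
      R⁻¹Δ′R⁻ᴴ≋J′ = ≋-trans
        (solve (N ∷ []) ((0F , 0F) ∷ (0F , 0F) ∷ (0F , 0F) ∷ (0F , 0F) ∷ [])
          (λ S D J J′ → (J ⊙ J′ ⇒ 𝕀) ∷ [] ⊢ S ⊙ D ⊙ S † ⇒ S ⊙ D ⊙ S † ⊙ J ⊙ J′) (R⁻¹ , Δ′ , J , J′ , _) (JJ′≋𝟏 , _))
        (≋-trans (·-congʳ J′ (·-congˡ (R⁻¹ · Δ′ · R⁻¹ ᴴ) (≋-sym RᴴΔR≋J)))
        (solve (N ∷ []) ((0F , 0F) ∷ (0F , 0F) ∷ (0F , 0F) ∷ (0F , 0F) ∷ (0F , 0F) ∷ [])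
          (λ R S D D′ J′ → (S ⊙ R ⇒ 𝕀) ∷ (R ⊙ S ⇒ 𝕀) ∷ (D′ ⊙ D ⇒ 𝕀) ∷ [] ⊢ S ⊙ D′ ⊙ S † ⊙ (R † ⊙ D ⊙ R) ⊙ J′ ⇒ J′)
          (R , R⁻¹ , Δ , Δ′ , J′ , _) (R⁻¹R≋𝟏 , RR⁻¹≋𝟏 , left-inverse {A = Δ} {Δ′} ΔΔ′≋𝟏 , _)))

      left right : Mat N N → Mat n n
      left  g = l · g · R⁻¹ · u ᴴ
      right g = l · g · R⁻¹ · l ᴴ

      -- The coset of g modulo the Siegel parabolic is determined by the bottom rows l g;
      -- [left g | right g] are their coordinates in V ⊕ (- V).
      pairing : ∀ g h → left g · Φ · left h ᴴ ⊞ ⊟ (right g · Φ · right h ᴴ) ≋ l · g · J′ · h ᴴ · l ᴴ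
      pairing g h = ≋-trans
        (solve (n ∷ N ∷ []) ((0F , 1F) ∷ (0F , 1F) ∷ (0F , 0F) ∷ (1F , 1F) ∷ (1F , 1F) ∷ (1F , 1F) ∷ [])
          (λ u l Φ S g h → []
            ⊢ (l ⊙ g ⊙ S ⊙ u †) ⊙ Φ ⊙ (l ⊙ h ⊙ S ⊙ u †) † ⊖ (l ⊙ g ⊙ S ⊙ l †) ⊙ Φ ⊙ (l ⊙ h ⊙ S ⊙ l †) †
              ⇒ l ⊙ g ⊙ (S ⊙ (u † ⊙ Φ ⊙ u ⊖ l † ⊙ Φ ⊙ l) ⊙ S †) ⊙ h † ⊙ l †)
          (u , l , Φ , R⁻¹ , g , h , _) _)
        (·-congʳ (l ᴴ) (·-congʳ (h ᴴ) (·-congˡ (l · g) R⁻¹Δ′R⁻ᴴ≋J′)))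

      lagrangian : ∀ {g} → g ∈ Isom J → Lagrangian (left g) (right g)
      lagrangian {g} ((i , gi , _) , e) = record
        { X′ = u · R · i · l ᴴ ; Y′ = l · R · i · l ᴴ
        ; basis = solve (n ∷ N ∷ []) ((0F , 1F) ∷ (0F , 1F) ∷ (1F , 1F) ∷ (1F , 1F) ∷ (1F , 1F) ∷ (1F , 1F) ∷ [])
            (λ u l R S g i → (S ⊙ R ⇒ 𝕀) ∷ (g ⊙ i ⇒ 𝕀) ∷ (u † ⊙ u ⇒ 𝕀 ⊖ l † ⊙ l) ∷ (l ⊙ l † ⇒ 𝕀) ∷ []
              ⊢ (l ⊙ g ⊙ S ⊙ u †) ⊙ (u ⊙ R ⊙ i ⊙ l †) ⊕ (l ⊙ g ⊙ S ⊙ l †) ⊙ (l ⊙ R ⊙ i ⊙ l †) ⇒ 𝕀)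
            (u , l , R , R⁻¹ , g , i , _) (R⁻¹R≋𝟏 , gi , uᴴu , llᴴ , _)
        ; isotropic = ⊞⊟≋𝟎 {X = left g · Φ · left g ᴴ} {right g · Φ · right g ᴴ} (≋-trans (pairing g g)
            (solve (n ∷ N ∷ []) ((0F , 1F) ∷ (0F , 1F) ∷ (1F , 1F) ∷ (1F , 1F) ∷ [])
              (λ u l g J′ → (g ⊙ J′ ⊙ g † ⇒ u † ⊙ l ⊖ l † ⊙ u) ∷ (u ⊙ l † ⇒ 𝟘) ∷ []
                ⊢ l ⊙ g ⊙ J′ ⊙ g † ⊙ l † ⇒ 𝟘)
              (u , l , g , J′ , _) (isom-dual {S = J} {J′} {g} JJ′≋𝟏 J′J≋𝟏 e , ulᴴ , _))) }

      Parabolic : Mat N N → Set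
      Parabolic p = p ∈ Isom J × (l · p · u ᴴ ≋ 𝟎)

      same-parabolic-coset : ∀ {g h} → g ∈ Isom J → h ∈ Isom J →
        left g · Φ · left h ᴴ ≋ right g · Φ · right h ᴴ → Σ (Mat N N) λ p → Parabolic p × (p · h ≋ g)
      same-parabolic-coset {g} {h} (_ , eg) (_ , eh) o =
        p , (isom-intro {S = J} {J′} {p} J′J≋𝟏 p-isometry , lower-left) ,
        solve (N ∷ []) ((0F , 0F) ∷ (0F , 0F) ∷ (0F , 0F) ∷ (0F , 0F) ∷ [])
          (λ J J′ g h → (h † ⊙ J ⊙ h ⇒ J) ∷ (J′ ⊙ J ⇒ 𝕀) ∷ [] ⊢ (g ⊙ (J′ ⊙ h † ⊙ J)) ⊙ h ⇒ g)
          (J , J′ , g , h , _) (eh , J′J≋𝟏 , _)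
        where
        i p : Mat N N
        i = J′ · h ᴴ · J
        p = g · i
        hi≋𝟏 : h · i ≋ 𝟏
        hi≋𝟏 = left-inverse {A = i} {h} (solve (N ∷ []) ((0F , 0F) ∷ (0F , 0F) ∷ (0F , 0F) ∷ [])
          (λ J J′ h → (h † ⊙ J ⊙ h ⇒ J) ∷ (J′ ⊙ J ⇒ 𝕀) ∷ [] ⊢ (J′ ⊙ h † ⊙ J) ⊙ h ⇒ 𝕀)
          (J , J′ , h , _) (eh , J′J≋𝟏 , _))
        p-isometry : p ᴴ · J · p ≋ J
        p-isometry = ≋-trans (solve (N ∷ []) ((0F , 0F) ∷ (0F , 0F) ∷ (0F , 0F) ∷ [])
            (λ J g i → (g † ⊙ J ⊙ g ⇒ J) ∷ [] ⊢ (g ⊙ i) † ⊙ J ⊙ (g ⊙ i) ⇒ i † ⊙ J ⊙ i) (J , g , i , _) (eg , _))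
          (≋-trans (·-congʳ i (·-congˡ (i ᴴ) (≋-sym eh)))
          (solve (N ∷ []) ((0F , 0F) ∷ (0F , 0F) ∷ (0F , 0F) ∷ [])
            (λ J h i → (h ⊙ i ⇒ 𝕀) ∷ [] ⊢ i † ⊙ (h † ⊙ J ⊙ h) ⊙ i ⇒ J) (J , h , i , _) (hi≋𝟏 , _)))
        lower-left : l · p · u ᴴ ≋ 𝟎
        lower-left = ≋-trans
          (solve (n ∷ N ∷ []) ((0F , 1F) ∷ (0F , 1F) ∷ (1F , 1F) ∷ (1F , 1F) ∷ (1F , 1F) ∷ (1F , 1F) ∷ [])
            (λ u l J J′ g h → (J ⇒ l † ⊙ u ⊖ u † ⊙ l) ∷ (u ⊙ u † ⇒ 𝕀) ∷ (u ⊙ l † ⇒ 𝟘) ∷ []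
              ⊢ l ⊙ (g ⊙ (J′ ⊙ h † ⊙ J)) ⊙ u † ⇒ l ⊙ g ⊙ J′ ⊙ h † ⊙ l †)
            (u , l , J , J′ , g , h , _) (J≋ , uuᴴ , ulᴴ , _))
          (≋-trans (≋-sym (pairing g h))
          (≋-trans (⊞-cong o (≋-refl {X = ⊟ (right g · Φ · right h ᴴ)}))
            (solve (n ∷ []) ((0F , 0F) ∷ []) (λ Z → [] ⊢ Z ⊖ Z ⇒ 𝟘) (right g · Φ · right h ᴴ , _) _)))

      module _ {D : Mat n n → Mat n n → Mat N N}
               (D≋ : ∀ g₁ g₂ → D g₁ g₂ ≋ R⁻¹ · (u ᴴ · g₁ · u ⊞ l ᴴ · g₂ · l) · R) where

        doubled-isom : ∀ {g₁ g₂} → g₁ ∈ Isom Ψ → g₂ ∈ Isom Ψ → D g₁ g₂ ∈ Isom J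
        doubled-isom {g₁} {g₂} (_ , e₁) (_ , e₂) = isom-intro {S = J} {J′} {D g₁ g₂} J′J≋𝟏
          (≋-trans (solve (n ∷ N ∷ []) ((0F , 1F) ∷ (0F , 1F) ∷ (0F , 0F) ∷ (0F , 0F) ∷ (0F , 0F) ∷
                                        (1F , 1F) ∷ (1F , 1F) ∷ (1F , 1F) ∷ (1F , 1F) ∷ [])
            (λ u l Ψ g₁ g₂ R S J D → (D ⇒ S ⊙ (u † ⊙ g₁ ⊙ u ⊕ l † ⊙ g₂ ⊙ l) ⊙ R) ∷
              (J ⇒ R † ⊙ (u † ⊙ Ψ ⊙ u ⊖ l † ⊙ Ψ ⊙ l) ⊙ R) ∷ (R ⊙ S ⇒ 𝕀) ∷ (u ⊙ u † ⇒ 𝕀) ∷ (u ⊙ l † ⇒ 𝟘) ∷ (l ⊙ l † ⇒ 𝕀) ∷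
              (g₁ † ⊙ Ψ ⊙ g₁ ⇒ Ψ) ∷ (g₂ † ⊙ Ψ ⊙ g₂ ⇒ Ψ) ∷ []
              ⊢ D † ⊙ J ⊙ D ⇒ R † ⊙ (u † ⊙ Ψ ⊙ u ⊖ l † ⊙ Ψ ⊙ l) ⊙ R)
            (u , l , Ψ , g₁ , g₂ , R , R⁻¹ , J , D g₁ g₂ , _)
            (D≋ g₁ g₂ , ≋-sym RᴴΔR≋J , RR⁻¹≋𝟏 , uuᴴ , ulᴴ , llᴴ , e₁ , e₂ , _)) RᴴΔR≋J)

        left-doubled : ∀ h g₁ g₂ → left (h · D g₁ g₂) ≋ left h · g₁
        left-doubled h g₁ g₂ = solve (n ∷ N ∷ []) ((0F , 1F) ∷ (0F , 1F) ∷ (0F , 0F) ∷ (0F , 0F) ∷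
                                        (1F , 1F) ∷ (1F , 1F) ∷ (1F , 1F) ∷ (1F , 1F) ∷ [])
            (λ u l g₁ g₂ R S h D → (D ⇒ S ⊙ (u † ⊙ g₁ ⊙ u ⊕ l † ⊙ g₂ ⊙ l) ⊙ R) ∷
              (R ⊙ S ⇒ 𝕀) ∷ (u ⊙ u † ⇒ 𝕀) ∷ (u ⊙ l † ⇒ 𝟘) ∷ []
              ⊢ l ⊙ (h ⊙ D) ⊙ S ⊙ u † ⇒ (l ⊙ h ⊙ S ⊙ u †) ⊙ g₁)
            (u , l , g₁ , g₂ , R , R⁻¹ , h , D g₁ g₂ , _) (D≋ g₁ g₂ , RR⁻¹≋𝟏 , uuᴴ , ulᴴ , _)

        right-doubled : ∀ h g₁ g₂ → right (h · D g₁ g₂) ≋ right h · g₂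
        right-doubled h g₁ g₂ = solve (n ∷ N ∷ []) ((0F , 1F) ∷ (0F , 1F) ∷ (0F , 0F) ∷ (0F , 0F) ∷
                                        (1F , 1F) ∷ (1F , 1F) ∷ (1F , 1F) ∷ (1F , 1F) ∷ [])
            (λ u l g₁ g₂ R S h D → (D ⇒ S ⊙ (u † ⊙ g₁ ⊙ u ⊕ l † ⊙ g₂ ⊙ l) ⊙ R) ∷
              (R ⊙ S ⇒ 𝕀) ∷ (l ⊙ l † ⇒ 𝕀) ∷ (u ⊙ l † ⇒ 𝟘) ∷ []
              ⊢ l ⊙ (h ⊙ D) ⊙ S ⊙ l † ⇒ (l ⊙ h ⊙ S ⊙ l †) ⊙ g₂)
            (u , l , g₁ , g₂ , R , R⁻¹ , h , D g₁ g₂ , _) (D≋ g₁ g₂ , RR⁻¹≋𝟏 , llᴴ , ulᴴ , _)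

        SameCoset : Mat N N → Mat N N → Set
        SameCoset h g = ∃[ p ] ∃[ g₁ ] ∃[ g₂ ]
          (Parabolic p × g₁ ∈ Isom Ψ × g₂ ∈ Isom Ψ × p · h · D g₁ g₂ ≋ g)

        isometry⇒isom : ∀ {g} → Isometry g → g ∈ Isom Ψ
        isometry⇒isom {g} e = isom-intro {S = Ψ} {Φ} {g} ΦΨ≋𝟏 (≋-trans
          (solve (n ∷ []) ((0F , 0F) ∷ (0F , 0F) ∷ (0F , 0F) ∷ [])
            (λ Φ Ψ g → (Ψ ⊙ Φ ⇒ 𝕀) ∷ [] ⊢ g † ⊙ Ψ ⊙ g ⇒ Ψ ⊙ ((Φ ⊙ g † ⊙ Ψ) ⊙ g)) (Φ , Ψ , g , _) (ΨΦ≋𝟏 , _))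
          (≋-trans (·-congˡ Ψ (inverseˡ e)) (·-𝟏 Ψ)))

        equal-rank⇒same-coset : ∀ {g h k} → g ∈ Isom J → h ∈ Isom J →
          NormalForm (left g) (right g) k → NormalForm (left h) (right h) k → SameCoset h g
        equal-rank⇒same-coset {g} {h} {k} G H Ng Nh =
          let g₁ , g₂ , iso₁ , iso₂ , o = lagrangians-orthogonal Ng Nh in via g₁ g₂ iso₁ iso₂ o
          where
          via : ∀ g₁ g₂ → Isometry g₁ → Isometry g₂ →
                left g · Φ · (left h · g₁) ᴴ ≋ right g · Φ · (right h · g₂) ᴴ → SameCoset h g
          via g₁ g₂ iso₁ iso₂ o =
            let p , parabolic , e = same-parabolic-coset {g} {h · D g₁ g₂} G hD
                  (≋-trans (·-congˡ (left g · Φ) (ᴴ-cong (left-doubled h g₁ g₂)))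
                  (≋-trans o (·-congˡ (right g · Φ) (ᴴ-cong (≋-sym (right-doubled h g₁ g₂))))))
            in p , g₁ , g₂ , parabolic , isometry⇒isom iso₁ , isometry⇒isom iso₂ ,
               ≋-trans (·-assoc p h (D g₁ g₂)) e
            where
            hD : h · D g₁ g₂ ∈ Isom J
            hD = isom-intro {S = J} {J′} {h · D g₁ g₂} J′J≋𝟏
              (solve (N ∷ []) ((0F , 0F) ∷ (0F , 0F) ∷ (0F , 0F) ∷ [])
                (λ J h D → (h † ⊙ J ⊙ h ⇒ J) ∷ (D † ⊙ J ⊙ D ⇒ J) ∷ [] ⊢ (h ⊙ D) † ⊙ J ⊙ (h ⊙ D) ⇒ J)
                (J , h , D g₁ g₂ , _) (proj₂ H ,
                proj₂ (doubled-isom (isometry⇒isom iso₁) (isometry⇒isom iso₂)) , _))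

        same-coset⇒equal-rank : ∀ {g h ρ} → SameCoset h g → Factorization (left h) ρ → Factorization (left g) ρ
        same-coset⇒equal-rank {g} {h} {ρ} (p , g₁ , g₂ , (((q , pq , _) , _) , lpu) , ((i , g₁i , _) , _) , _ , e) f = record
          { F = d · F ; G = G · g₁ ; E = E · d′ ; H = i · H
          ; X≋FG = ≋-trans left≋ (solve (n ∷ ρ ∷ []) ((0F , 0F) ∷ (0F , 0F) ∷ (0F , 1F) ∷ (1F , 0F) ∷ (0F , 0F) ∷ [])
              (λ d X F G g₁ → (X ⇒ F ⊙ G) ∷ [] ⊢ d ⊙ X ⊙ g₁ ⇒ (d ⊙ F) ⊙ (G ⊙ g₁)) (d , left h , F , G , g₁ , _) (X≋FG , _))
          ; EF≋𝟏 = solve (n ∷ ρ ∷ []) ((0F , 0F) ∷ (0F , 0F) ∷ (0F , 1F) ∷ (1F , 0F) ∷ [])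
              (λ d d′ F E → (d′ ⊙ d ⇒ 𝕀) ∷ (E ⊙ F ⇒ 𝕀) ∷ [] ⊢ (E ⊙ d′) ⊙ (d ⊙ F) ⇒ 𝕀)
              (d , d′ , F , E , _) (left-inverse {A = d} {d′} dd′≋𝟏 , EF≋𝟏 , _)
          ; GH≋𝟏 = solve (n ∷ ρ ∷ []) ((0F , 0F) ∷ (0F , 0F) ∷ (1F , 0F) ∷ (0F , 1F) ∷ [])
              (λ g₁ i G H → (g₁ ⊙ i ⇒ 𝕀) ∷ (G ⊙ H ⇒ 𝕀) ∷ [] ⊢ (G ⊙ g₁) ⊙ (i ⊙ H) ⇒ 𝕀)
              (g₁ , i , G , H , _) (g₁i , GH≋𝟏 , _) }
          where
          open Factorization f
          d d′ : Mat n n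
          d = l · p · l ᴴ
          d′ = l · q · l ᴴ
          dd′≋𝟏 : d · d′ ≋ 𝟏
          dd′≋𝟏 = solve (n ∷ N ∷ []) ((0F , 1F) ∷ (0F , 1F) ∷ (1F , 1F) ∷ (1F , 1F) ∷ [])
              (λ u l p q → (l † ⊙ l ⇒ 𝕀 ⊖ u † ⊙ u) ∷ (l ⊙ p ⊙ u † ⇒ 𝟘) ∷ (p ⊙ q ⇒ 𝕀) ∷ (l ⊙ l † ⇒ 𝕀) ∷ []
                ⊢ (l ⊙ p ⊙ l †) ⊙ (l ⊙ q ⊙ l †) ⇒ 𝕀)
              (u , l , p , q , _) (lᴴl , lpu , pq , llᴴ , _)
            where
            lᴴl : l ᴴ · l ≋ 𝟏 ⊞ ⊟ (u ᴴ · u)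
            lᴴl = ≋-trans (solve (n ∷ N ∷ []) ((0F , 1F) ∷ (0F , 1F) ∷ [])
              (λ u l → [] ⊢ l † ⊙ l ⇒ (u † ⊙ u ⊕ l † ⊙ l) ⊖ u † ⊙ u) (u , l , _) _)
              (⊞-cong (blocks-resolution {n} {n}) (≋-refl {X = ⊟ (u ᴴ · u)}))
          left≋ : left g ≋ d · left h · g₁
          left≋ = ≋-trans (solve (n ∷ N ∷ []) ((0F , 1F) ∷ (0F , 1F) ∷ (1F , 1F) ∷ (1F , 1F) ∷ (1F , 1F) ∷ (1F , 1F) ∷ (1F , 1F) ∷ [])
              (λ u l g p h D S → (g ⇒ p ⊙ h ⊙ D) ∷ (u † ⊙ u ⇒ 𝕀 ⊖ l † ⊙ l) ∷ (l ⊙ p ⊙ u † ⇒ 𝟘) ∷ []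
                ⊢ l ⊙ g ⊙ S ⊙ u † ⇒ l ⊙ p ⊙ (u † ⊙ u ⊕ l † ⊙ l) ⊙ (h ⊙ D) ⊙ S ⊙ u †)
              (u , l , g , p , h , D g₁ g₂ , R⁻¹ , _) (≋-sym e , uᴴu , lpu , _))
            (≋-trans (solve (n ∷ N ∷ []) ((0F , 1F) ∷ (0F , 1F) ∷ (1F , 1F) ∷ (1F , 1F) ∷ (1F , 1F) ∷ (1F , 1F) ∷ [])
              (λ u l p h D S → (l ⊙ p ⊙ u † ⇒ 𝟘) ∷ []
                ⊢ l ⊙ p ⊙ (u † ⊙ u ⊕ l † ⊙ l) ⊙ (h ⊙ D) ⊙ S ⊙ u † ⇒ (l ⊙ p ⊙ l †) ⊙ (l ⊙ (h ⊙ D) ⊙ S ⊙ u †))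
              (u , l , p , h , D g₁ g₂ , R⁻¹ , _) (lpu , _))
            (≋-trans (·-congˡ d (left-doubled h g₁ g₂)) (≋-sym (·-assoc d (left h) g₁))))

module Triples (𝓡 : Ring 0ℓ 0ℓ) (involution : Involution 𝓡) (p q s : ℕ) where

  open BlockAlgebra 𝓡 involution

  private
    n : ℕ
    n = p ℕ.+ (q ℕ.+ s)
    u₁ : Mat p n
    u₁ = upper {p} {q ℕ.+ s}
    l₁ : Mat (q ℕ.+ s) n
    l₁ = lower {q ℕ.+ s} {p}
    u₂ : Mat q (q ℕ.+ s)
    u₂ = upper {q} {s}
    l₂ : Mat s (q ℕ.+ s)
    l₂ = lower {s} {q}

  κ₁ : Mat p n
  κ₁ = u₁
  κ₂ : Mat q n
  κ₂ = u₂ · l₁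
  κ₃ : Mat s n
  κ₃ = l₂ · l₁

  κ₁κ₁ᴴ : κ₁ · κ₁ ᴴ ≋ 𝟏
  κ₁κ₁ᴴ = upper-upperᴴ {p} {q ℕ.+ s}

  κ₂κ₂ᴴ : κ₂ · κ₂ ᴴ ≋ 𝟏
  κ₂κ₂ᴴ = solve (q ∷ q ℕ.+ s ∷ n ∷ []) ((0F , 1F) ∷ (1F , 2F) ∷ [])
    (λ u l → (l ⊙ l † ⇒ 𝕀) ∷ (u ⊙ u † ⇒ 𝕀) ∷ [] ⊢ (u ⊙ l) ⊙ (u ⊙ l) † ⇒ 𝕀)
    (u₂ , l₁ , _) (lower-lowerᴴ {q ℕ.+ s} {p} , upper-upperᴴ {q} {s} , _)

  κ₃κ₃ᴴ : κ₃ · κ₃ ᴴ ≋ 𝟏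
  κ₃κ₃ᴴ = solve (s ∷ q ℕ.+ s ∷ n ∷ []) ((0F , 1F) ∷ (1F , 2F) ∷ [])
    (λ u l → (l ⊙ l † ⇒ 𝕀) ∷ (u ⊙ u † ⇒ 𝕀) ∷ [] ⊢ (u ⊙ l) ⊙ (u ⊙ l) † ⇒ 𝕀)
    (l₂ , l₁ , _) (lower-lowerᴴ {q ℕ.+ s} {p} , lower-lowerᴴ {s} {q} , _)

  κ₁κ₂ᴴ : κ₁ · κ₂ ᴴ ≋ 𝟎
  κ₁κ₂ᴴ = solve (p ∷ q ∷ q ℕ.+ s ∷ n ∷ []) ((0F , 3F) ∷ (1F , 2F) ∷ (2F , 3F) ∷ [])
    (λ u u′ l → (u ⊙ l † ⇒ 𝟘) ∷ [] ⊢ u ⊙ (u′ ⊙ l) † ⇒ 𝟘)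
    (u₁ , u₂ , l₁ , _) (upper-lowerᴴ {p} {q ℕ.+ s} , _)

  κ₁κ₃ᴴ : κ₁ · κ₃ ᴴ ≋ 𝟎
  κ₁κ₃ᴴ = solve (p ∷ s ∷ q ℕ.+ s ∷ n ∷ []) ((0F , 3F) ∷ (1F , 2F) ∷ (2F , 3F) ∷ [])
    (λ u u′ l → (u ⊙ l † ⇒ 𝟘) ∷ [] ⊢ u ⊙ (u′ ⊙ l) † ⇒ 𝟘)
    (u₁ , l₂ , l₁ , _) (upper-lowerᴴ {p} {q ℕ.+ s} , _)

  κ₂κ₃ᴴ : κ₂ · κ₃ ᴴ ≋ 𝟎
  κ₂κ₃ᴴ = solve (s ∷ q ∷ q ℕ.+ s ∷ n ∷ []) ((1F , 2F) ∷ (0F , 2F) ∷ (2F , 3F) ∷ [])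
    (λ u l l′ → (l′ ⊙ l′ † ⇒ 𝕀) ∷ (u ⊙ l † ⇒ 𝟘) ∷ [] ⊢ (u ⊙ l′) ⊙ (l ⊙ l′) † ⇒ 𝟘)
    (u₂ , l₂ , l₁ , _) (lower-lowerᴴ {q ℕ.+ s} {p} , upper-lowerᴴ {q} {s} , _)

  κ-resolution : κ₁ ᴴ · κ₁ ⊞ κ₂ ᴴ · κ₂ ⊞ κ₃ ᴴ · κ₃ ≋ 𝟏
  κ-resolution = ≋-trans
    (solve (p ∷ q ∷ s ∷ q ℕ.+ s ∷ n ∷ []) ((0F , 4F) ∷ (3F , 4F) ∷ (1F , 3F) ∷ (2F , 3F) ∷ [])
      (λ u₁ l₁ u₂ l₂ → []
        ⊢ u₁ † ⊙ u₁ ⊕ (u₂ ⊙ l₁) † ⊙ (u₂ ⊙ l₁) ⊕ (l₂ ⊙ l₁) † ⊙ (l₂ ⊙ l₁) ⇒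
          u₁ † ⊙ u₁ ⊕ l₁ † ⊙ (u₂ † ⊙ u₂ ⊕ l₂ † ⊙ l₂) ⊙ l₁) (u₁ , l₁ , u₂ , l₂ , _) _)
    (≋-trans (⊞-cong (≋-refl {X = u₁ ᴴ · u₁}) (·-congʳ l₁ (·-congˡ (l₁ ᴴ) (blocks-resolution {q} {s}))))
    (≋-trans (⊞-cong (≋-refl {X = u₁ ᴴ · u₁}) (·-congʳ l₁ (·-𝟏 (l₁ ᴴ)))) (blocks-resolution {p} {q ℕ.+ s})))

  κ₁ᴴκ₁ : κ₁ ᴴ · κ₁ ≋ 𝟏 ⊞ ⊟ (κ₂ ᴴ · κ₂) ⊞ ⊟ (κ₃ ᴴ · κ₃)
  κ₁ᴴκ₁ = ≋-trans
    (solve (p ∷ q ∷ s ∷ n ∷ []) ((0F , 3F) ∷ (1F , 3F) ∷ (2F , 3F) ∷ [])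
      (λ a b c → [] ⊢ a † ⊙ a ⇒ (a † ⊙ a ⊕ b † ⊙ b ⊕ c † ⊙ c) ⊖ b † ⊙ b ⊖ c † ⊙ c) (κ₁ , κ₂ , κ₃ , _) _)
    (⊞-cong (⊞-cong κ-resolution (≋-refl {X = ⊟ (κ₂ ᴴ · κ₂)})) (≋-refl {X = ⊟ (κ₃ ᴴ · κ₃)}))

module ThreeBlocks (𝓡 : Ring 0ℓ 0ℓ) (involution : Involution 𝓡) (division : IsDivision 𝓡 involution) (m r : ℕ) where

  open DoublingGroup 𝓡 involution division public
  open Blocks m r public
  open Triples 𝓡 involution m r m public
  open Ring 𝓡 hiding (zero; refl; -_; sym; trans)
  open Ring 𝓡 using () renaming (sym to ≈-sym; trans to ≈-trans)

  private
    variable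
      k l : ℕ

    u₁ : Mat m n
    u₁ = upper {m} {r ℕ.+ m}
    l₁ : Mat (r ℕ.+ m) n
    l₁ = lower {r ℕ.+ m} {m}
    u₂ : Mat r (r ℕ.+ m)
    u₂ = upper {r} {m}
    l₂ : Mat m (r ℕ.+ m)
    l₂ = lower {m} {r}

  ⟦⟧-split : (a : Mat k m) (b : Mat k r) (c : Mat k m) → ⟦ a & b & c ⟧ ≋ a · κ₁ ⊞ b · κ₂ ⊞ c · κ₃
  ⟦⟧-split {k} a b c = ≋-trans (∥-split a (b ∥ c)) (≋-trans
    (⊞-cong (≋-refl {X = a · u₁}) (·-congʳ l₁ (∥-split b c)))
    (solve (m ∷ r ∷ r ℕ.+ m ∷ n ∷ k ∷ [])
      ((0F , 3F) ∷ (2F , 3F) ∷ (1F , 2F) ∷ (0F , 2F) ∷ (4F , 0F) ∷ (4F , 1F) ∷ (4F , 0F) ∷ [])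
      (λ u₁ l₁ u₂ l₂ a b c → []
        ⊢ a ⊙ u₁ ⊕ (b ⊙ u₂ ⊕ c ⊙ l₂) ⊙ l₁ ⇒ a ⊙ u₁ ⊕ b ⊙ (u₂ ⊙ l₁) ⊕ c ⊙ (l₂ ⊙ l₁))
      (u₁ , l₁ , u₂ , l₂ , a , b , c , _) _))

  ⫽-split : ∀ {p q} (X : Mat p k) (Y : Mat q k) → X ⫽ Y ≋ upper {p} {q} ᴴ · X ⊞ lower {q} {p} ᴴ · Y
  ⫽-split {p = p} {q} X Y = ≋-trans (rowwise {p} {q} (X ⫽ Y))
    (⊞-cong (·-congˡ (upper {p} {q} ᴴ) (upper-⫽ X Y)) (·-congˡ (lower {q} {p} ᴴ) (lower-⫽ X Y)))

  rows₃-split : (a : Mat m k) (b : Mat r k) (c : Mat m k) → rows₃ a b c ≋ κ₁ ᴴ · a ⊞ κ₂ ᴴ · b ⊞ κ₃ ᴴ · c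
  rows₃-split {k} a b c = ≋-trans (⫽-split a (b ⫽ c)) (≋-trans
    (⊞-cong (≋-refl {X = u₁ ᴴ · a}) (·-congˡ (l₁ ᴴ) (⫽-split b c)))
    (solve (m ∷ r ∷ r ℕ.+ m ∷ n ∷ k ∷ [])
      ((0F , 3F) ∷ (2F , 3F) ∷ (1F , 2F) ∷ (0F , 2F) ∷ (0F , 4F) ∷ (1F , 4F) ∷ (0F , 4F) ∷ [])
      (λ u₁ l₁ u₂ l₂ a b c → []
        ⊢ u₁ † ⊙ a ⊕ l₁ † ⊙ (u₂ † ⊙ b ⊕ l₂ † ⊙ c) ⇒ u₁ † ⊙ a ⊕ (u₂ ⊙ l₁) † ⊙ b ⊕ (l₂ ⊙ l₁) † ⊙ c)
      (u₁ , l₁ , u₂ , l₂ , a , b , c , _) _))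

  υ λᴺ : Mat n N
  υ  = upper {n} {n}
  λᴺ = lower {n} {n}

  ⟦⟧₆-split : (a : Mat k m) (b : Mat k r) (c d : Mat k m) (e : Mat k r) (f : Mat k m) →
    ⟦ a & b & c & d & e & f ⟧ ≋ (a · κ₁ ⊞ b · κ₂ ⊞ c · κ₃) · υ ⊞ (d · κ₁ ⊞ e · κ₂ ⊞ f · κ₃) · λᴺ
  ⟦⟧₆-split a b c d e f = ≋-trans (∥-split ⟦ a & b & c ⟧ ⟦ d & e & f ⟧)
    (⊞-cong (·-congʳ υ (⟦⟧-split a b c)) (·-congʳ λᴺ (⟦⟧-split d e f)))

  rows₆-split : (a : Mat m k) (b : Mat r k) (c d : Mat m k) (e : Mat r k) (f : Mat m k) →
    rows₆ a b c d e f ≋ υ ᴴ · (κ₁ ᴴ · a ⊞ κ₂ ᴴ · b ⊞ κ₃ ᴴ · c) ⊞ λᴺ ᴴ · (κ₁ ᴴ · d ⊞ κ₂ ᴴ · e ⊞ κ₃ ᴴ · f)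
  rows₆-split a b c d e f = ≋-trans (⫽-split (rows₃ a b c) (rows₃ d e f))
    (⊞-cong (·-congˡ (υ ᴴ) (rows₃-split a b c)) (·-congˡ (λᴺ ᴴ) (rows₃-split d e f)))

  sel-ᴴ : ∀ {p q} (f : Fin p → Fin q) (X : Mat k q) → X · sel f ᴴ ≋ λ i j → X i (f j)
  sel-ᴴ f X i j = ≈-trans (·-congʳ (sel f ᴴ) {X} {(X ᴴ) ᴴ} (≋-sym (ᴴ-involutive X)) i j)
    (≈-trans (≈-sym (ᴴ-· (sel f) (X ᴴ) i j)) (≈-trans (conj-cong (sel-· f (X ᴴ) j i)) (conj-involutive _)))

record DoublingScalars (𝓡 : Ring 0ℓ 0ℓ) (involution : Involution 𝓡) : Set where
  open Ring 𝓡
  open Involution involution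
  field
    ζ ζ⁻¹ ½ : Carrier
    ζζ⁻¹≈1  : ζ * ζ⁻¹ ≈ 1#
    ζ⁻¹ζ≈1  : ζ⁻¹ * ζ ≈ 1#
    conj-ζ  : conj ζ ≈ - ζ
    ½+½≈1   : ½ + ½ ≈ 1#
    conj-½  : conj ½ ≈ ½

-- The matrices of Defs over an abstract ring: for 𝔹-ring they agree with them
-- definitionally, but here the quaternion arithmetic cannot unfold.
module SiegelDoubling
  (𝓡 : Ring 0ℓ 0ℓ) (involution : Involution 𝓡) (division : IsDivision 𝓡 involution)
  (scalars : DoublingScalars 𝓡 involution) (m r : ℕ) where

  open ThreeBlocks 𝓡 involution division m r public
  open DoublingScalars scalars
  open Ring 𝓡 using (Carrier; _≈_; _+_; _*_; -_; 0#; 1#)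

  φ : Mat n n
  φ = rows₃
    ⟦ 𝟎 & 𝟎        & scalar (- 1#) ⟧
    ⟦ 𝟎 & scalar ζ & 𝟎             ⟧
    ⟦ 𝟏 & 𝟎        & 𝟎             ⟧

  J : Mat N N
  J = (𝟎 {q = n} ∥ scalar (- 1#)) ⫽ (𝟏 {n} ∥ 𝟎)

  R : Mat N N
  R = rows₆
    ⟦ 𝟏 & 𝟎            & 𝟎             & 𝟎 & 𝟎              & 𝟎 ⟧
    ⟦ 𝟎 & scalar ½     & 𝟎             & 𝟎 & scalar (- ζ⁻¹) & 𝟎 ⟧
    ⟦ 𝟎 & 𝟎            & 𝟎             & 𝟏 & 𝟎              & 𝟎 ⟧
    ⟦ 𝟎 & 𝟎            & scalar (- 1#) & 𝟎 & 𝟎              & 𝟎 ⟧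
    ⟦ 𝟎 & scalar (- ½) & 𝟎             & 𝟎 & scalar (- ζ⁻¹) & 𝟎 ⟧
    ⟦ 𝟎 & 𝟎            & 𝟎             & 𝟎 & 𝟎              & 𝟏 ⟧

  R⁻¹ : Mat N N
  R⁻¹ = rows₆
    ⟦ 𝟏 & 𝟎                  & 𝟎 & 𝟎             & 𝟎                  & 𝟎 ⟧
    ⟦ 𝟎 & 𝟏                  & 𝟎 & 𝟎             & scalar (- 1#)      & 𝟎 ⟧
    ⟦ 𝟎 & 𝟎                  & 𝟎 & scalar (- 1#) & 𝟎                  & 𝟎 ⟧
    ⟦ 𝟎 & 𝟎                  & 𝟏 & 𝟎             & 𝟎                  & 𝟎 ⟧
    ⟦ 𝟎 & scalar (- (½ * ζ)) & 𝟎 & 𝟎             & scalar (- (½ * ζ)) & 𝟎 ⟧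
    ⟦ 𝟎 & 𝟎                  & 𝟎 & 𝟎             & 𝟎                  & 𝟏 ⟧

  e : Fin (suc m) → Mat m m
  e t i j = if does (i Finₚ.≟ j) ∧ does (toℕ i ℕₚ.<? toℕ t) then 1# else 0#

  τ : Fin (suc m) → Mat N N
  τ t = rows₆
    ⟦ 𝟏       & 𝟎 & 𝟎   & 𝟎 & 𝟎 & 𝟎 ⟧
    ⟦ 𝟎       & 𝟏 & 𝟎   & 𝟎 & 𝟎 & 𝟎 ⟧
    ⟦ 𝟎       & 𝟎 & 𝟏   & 𝟎 & 𝟎 & 𝟎 ⟧
    ⟦ 𝟎       & 𝟎 & e t & 𝟏 & 𝟎 & 𝟎 ⟧
    ⟦ 𝟎       & 𝟎 & 𝟎   & 𝟎 & 𝟏 & 𝟎 ⟧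
    ⟦ (e t) ᴴ & 𝟎 & 𝟎   & 𝟎 & 𝟎 & 𝟏 ⟧

  private
    z z⁻¹ h q : Mat r r
    z   = scalar ζ
    z⁻¹ = scalar ζ⁻¹
    h   = scalar ½
    q   = scalar (- (½ * ζ))

    zz⁻¹ : z · z⁻¹ ≋ 𝟏
    zz⁻¹ = ≋-trans (scalar-· ζ ζ⁻¹) (scalar-cong ζζ⁻¹≈1)

    z⁻¹z : z⁻¹ · z ≋ 𝟏
    z⁻¹z = ≋-trans (scalar-· ζ⁻¹ ζ) (scalar-cong ζ⁻¹ζ≈1)

    zᴴ : z ᴴ ≋ ⊟ z
    zᴴ = ≋-trans (scalar-ᴴ ζ) (≋-trans (scalar-cong conj-ζ) (scalar-neg ζ))

    z⁻¹ᴴ : z⁻¹ ᴴ ≋ ⊟ z⁻¹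
    z⁻¹ᴴ = ≋-trans
      (solve (r ∷ []) ((0F , 0F) ∷ (0F , 0F) ∷ []) (λ z i → (z ⊙ i ⇒ 𝕀) ∷ [] ⊢ i † ⇒ ⊝ (i † ⊙ (⊝ z) ⊙ i)) (z , z⁻¹ , _) (zz⁻¹ , _))
      (≋-trans (⊟-cong (·-congʳ z⁻¹ (·-congˡ (z⁻¹ ᴴ) (≋-sym zᴴ))))
      (solve (r ∷ []) ((0F , 0F) ∷ (0F , 0F) ∷ []) (λ z i → (i † ⊙ z † ⇒ 𝕀) ∷ [] ⊢ ⊝ (i † ⊙ z † ⊙ i) ⇒ ⊝ i) (z , z⁻¹ , _)
        (≋-trans (≋-sym (ᴴ-· z z⁻¹)) (≋-trans (ᴴ-cong zz⁻¹) 𝟏-ᴴ) , _)))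

    hᴴ : h ᴴ ≋ h
    hᴴ = ≋-trans (scalar-ᴴ ½) (scalar-cong conj-½)

    h+h : h ⊞ h ≋ 𝟏
    h+h = ≋-trans (≋-sym (scalar-+ ½ ½)) (scalar-cong ½+½≈1)

    -𝟏 : ∀ {k} → scalar {k} (- 1#) ≋ ⊟ 𝟏
    -𝟏 = scalar-neg 1#

  φ≋ : φ ≋ κ₂ ᴴ · z · κ₂ ⊞ κ₃ ᴴ · κ₁ ⊞ ⊟ (κ₁ ᴴ · κ₃)
  φ≋ = ≋-trans (rows₃-split ⟦ 𝟎 & 𝟎 & scalar (- 1#) ⟧ ⟦ 𝟎 & z & 𝟎 ⟧ ⟦ 𝟏 & 𝟎 & 𝟎 ⟧)
    (solve (m ∷ r ∷ n ∷ []) ((0F , 2F) ∷ (1F , 2F) ∷ (0F , 2F) ∷ (0F , 2F) ∷ (1F , 2F) ∷ (0F , 2F) ∷ (1F , 1F) ∷ (0F , 0F) ∷ [])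
      (λ κ₁ κ₂ κ₃ a b c z -𝟏 →
        (a ⇒ 𝟘 ⊙ κ₁ ⊕ 𝟘 ⊙ κ₂ ⊕ -𝟏 ⊙ κ₃) ∷ (b ⇒ 𝟘 ⊙ κ₁ ⊕ z ⊙ κ₂ ⊕ 𝟘 ⊙ κ₃) ∷ (c ⇒ 𝕀 ⊙ κ₁ ⊕ 𝟘 ⊙ κ₂ ⊕ 𝟘 ⊙ κ₃) ∷ (-𝟏 ⇒ ⊝ 𝕀) ∷ []
        ⊢ κ₁ † ⊙ a ⊕ κ₂ † ⊙ b ⊕ κ₃ † ⊙ c ⇒ κ₂ † ⊙ z ⊙ κ₂ ⊕ κ₃ † ⊙ κ₁ ⊖ κ₁ † ⊙ κ₃)
      (κ₁ , κ₂ , κ₃ , ⟦ 𝟎 & 𝟎 & scalar (- 1#) ⟧ , ⟦ 𝟎 & z & 𝟎 ⟧ , ⟦ 𝟏 & 𝟎 & 𝟎 ⟧ , z , scalar (- 1#) , _)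
      (⟦⟧-split 𝟎 𝟎 (scalar (- 1#)) , ⟦⟧-split 𝟎 z 𝟎 , ⟦⟧-split 𝟏 𝟎 𝟎 , -𝟏 , _))

  form : Form n
  form = record
    { Φ = Φ₀ ; Ψ = φ
    ; skew = solve (m ∷ r ∷ n ∷ []) ((0F , 2F) ∷ (1F , 2F) ∷ (0F , 2F) ∷ (1F , 1F) ∷ [])
        (λ κ₁ κ₂ κ₃ i → (i † ⇒ ⊝ i) ∷ []
          ⊢ (κ₂ † ⊙ i ⊙ κ₂ ⊕ κ₁ † ⊙ κ₃ ⊖ κ₃ † ⊙ κ₁) † ⇒ ⊝ (κ₂ † ⊙ i ⊙ κ₂ ⊕ κ₁ † ⊙ κ₃ ⊖ κ₃ † ⊙ κ₁))
        (κ₁ , κ₂ , κ₃ , z⁻¹ , _) (z⁻¹ᴴ , _)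
    ; ΦΨ≋𝟏 = left-inverse {A = φ} {Φ₀} φΦ ; ΨΦ≋𝟏 = φΦ }
    where
    Φ₀ : Mat n n
    Φ₀ = κ₂ ᴴ · z⁻¹ · κ₂ ⊞ κ₁ ᴴ · κ₃ ⊞ ⊟ (κ₃ ᴴ · κ₁)
    φΦ : φ · Φ₀ ≋ 𝟏
    φΦ = solve (m ∷ r ∷ n ∷ []) ((0F , 2F) ∷ (1F , 2F) ∷ (0F , 2F) ∷ (1F , 1F) ∷ (1F , 1F) ∷ (2F , 2F) ∷ [])
        (λ κ₁ κ₂ κ₃ z i φ → (φ ⇒ κ₂ † ⊙ z ⊙ κ₂ ⊕ κ₃ † ⊙ κ₁ ⊖ κ₁ † ⊙ κ₃) ∷ (z ⊙ i ⇒ 𝕀) ∷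
            (κ₁ ⊙ κ₁ † ⇒ 𝕀) ∷ (κ₂ ⊙ κ₂ † ⇒ 𝕀) ∷ (κ₃ ⊙ κ₃ † ⇒ 𝕀) ∷
            (κ₁ ⊙ κ₂ † ⇒ 𝟘) ∷ (κ₁ ⊙ κ₃ † ⇒ 𝟘) ∷ (κ₂ ⊙ κ₃ † ⇒ 𝟘) ∷ (κ₁ † ⊙ κ₁ ⇒ 𝕀 ⊖ κ₂ † ⊙ κ₂ ⊖ κ₃ † ⊙ κ₃) ∷ []
          ⊢ φ ⊙ (κ₂ † ⊙ i ⊙ κ₂ ⊕ κ₁ † ⊙ κ₃ ⊖ κ₃ † ⊙ κ₁) ⇒ 𝕀)
        (κ₁ , κ₂ , κ₃ , z , z⁻¹ , φ , _)
        (φ≋ , zz⁻¹ , κ₁κ₁ᴴ , κ₂κ₂ᴴ , κ₃κ₃ᴴ , κ₁κ₂ᴴ , κ₁κ₃ᴴ , κ₂κ₃ᴴ , κ₁ᴴκ₁ , _)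

  J≋ : J ≋ λᴺ ᴴ · υ ⊞ ⊟ (υ ᴴ · λᴺ)
  J≋ = ≋-trans (⫽-split (𝟎 {q = n} ∥ scalar (- 1#)) (𝟏 {n} ∥ 𝟎))
    (solve (n ∷ N ∷ []) ((0F , 1F) ∷ (0F , 1F) ∷ (0F , 1F) ∷ (0F , 1F) ∷ (0F , 0F) ∷ [])
      (λ u l a b -𝟏 → (a ⇒ 𝟘 ⊙ u ⊕ -𝟏 ⊙ l) ∷ (b ⇒ 𝕀 ⊙ u ⊕ 𝟘 ⊙ l) ∷ (-𝟏 ⇒ ⊝ 𝕀) ∷ []
        ⊢ u † ⊙ a ⊕ l † ⊙ b ⇒ l † ⊙ u ⊖ u † ⊙ l)
      (υ , λᴺ , 𝟎 {q = n} ∥ scalar (- 1#) , 𝟏 {n} ∥ 𝟎 , scalar (- 1#) , _)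
      (∥-split {k = n} (𝟎 {n} {n}) (scalar (- 1#)) , ∥-split {k = n} (𝟏 {n}) 𝟎 , -𝟏 , _))

  R≋ : R ≋ υ ᴴ · (κ₁ ᴴ · κ₁ · υ ⊞ κ₂ ᴴ · (h · κ₂ · υ ⊞ ⊟ (z⁻¹ · κ₂ · λᴺ)) ⊞ κ₃ ᴴ · κ₁ · λᴺ)
         ⊞ λᴺ ᴴ · (κ₃ ᴴ · κ₃ · λᴺ ⊞ ⊟ (κ₂ ᴴ · (h · κ₂ · υ ⊞ z⁻¹ · κ₂ · λᴺ)) ⊞ ⊟ (κ₁ ᴴ · κ₃ · υ))
  R≋ = ≋-trans (rows₆-split r₁ r₂ r₃ r₄ r₅ r₆)
    (solve (m ∷ r ∷ n ∷ N ∷ [])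
      ((0F , 2F) ∷ (1F , 2F) ∷ (0F , 2F) ∷ (2F , 3F) ∷ (2F , 3F) ∷ (1F , 1F) ∷ (1F , 1F) ∷ (0F , 0F) ∷ (1F , 1F) ∷ (1F , 1F) ∷
       (0F , 3F) ∷ (1F , 3F) ∷ (0F , 3F) ∷ (0F , 3F) ∷ (1F , 3F) ∷ (0F , 3F) ∷ [])
      (λ κ₁ κ₂ κ₃ u l h i -𝟏 -h -i r₁ r₂ r₃ r₄ r₅ r₆ →
        (r₁ ⇒ (𝕀 ⊙ κ₁ ⊕ 𝟘 ⊙ κ₂ ⊕ 𝟘 ⊙ κ₃) ⊙ u ⊕ (𝟘 ⊙ κ₁ ⊕ 𝟘 ⊙ κ₂ ⊕ 𝟘 ⊙ κ₃) ⊙ l) ∷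
        (r₂ ⇒ (𝟘 ⊙ κ₁ ⊕ h ⊙ κ₂ ⊕ 𝟘 ⊙ κ₃) ⊙ u ⊕ (𝟘 ⊙ κ₁ ⊕ -i ⊙ κ₂ ⊕ 𝟘 ⊙ κ₃) ⊙ l) ∷
        (r₃ ⇒ (𝟘 ⊙ κ₁ ⊕ 𝟘 ⊙ κ₂ ⊕ 𝟘 ⊙ κ₃) ⊙ u ⊕ (𝕀 ⊙ κ₁ ⊕ 𝟘 ⊙ κ₂ ⊕ 𝟘 ⊙ κ₃) ⊙ l) ∷
        (r₄ ⇒ (𝟘 ⊙ κ₁ ⊕ 𝟘 ⊙ κ₂ ⊕ -𝟏 ⊙ κ₃) ⊙ u ⊕ (𝟘 ⊙ κ₁ ⊕ 𝟘 ⊙ κ₂ ⊕ 𝟘 ⊙ κ₃) ⊙ l) ∷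
        (r₅ ⇒ (𝟘 ⊙ κ₁ ⊕ -h ⊙ κ₂ ⊕ 𝟘 ⊙ κ₃) ⊙ u ⊕ (𝟘 ⊙ κ₁ ⊕ -i ⊙ κ₂ ⊕ 𝟘 ⊙ κ₃) ⊙ l) ∷
        (r₆ ⇒ (𝟘 ⊙ κ₁ ⊕ 𝟘 ⊙ κ₂ ⊕ 𝟘 ⊙ κ₃) ⊙ u ⊕ (𝟘 ⊙ κ₁ ⊕ 𝟘 ⊙ κ₂ ⊕ 𝕀 ⊙ κ₃) ⊙ l) ∷
        (-𝟏 ⇒ ⊝ 𝕀) ∷ (-h ⇒ ⊝ h) ∷ (-i ⇒ ⊝ i) ∷ []
        ⊢ u † ⊙ (κ₁ † ⊙ r₁ ⊕ κ₂ † ⊙ r₂ ⊕ κ₃ † ⊙ r₃) ⊕ l † ⊙ (κ₁ † ⊙ r₄ ⊕ κ₂ † ⊙ r₅ ⊕ κ₃ † ⊙ r₆)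
        ⇒ u † ⊙ (κ₁ † ⊙ κ₁ ⊙ u ⊕ κ₂ † ⊙ (h ⊙ κ₂ ⊙ u ⊖ i ⊙ κ₂ ⊙ l) ⊕ κ₃ † ⊙ κ₁ ⊙ l)
        ⊕ l † ⊙ (κ₃ † ⊙ κ₃ ⊙ l ⊖ κ₂ † ⊙ (h ⊙ κ₂ ⊙ u ⊕ i ⊙ κ₂ ⊙ l) ⊖ κ₁ † ⊙ κ₃ ⊙ u))
      (κ₁ , κ₂ , κ₃ , υ , λᴺ , h , z⁻¹ , scalar (- 1#) , scalar (- ½) , scalar (- ζ⁻¹) ,
       r₁ , r₂ , r₃ , r₄ , r₅ , r₆ , _)
      (⟦⟧₆-split 𝟏 𝟎 𝟎 𝟎 𝟎 𝟎 , ⟦⟧₆-split 𝟎 h 𝟎 𝟎 (scalar (- ζ⁻¹)) 𝟎 , ⟦⟧₆-split 𝟎 𝟎 𝟎 𝟏 𝟎 𝟎 ,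
       ⟦⟧₆-split 𝟎 𝟎 (scalar (- 1#)) 𝟎 𝟎 𝟎 , ⟦⟧₆-split 𝟎 (scalar (- ½)) 𝟎 𝟎 (scalar (- ζ⁻¹)) 𝟎 ,
       ⟦⟧₆-split 𝟎 𝟎 𝟎 𝟎 𝟎 𝟏 , -𝟏 , scalar-neg ½ , scalar-neg ζ⁻¹ , _))
    where
    r₁ r₃ r₄ r₆ : Mat m N
    r₂ r₅ : Mat r N
    r₁ = ⟦ 𝟏 & 𝟎            & 𝟎             & 𝟎 & 𝟎              & 𝟎 ⟧
    r₂ = ⟦ 𝟎 & scalar ½     & 𝟎             & 𝟎 & scalar (- ζ⁻¹) & 𝟎 ⟧
    r₃ = ⟦ 𝟎 & 𝟎            & 𝟎             & 𝟏 & 𝟎              & 𝟎 ⟧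
    r₄ = ⟦ 𝟎 & 𝟎            & scalar (- 1#) & 𝟎 & 𝟎              & 𝟎 ⟧
    r₅ = ⟦ 𝟎 & scalar (- ½) & 𝟎             & 𝟎 & scalar (- ζ⁻¹) & 𝟎 ⟧
    r₆ = ⟦ 𝟎 & 𝟎            & 𝟎             & 𝟎 & 𝟎              & 𝟏 ⟧

  R⁻¹≋ : R⁻¹ ≋ υ ᴴ · (κ₁ ᴴ · κ₁ · υ ⊞ κ₂ ᴴ · κ₂ · (υ ⊞ ⊟ λᴺ) ⊞ ⊟ (κ₃ ᴴ · κ₁ · λᴺ))
             ⊞ λᴺ ᴴ · (κ₁ ᴴ · κ₃ · υ ⊞ κ₂ ᴴ · q · κ₂ · (υ ⊞ λᴺ) ⊞ κ₃ ᴴ · κ₃ · λᴺ)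
  R⁻¹≋ = ≋-trans (rows₆-split r₁ r₂ r₃ r₄ r₅ r₆)
    (solve (m ∷ r ∷ n ∷ N ∷ [])
      ((0F , 2F) ∷ (1F , 2F) ∷ (0F , 2F) ∷ (2F , 3F) ∷ (2F , 3F) ∷ (1F , 1F) ∷ (0F , 0F) ∷ (1F , 1F) ∷
       (0F , 3F) ∷ (1F , 3F) ∷ (0F , 3F) ∷ (0F , 3F) ∷ (1F , 3F) ∷ (0F , 3F) ∷ [])
      (λ κ₁ κ₂ κ₃ u l q -𝟏 -𝟏′ r₁ r₂ r₃ r₄ r₅ r₆ →
        (r₁ ⇒ (𝕀 ⊙ κ₁ ⊕ 𝟘 ⊙ κ₂ ⊕ 𝟘 ⊙ κ₃) ⊙ u ⊕ (𝟘 ⊙ κ₁ ⊕ 𝟘 ⊙ κ₂ ⊕ 𝟘 ⊙ κ₃) ⊙ l) ∷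
        (r₂ ⇒ (𝟘 ⊙ κ₁ ⊕ 𝕀 ⊙ κ₂ ⊕ 𝟘 ⊙ κ₃) ⊙ u ⊕ (𝟘 ⊙ κ₁ ⊕ -𝟏′ ⊙ κ₂ ⊕ 𝟘 ⊙ κ₃) ⊙ l) ∷
        (r₃ ⇒ (𝟘 ⊙ κ₁ ⊕ 𝟘 ⊙ κ₂ ⊕ 𝟘 ⊙ κ₃) ⊙ u ⊕ (-𝟏 ⊙ κ₁ ⊕ 𝟘 ⊙ κ₂ ⊕ 𝟘 ⊙ κ₃) ⊙ l) ∷
        (r₄ ⇒ (𝟘 ⊙ κ₁ ⊕ 𝟘 ⊙ κ₂ ⊕ 𝕀 ⊙ κ₃) ⊙ u ⊕ (𝟘 ⊙ κ₁ ⊕ 𝟘 ⊙ κ₂ ⊕ 𝟘 ⊙ κ₃) ⊙ l) ∷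
        (r₅ ⇒ (𝟘 ⊙ κ₁ ⊕ q ⊙ κ₂ ⊕ 𝟘 ⊙ κ₃) ⊙ u ⊕ (𝟘 ⊙ κ₁ ⊕ q ⊙ κ₂ ⊕ 𝟘 ⊙ κ₃) ⊙ l) ∷
        (r₆ ⇒ (𝟘 ⊙ κ₁ ⊕ 𝟘 ⊙ κ₂ ⊕ 𝟘 ⊙ κ₃) ⊙ u ⊕ (𝟘 ⊙ κ₁ ⊕ 𝟘 ⊙ κ₂ ⊕ 𝕀 ⊙ κ₃) ⊙ l) ∷
        (-𝟏 ⇒ ⊝ 𝕀) ∷ (-𝟏′ ⇒ ⊝ 𝕀) ∷ []
        ⊢ u † ⊙ (κ₁ † ⊙ r₁ ⊕ κ₂ † ⊙ r₂ ⊕ κ₃ † ⊙ r₃) ⊕ l † ⊙ (κ₁ † ⊙ r₄ ⊕ κ₂ † ⊙ r₅ ⊕ κ₃ † ⊙ r₆)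
        ⇒ u † ⊙ (κ₁ † ⊙ κ₁ ⊙ u ⊕ κ₂ † ⊙ κ₂ ⊙ (u ⊖ l) ⊖ κ₃ † ⊙ κ₁ ⊙ l)
        ⊕ l † ⊙ (κ₁ † ⊙ κ₃ ⊙ u ⊕ κ₂ † ⊙ q ⊙ κ₂ ⊙ (u ⊕ l) ⊕ κ₃ † ⊙ κ₃ ⊙ l))
      (κ₁ , κ₂ , κ₃ , υ , λᴺ , q , scalar (- 1#) , scalar (- 1#) , r₁ , r₂ , r₃ , r₄ , r₅ , r₆ , _)
      (⟦⟧₆-split 𝟏 𝟎 𝟎 𝟎 𝟎 𝟎 , ⟦⟧₆-split 𝟎 𝟏 𝟎 𝟎 (scalar (- 1#)) 𝟎 , ⟦⟧₆-split 𝟎 𝟎 𝟎 (scalar (- 1#)) 𝟎 𝟎 ,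
       ⟦⟧₆-split 𝟎 𝟎 𝟏 𝟎 𝟎 𝟎 , ⟦⟧₆-split 𝟎 q 𝟎 𝟎 q 𝟎 , ⟦⟧₆-split 𝟎 𝟎 𝟎 𝟎 𝟎 𝟏 , -𝟏 , -𝟏 , _))
    where
    r₁ r₃ r₄ r₆ : Mat m N
    r₂ r₅ : Mat r N
    r₁ = ⟦ 𝟏 & 𝟎 & 𝟎 & 𝟎             & 𝟎             & 𝟎 ⟧
    r₂ = ⟦ 𝟎 & 𝟏 & 𝟎 & 𝟎             & scalar (- 1#) & 𝟎 ⟧
    r₃ = ⟦ 𝟎 & 𝟎 & 𝟎 & scalar (- 1#) & 𝟎             & 𝟎 ⟧
    r₄ = ⟦ 𝟎 & 𝟎 & 𝟏 & 𝟎             & 𝟎             & 𝟎 ⟧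
    r₅ = ⟦ 𝟎 & q & 𝟎 & 𝟎             & q             & 𝟎 ⟧
    r₆ = ⟦ 𝟎 & 𝟎 & 𝟎 & 𝟎             & 𝟎             & 𝟏 ⟧

  private
    υυᴴ : υ · υ ᴴ ≋ 𝟏
    υυᴴ = upper-upperᴴ {n} {n}
    λλᴴ : λᴺ · λᴺ ᴴ ≋ 𝟏
    λλᴴ = lower-lowerᴴ {n} {n}
    υλᴴ : υ · λᴺ ᴴ ≋ 𝟎
    υλᴴ = upper-lowerᴴ {n} {n}
    υᴴυ : υ ᴴ · υ ≋ 𝟏 ⊞ ⊟ (λᴺ ᴴ · λᴺ)
    υᴴυ = ≋-trans (solve (n ∷ N ∷ []) ((0F , 1F) ∷ (0F , 1F) ∷ [])
      (λ u l → [] ⊢ u † ⊙ u ⇒ (u † ⊙ u ⊕ l † ⊙ l) ⊖ l † ⊙ l) (υ , λᴺ , _) _)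
      (⊞-cong (blocks-resolution {n} {n}) (≋-refl {X = ⊟ (λᴺ ᴴ · λᴺ)}))

  τ≋ : ∀ t → τ t ≋ 𝟏 ⊞ λᴺ ᴴ · (κ₁ ᴴ · e t · κ₃ ⊞ κ₃ ᴴ · e t ᴴ · κ₁) · υ
  τ≋ t = ≋-trans (rows₆-split r₁ r₂ r₃ r₄ r₅ r₆)
    (solve (m ∷ r ∷ n ∷ N ∷ [])
      ((0F , 2F) ∷ (1F , 2F) ∷ (0F , 2F) ∷ (2F , 3F) ∷ (2F , 3F) ∷ (0F , 0F) ∷
       (0F , 3F) ∷ (1F , 3F) ∷ (0F , 3F) ∷ (0F , 3F) ∷ (1F , 3F) ∷ (0F , 3F) ∷ [])
      (λ κ₁ κ₂ κ₃ u l e r₁ r₂ r₃ r₄ r₅ r₆ →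
        (r₁ ⇒ (𝕀 ⊙ κ₁ ⊕ 𝟘 ⊙ κ₂ ⊕ 𝟘 ⊙ κ₃) ⊙ u ⊕ (𝟘 ⊙ κ₁ ⊕ 𝟘 ⊙ κ₂ ⊕ 𝟘 ⊙ κ₃) ⊙ l) ∷
        (r₂ ⇒ (𝟘 ⊙ κ₁ ⊕ 𝕀 ⊙ κ₂ ⊕ 𝟘 ⊙ κ₃) ⊙ u ⊕ (𝟘 ⊙ κ₁ ⊕ 𝟘 ⊙ κ₂ ⊕ 𝟘 ⊙ κ₃) ⊙ l) ∷
        (r₃ ⇒ (𝟘 ⊙ κ₁ ⊕ 𝟘 ⊙ κ₂ ⊕ 𝕀 ⊙ κ₃) ⊙ u ⊕ (𝟘 ⊙ κ₁ ⊕ 𝟘 ⊙ κ₂ ⊕ 𝟘 ⊙ κ₃) ⊙ l) ∷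
        (r₄ ⇒ (𝟘 ⊙ κ₁ ⊕ 𝟘 ⊙ κ₂ ⊕ e ⊙ κ₃) ⊙ u ⊕ (𝕀 ⊙ κ₁ ⊕ 𝟘 ⊙ κ₂ ⊕ 𝟘 ⊙ κ₃) ⊙ l) ∷
        (r₅ ⇒ (𝟘 ⊙ κ₁ ⊕ 𝟘 ⊙ κ₂ ⊕ 𝟘 ⊙ κ₃) ⊙ u ⊕ (𝟘 ⊙ κ₁ ⊕ 𝕀 ⊙ κ₂ ⊕ 𝟘 ⊙ κ₃) ⊙ l) ∷
        (r₆ ⇒ (e † ⊙ κ₁ ⊕ 𝟘 ⊙ κ₂ ⊕ 𝟘 ⊙ κ₃) ⊙ u ⊕ (𝟘 ⊙ κ₁ ⊕ 𝟘 ⊙ κ₂ ⊕ 𝕀 ⊙ κ₃) ⊙ l) ∷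
        (κ₁ † ⊙ κ₁ ⇒ 𝕀 ⊖ κ₂ † ⊙ κ₂ ⊖ κ₃ † ⊙ κ₃) ∷ (u † ⊙ u ⇒ 𝕀 ⊖ l † ⊙ l) ∷ []
        ⊢ u † ⊙ (κ₁ † ⊙ r₁ ⊕ κ₂ † ⊙ r₂ ⊕ κ₃ † ⊙ r₃) ⊕ l † ⊙ (κ₁ † ⊙ r₄ ⊕ κ₂ † ⊙ r₅ ⊕ κ₃ † ⊙ r₆)
        ⇒ 𝕀 ⊕ l † ⊙ (κ₁ † ⊙ e ⊙ κ₃ ⊕ κ₃ † ⊙ e † ⊙ κ₁) ⊙ u)
      (κ₁ , κ₂ , κ₃ , υ , λᴺ , e t , r₁ , r₂ , r₃ , r₄ , r₅ , r₆ , _)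
      (⟦⟧₆-split 𝟏 𝟎 𝟎 𝟎 𝟎 𝟎 , ⟦⟧₆-split 𝟎 𝟏 𝟎 𝟎 𝟎 𝟎 , ⟦⟧₆-split 𝟎 𝟎 𝟏 𝟎 𝟎 𝟎 , ⟦⟧₆-split 𝟎 𝟎 (e t) 𝟏 𝟎 𝟎 ,
       ⟦⟧₆-split 𝟎 𝟎 𝟎 𝟎 𝟏 𝟎 , ⟦⟧₆-split (e t ᴴ) 𝟎 𝟎 𝟎 𝟎 𝟏 , κ₁ᴴκ₁ , υᴴυ , _))
    where
    r₁ r₃ r₄ r₆ : Mat m N
    r₂ r₅ : Mat r N
    r₁ = ⟦ 𝟏       & 𝟎 & 𝟎   & 𝟎 & 𝟎 & 𝟎 ⟧
    r₂ = ⟦ 𝟎       & 𝟏 & 𝟎   & 𝟎 & 𝟎 & 𝟎 ⟧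
    r₃ = ⟦ 𝟎       & 𝟎 & 𝟏   & 𝟎 & 𝟎 & 𝟎 ⟧
    r₄ = ⟦ 𝟎       & 𝟎 & e t & 𝟏 & 𝟎 & 𝟎 ⟧
    r₅ = ⟦ 𝟎       & 𝟎 & 𝟎   & 𝟎 & 𝟏 & 𝟎 ⟧
    r₆ = ⟦ (e t) ᴴ & 𝟎 & 𝟎   & 𝟎 & 𝟎 & 𝟏 ⟧

  RᴴΔR≋J : R ᴴ · (υ ᴴ · φ · υ ⊞ ⊟ (λᴺ ᴴ · φ · λᴺ)) · R ≋ J
  RᴴΔR≋J = ≋-trans
    (solve (n ∷ N ∷ []) ((0F , 1F) ∷ (0F , 1F) ∷ (0F , 0F) ∷ (1F , 1F) ∷ [])
      (λ u l φ R → [] ⊢ R † ⊙ (u † ⊙ φ ⊙ u ⊖ l † ⊙ φ ⊙ l) ⊙ R ⇒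
        (u ⊙ R) † ⊙ φ ⊙ (u ⊙ R) ⊖ (l ⊙ R) † ⊙ φ ⊙ (l ⊙ R)) (υ , λᴺ , φ , R , _) _)
    (≋-trans (⊞-cong upper-part (⊟-cong lower-part))
    (≋-trans (solve (m ∷ r ∷ n ∷ N ∷ [])
        ((0F , 2F) ∷ (1F , 2F) ∷ (0F , 2F) ∷ (2F , 3F) ∷ (2F , 3F) ∷ (1F , 1F) ∷ (1F , 1F) ∷ (1F , 1F) ∷ [])
        (λ κ₁ κ₂ κ₃ u l h z i → (h † ⇒ h) ∷ (i † ⇒ ⊝ i) ∷ (z ⊙ i ⇒ 𝕀) ∷ (i ⊙ z ⇒ 𝕀) ∷ []
          ⊢ ((h ⊙ κ₂ ⊙ u ⊖ i ⊙ κ₂ ⊙ l) † ⊙ z ⊙ (h ⊙ κ₂ ⊙ u ⊖ i ⊙ κ₂ ⊙ l)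
              ⊕ l † ⊙ κ₁ † ⊙ κ₁ ⊙ u ⊖ u † ⊙ κ₁ † ⊙ κ₁ ⊙ l)
            ⊖ ((h ⊙ κ₂ ⊙ u ⊕ i ⊙ κ₂ ⊙ l) † ⊙ z ⊙ (h ⊙ κ₂ ⊙ u ⊕ i ⊙ κ₂ ⊙ l)
              ⊖ l † ⊙ κ₃ † ⊙ κ₃ ⊙ u ⊕ u † ⊙ κ₃ † ⊙ κ₃ ⊙ l)
          ⇒ (l † ⊙ κ₂ † ⊙ (h ⊕ h) ⊙ κ₂ ⊙ u ⊖ u † ⊙ κ₂ † ⊙ (h ⊕ h) ⊙ κ₂ ⊙ l)
            ⊕ (l † ⊙ κ₁ † ⊙ κ₁ ⊙ u ⊖ u † ⊙ κ₁ † ⊙ κ₁ ⊙ l ⊕ l † ⊙ κ₃ † ⊙ κ₃ ⊙ u ⊖ u † ⊙ κ₃ † ⊙ κ₃ ⊙ l))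
        (κ₁ , κ₂ , κ₃ , υ , λᴺ , h , z , z⁻¹ , _) (hᴴ , z⁻¹ᴴ , zz⁻¹ , z⁻¹z , _))
    (≋-trans (⊞-cong (⊞-cong (·-congʳ υ (·-congʳ κ₂ (·-congˡ (λᴺ ᴴ · κ₂ ᴴ) h+h)))
                (⊟-cong (·-congʳ λᴺ (·-congʳ κ₂ (·-congˡ (υ ᴴ · κ₂ ᴴ) h+h))))) ≋-refl)
    (≋-trans (solve (m ∷ r ∷ n ∷ N ∷ [])
        ((0F , 2F) ∷ (1F , 2F) ∷ (0F , 2F) ∷ (2F , 3F) ∷ (2F , 3F) ∷ [])
        (λ κ₁ κ₂ κ₃ u l → (κ₁ † ⊙ κ₁ ⇒ 𝕀 ⊖ κ₂ † ⊙ κ₂ ⊖ κ₃ † ⊙ κ₃) ∷ []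
          ⊢ (l † ⊙ κ₂ † ⊙ 𝕀 ⊙ κ₂ ⊙ u ⊖ u † ⊙ κ₂ † ⊙ 𝕀 ⊙ κ₂ ⊙ l)
            ⊕ (l † ⊙ κ₁ † ⊙ κ₁ ⊙ u ⊖ u † ⊙ κ₁ † ⊙ κ₁ ⊙ l ⊕ l † ⊙ κ₃ † ⊙ κ₃ ⊙ u ⊖ u † ⊙ κ₃ † ⊙ κ₃ ⊙ l)
          ⇒ l † ⊙ u ⊖ u † ⊙ l)
        (κ₁ , κ₂ , κ₃ , υ , λᴺ , _) (κ₁ᴴκ₁ , _))
      (≋-sym J≋)))))
    where
    p s : Mat r N
    p = h · κ₂ · υ ⊞ ⊟ (z⁻¹ · κ₂ · λᴺ)
    s = h · κ₂ · υ ⊞ z⁻¹ · κ₂ · λᴺ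
    upper-part : (υ · R) ᴴ · φ · (υ · R) ≋ p ᴴ · z · p ⊞ λᴺ ᴴ · κ₁ ᴴ · κ₁ · υ ⊞ ⊟ (υ ᴴ · κ₁ ᴴ · κ₁ · λᴺ)
    upper-part = solve (m ∷ r ∷ n ∷ N ∷ [])
      ((0F , 2F) ∷ (1F , 2F) ∷ (0F , 2F) ∷ (2F , 3F) ∷ (2F , 3F) ∷ (1F , 1F) ∷ (1F , 3F) ∷ (2F , 2F) ∷ (3F , 3F) ∷ [])
      (λ κ₁ κ₂ κ₃ u l z p φ R →
        (u ⊙ R ⇒ κ₁ † ⊙ κ₁ ⊙ u ⊕ κ₂ † ⊙ p ⊕ κ₃ † ⊙ κ₁ ⊙ l) ∷ (φ ⇒ κ₂ † ⊙ z ⊙ κ₂ ⊕ κ₃ † ⊙ κ₁ ⊖ κ₁ † ⊙ κ₃) ∷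
        (κ₁ ⊙ κ₁ † ⇒ 𝕀) ∷ (κ₂ ⊙ κ₂ † ⇒ 𝕀) ∷ (κ₃ ⊙ κ₃ † ⇒ 𝕀) ∷
        (κ₁ ⊙ κ₂ † ⇒ 𝟘) ∷ (κ₁ ⊙ κ₃ † ⇒ 𝟘) ∷ (κ₂ ⊙ κ₃ † ⇒ 𝟘) ∷ []
        ⊢ (u ⊙ R) † ⊙ φ ⊙ (u ⊙ R) ⇒ p † ⊙ z ⊙ p ⊕ l † ⊙ κ₁ † ⊙ κ₁ ⊙ u ⊖ u † ⊙ κ₁ † ⊙ κ₁ ⊙ l)
      (κ₁ , κ₂ , κ₃ , υ , λᴺ , z , p , φ , R , _)
      (υR , φ≋ , κ₁κ₁ᴴ , κ₂κ₂ᴴ , κ₃κ₃ᴴ , κ₁κ₂ᴴ , κ₁κ₃ᴴ , κ₂κ₃ᴴ , _)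
      where
      υR : υ · R ≋ κ₁ ᴴ · κ₁ · υ ⊞ κ₂ ᴴ · p ⊞ κ₃ ᴴ · κ₁ · λᴺ
      υR = ≋-trans (·-congˡ υ R≋) (solve (n ∷ N ∷ []) ((0F , 1F) ∷ (0F , 1F) ∷ (0F , 1F) ∷ (0F , 1F) ∷ [])
        (λ u l a b → (u ⊙ u † ⇒ 𝕀) ∷ (u ⊙ l † ⇒ 𝟘) ∷ [] ⊢ u ⊙ (u † ⊙ a ⊕ l † ⊙ b) ⇒ a)
        (υ , λᴺ , κ₁ ᴴ · κ₁ · υ ⊞ κ₂ ᴴ · p ⊞ κ₃ ᴴ · κ₁ · λᴺ ,
         κ₃ ᴴ · κ₃ · λᴺ ⊞ ⊟ (κ₂ ᴴ · s) ⊞ ⊟ (κ₁ ᴴ · κ₃ · υ) , _) (υυᴴ , υλᴴ , _))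
    lower-part : (λᴺ · R) ᴴ · φ · (λᴺ · R) ≋ s ᴴ · z · s ⊞ ⊟ (λᴺ ᴴ · κ₃ ᴴ · κ₃ · υ) ⊞ υ ᴴ · κ₃ ᴴ · κ₃ · λᴺ
    lower-part = solve (m ∷ r ∷ n ∷ N ∷ [])
      ((0F , 2F) ∷ (1F , 2F) ∷ (0F , 2F) ∷ (2F , 3F) ∷ (2F , 3F) ∷ (1F , 1F) ∷ (1F , 3F) ∷ (2F , 2F) ∷ (3F , 3F) ∷ [])
      (λ κ₁ κ₂ κ₃ u l z s φ R →
        (l ⊙ R ⇒ κ₃ † ⊙ κ₃ ⊙ l ⊖ κ₂ † ⊙ s ⊖ κ₁ † ⊙ κ₃ ⊙ u) ∷ (φ ⇒ κ₂ † ⊙ z ⊙ κ₂ ⊕ κ₃ † ⊙ κ₁ ⊖ κ₁ † ⊙ κ₃) ∷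
        (κ₁ ⊙ κ₁ † ⇒ 𝕀) ∷ (κ₂ ⊙ κ₂ † ⇒ 𝕀) ∷ (κ₃ ⊙ κ₃ † ⇒ 𝕀) ∷
        (κ₁ ⊙ κ₂ † ⇒ 𝟘) ∷ (κ₁ ⊙ κ₃ † ⇒ 𝟘) ∷ (κ₂ ⊙ κ₃ † ⇒ 𝟘) ∷ []
        ⊢ (l ⊙ R) † ⊙ φ ⊙ (l ⊙ R) ⇒ s † ⊙ z ⊙ s ⊖ l † ⊙ κ₃ † ⊙ κ₃ ⊙ u ⊕ u † ⊙ κ₃ † ⊙ κ₃ ⊙ l)
      (κ₁ , κ₂ , κ₃ , υ , λᴺ , z , s , φ , R , _)
      (λR , φ≋ , κ₁κ₁ᴴ , κ₂κ₂ᴴ , κ₃κ₃ᴴ , κ₁κ₂ᴴ , κ₁κ₃ᴴ , κ₂κ₃ᴴ , _)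
      where
      λR : λᴺ · R ≋ κ₃ ᴴ · κ₃ · λᴺ ⊞ ⊟ (κ₂ ᴴ · s) ⊞ ⊟ (κ₁ ᴴ · κ₃ · υ)
      λR = ≋-trans (·-congˡ λᴺ R≋) (solve (n ∷ N ∷ []) ((0F , 1F) ∷ (0F , 1F) ∷ (0F , 1F) ∷ (0F , 1F) ∷ [])
        (λ u l a b → (l ⊙ l † ⇒ 𝕀) ∷ (u ⊙ l † ⇒ 𝟘) ∷ [] ⊢ l ⊙ (u † ⊙ a ⊕ l † ⊙ b) ⇒ b)
        (υ , λᴺ , κ₁ ᴴ · κ₁ · υ ⊞ κ₂ ᴴ · p ⊞ κ₃ ᴴ · κ₁ · λᴺ ,
         κ₃ ᴴ · κ₃ · λᴺ ⊞ ⊟ (κ₂ ᴴ · s) ⊞ ⊟ (κ₁ ᴴ · κ₃ · υ) , _) (λλᴴ , υλᴴ , _))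

  private
    module _ (t : Fin (suc m)) where

      t≤m : toℕ t ≤ m
      t≤m = Finₚ.toℕ≤pred[n] t

      initial : Fin (toℕ t) → Fin m
      initial i = Fin.inject≤ i t≤m

      S : Mat (toℕ t) m
      S = sel initial

      SSᴴ : S · S ᴴ ≋ 𝟏
      SSᴴ = sel-orthonormal initial (λ {i} {j} e → Finₚ.inject≤-injective t≤m t≤m i j e)

      e≋SᴴS : e t ≋ S ᴴ · S
      e≋SᴴS i j = go (toℕ i ℕₚ.<? toℕ t)
        where
        open Ring 𝓡 using () renaming (sym to ≈-sym; trans to ≈-trans; reflexive to ≈-reflexive)
        s : Mat 1 m
        s = sel (λ _ → i)
        inside : ∀ (i′ : Fin (toℕ t)) → (S ᴴ · S) (initial i′) j ≈ 𝟏 (initial i′) j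
        inside i′ = ≈-trans (≈-sym (sel-· initial (S ᴴ · S) i′ j))
          (solve (toℕ t ∷ m ∷ []) ((0F , 1F) ∷ []) (λ S → (S ⊙ S † ⇒ 𝕀) ∷ [] ⊢ S ⊙ (S † ⊙ S) ⇒ S) (S , _) (SSᴴ , _) i′ j)
        outside : ¬ toℕ i < toℕ t → (S ᴴ · S) i j ≈ 0#
        outside i≮t = ≈-trans (≈-sym (sel-· {p = 1} (λ _ → i) (S ᴴ · S) 0F j))
          (solve (toℕ t ∷ m ∷ 1 ∷ []) ((0F , 1F) ∷ (2F , 1F) ∷ []) (λ S s → (s ⊙ S † ⇒ 𝟘) ∷ [] ⊢ s ⊙ (S † ⊙ S) ⇒ 𝟘)
            (S , s , _) (sel-orthogonal (λ _ → i) initial (λ _ i′ i≡ → i≮t (subst (_< toℕ t)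
              (trans (sym (Finₚ.toℕ-inject≤ i′ t≤m)) (cong toℕ (sym i≡))) (Finₚ.toℕ<n i′))) , _) 0F j)
        go : Dec (toℕ i < toℕ t) → e t i j ≈ (S ᴴ · S) i j
        go (yes i<t) = ≈-trans (≈-reflexive entry) (≈-sym
          (subst (λ i → (S ᴴ · S) i j ≈ 𝟏 i j) i≡ (inside (Fin.fromℕ< i<t))))
          where
          i≡ : initial (Fin.fromℕ< i<t) ≡ i
          i≡ = Finₚ.toℕ-injective (trans (Finₚ.toℕ-inject≤ _ t≤m) (Finₚ.toℕ-fromℕ< i<t))
          entry : e t i j ≡ 𝟏 i j
          entry = trans (cong (λ b → if does (i Finₚ.≟ j) ∧ b then 1# else 0#) (dec-true (toℕ i ℕₚ.<? toℕ t) i<t))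
            (cong (if_then 1# else 0#) (∧-identityʳ (does (i Finₚ.≟ j))))
        go (no i≮t) = ≈-trans (≈-reflexive entry) (≈-sym (outside i≮t))
          where
          entry : e t i j ≡ 0#
          entry = trans (cong (λ b → if does (i Finₚ.≟ j) ∧ b then 1# else 0#) (dec-false (toℕ i ℕₚ.<? toℕ t) i≮t))
            (cong (if_then 1# else 0#) (∧-zeroʳ (does (i Finₚ.≟ j))))

      eᴴ≋e : e t ᴴ ≋ e t
      eᴴ≋e = solve (toℕ t ∷ m ∷ []) ((0F , 1F) ∷ (1F , 1F) ∷ []) (λ S e → (e ⇒ S † ⊙ S) ∷ [] ⊢ e † ⇒ e)
        (S , e t , _) (e≋SᴴS , _)

  doubling : Mat n n → Mat n n → Mat N N
  doubling g₁ g₂ = R⁻¹ · diag g₁ g₂ · R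

  infix 4 _∼_
  _∼_ : Mat N N → Mat N N → Set
  g ∼ h = ∃[ p ] ∃[ g₁ ] ∃[ g₂ ]
    ((p ∈ Isom J × (∀ (i j : Fin n) → p (n ↑ʳ i) (j ↑ˡ n) ≈ 0#)) ×
     g₁ ∈ Isom φ × g₂ ∈ Isom φ × p · g · doubling g₁ g₂ ≋ h)

  doubling≋ : ∀ g₁ g₂ → doubling g₁ g₂ ≋ R⁻¹ · (υ ᴴ · g₁ · υ ⊞ λᴺ ᴴ · g₂ · λᴺ) · R
  doubling≋ g₁ g₂ = ·-congʳ R (·-congˡ R⁻¹ (≋-trans (rowwise {n} {n} (diag g₁ g₂)) (≋-trans
    (⊞-cong (·-congˡ (υ ᴴ) (upper-diag g₁ g₂)) (·-congˡ (λᴺ ᴴ) (lower-diag g₁ g₂)))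
    (solve (n ∷ N ∷ []) ((0F , 1F) ∷ (0F , 1F) ∷ (0F , 0F) ∷ (0F , 0F) ∷ [])
      (λ u l g₁ g₂ → [] ⊢ u † ⊙ (g₁ ⊙ u) ⊕ l † ⊙ (g₂ ⊙ l) ⇒ u † ⊙ g₁ ⊙ u ⊕ l † ⊙ g₂ ⊙ l) (υ , λᴺ , g₁ , g₂ , _) _))))

  corner : (p : Mat N N) → λᴺ · p · υ ᴴ ≋ λ i j → p (n ↑ʳ i) (j ↑ˡ n)
  corner p i j = ≈-trans (sel-ᴴ (_↑ˡ n) (λᴺ · p) i j) (sel-· (n ↑ʳ_) p i (j ↑ˡ n))
    where open Ring 𝓡 using () renaming (trans to ≈-trans)

  module Representatives (R-inverse : Inverses R R⁻¹) where

    open Lagrangians form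
    open Doubled form {J} {R} {R⁻¹} J≋ (proj₁ R-inverse) (proj₂ R-inverse) RᴴΔR≋J

    toSameCoset : ∀ {g h} → g ∼ h → SameCoset doubling≋ g h
    toSameCoset (p , g₁ , g₂ , (P , z) , G₁ , G₂ , e) = p , g₁ , g₂ , (P , ≋-trans (corner p) z) , G₁ , G₂ , e

    fromSameCoset : ∀ {g h} → SameCoset doubling≋ g h → g ∼ h
    fromSameCoset (p , g₁ , g₂ , (P , z) , G₁ , G₂ , e) =
      p , g₁ , g₂ , (P , ≋-trans (≋-sym (corner p)) z) , G₁ , G₂ , e

    τ-isom : ∀ t → τ t ∈ Isom J
    τ-isom t = isom-intro {S = J} {J′} {τ t} J′J≋𝟏
      (≋-trans (solve (m ∷ n ∷ N ∷ []) ((0F , 1F) ∷ (0F , 1F) ∷ (1F , 2F) ∷ (1F , 2F) ∷ (0F , 0F) ∷ (2F , 2F) ∷ (2F , 2F) ∷ [])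
        (λ κ₁ κ₃ u l e J τ → (τ ⇒ 𝕀 ⊕ l † ⊙ (κ₁ † ⊙ e ⊙ κ₃ ⊕ κ₃ † ⊙ e † ⊙ κ₁) ⊙ u) ∷
          (J ⇒ l † ⊙ u ⊖ u † ⊙ l) ∷ (e † ⇒ e) ∷ (l ⊙ l † ⇒ 𝕀) ∷ (u ⊙ l † ⇒ 𝟘) ∷ []
          ⊢ τ † ⊙ J ⊙ τ ⇒ l † ⊙ u ⊖ u † ⊙ l)
        (κ₁ , κ₃ , υ , λᴺ , e t , J , τ t , _) (τ≋ t , J≋ , eᴴ≋e t , λλᴴ , υλᴴ , _)) (≋-sym J≋))

    left-τ : ∀ t → left (τ t) ≋ κ₁ ᴴ · κ₃ ⊞ κ₂ ᴴ · q · κ₂ ⊞ κ₃ ᴴ · e t · κ₁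
    left-τ t = ≋-trans
      (solve (n ∷ N ∷ []) ((0F , 1F) ∷ (0F , 1F) ∷ (0F , 0F) ∷ (1F , 1F) ∷ (1F , 1F) ∷ [])
        (λ u l W S τ → (τ ⇒ 𝕀 ⊕ l † ⊙ W ⊙ u) ∷ (l ⊙ l † ⇒ 𝕀) ∷ []
          ⊢ l ⊙ τ ⊙ S ⊙ u † ⇒ l ⊙ S ⊙ u † ⊕ W ⊙ (u ⊙ S ⊙ u †))
        (υ , λᴺ , W , R⁻¹ , τ t , _) (τ≋ t , λλᴴ , _))
      (solve (m ∷ r ∷ n ∷ N ∷ [])
        ((0F , 2F) ∷ (1F , 2F) ∷ (0F , 2F) ∷ (2F , 3F) ∷ (2F , 3F) ∷ (0F , 0F) ∷ (1F , 1F) ∷ (3F , 3F) ∷ [])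
        (λ κ₁ κ₂ κ₃ u l e q S →
          (S ⇒ u † ⊙ (κ₁ † ⊙ κ₁ ⊙ u ⊕ κ₂ † ⊙ κ₂ ⊙ (u ⊖ l) ⊖ κ₃ † ⊙ κ₁ ⊙ l)
               ⊕ l † ⊙ (κ₁ † ⊙ κ₃ ⊙ u ⊕ κ₂ † ⊙ q ⊙ κ₂ ⊙ (u ⊕ l) ⊕ κ₃ † ⊙ κ₃ ⊙ l)) ∷
          (l ⊙ l † ⇒ 𝕀) ∷ (u ⊙ l † ⇒ 𝟘) ∷ (u ⊙ u † ⇒ 𝕀) ∷ (e † ⇒ e) ∷
          (κ₁ ⊙ κ₁ † ⇒ 𝕀) ∷ (κ₁ ⊙ κ₂ † ⇒ 𝟘) ∷ (κ₁ ⊙ κ₃ † ⇒ 𝟘) ∷ (κ₂ ⊙ κ₃ † ⇒ 𝟘) ∷ []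
          ⊢ l ⊙ S ⊙ u † ⊕ (κ₁ † ⊙ e ⊙ κ₃ ⊕ κ₃ † ⊙ e † ⊙ κ₁) ⊙ (u ⊙ S ⊙ u †)
          ⇒ κ₁ † ⊙ κ₃ ⊕ κ₂ † ⊙ q ⊙ κ₂ ⊕ κ₃ † ⊙ e ⊙ κ₁)
        (κ₁ , κ₂ , κ₃ , υ , λᴺ , e t , q , R⁻¹ , _)
        (R⁻¹≋ , λλᴴ , υλᴴ , υυᴴ , eᴴ≋e t , κ₁κ₁ᴴ , κ₁κ₂ᴴ , κ₁κ₃ᴴ , κ₂κ₃ᴴ , _))
      where
      W : Mat n n
      W = κ₁ ᴴ · e t · κ₃ ⊞ κ₃ ᴴ · e t ᴴ · κ₁

    factorization-τ : ∀ t → Factorization (left (τ t)) (toℕ t ℕ.+ (r ℕ.+ m))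
    factorization-τ t = record
      { F = κ₁ ᴴ · c ⊞ κ₂ ᴴ · q · b ⊞ κ₃ ᴴ · S t ᴴ · a
      ; G = a ᴴ · S t · κ₁ ⊞ b ᴴ · κ₂ ⊞ c ᴴ · κ₃
      ; E = c ᴴ · κ₁ ⊞ b ᴴ · q⁻¹ · κ₂ ⊞ a ᴴ · S t · κ₃
      ; H = κ₁ ᴴ · S t ᴴ · a ⊞ κ₂ ᴴ · b ⊞ κ₃ ᴴ · c
      ; X≋FG = ≋-trans (left-τ t) (solve (m ∷ r ∷ n ∷ toℕ t ∷ ρ ∷ [])
          ((0F , 2F) ∷ (1F , 2F) ∷ (0F , 2F) ∷ (3F , 4F) ∷ (1F , 4F) ∷ (0F , 4F) ∷ (1F , 1F) ∷ (3F , 0F) ∷ (0F , 0F) ∷ [])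
          (λ κ₁ κ₂ κ₃ a b c q S e → (a ⊙ a † ⇒ 𝕀) ∷ (b ⊙ b † ⇒ 𝕀) ∷ (c ⊙ c † ⇒ 𝕀) ∷
            (a ⊙ b † ⇒ 𝟘) ∷ (a ⊙ c † ⇒ 𝟘) ∷ (b ⊙ c † ⇒ 𝟘) ∷ (e ⇒ S † ⊙ S) ∷ []
            ⊢ κ₁ † ⊙ κ₃ ⊕ κ₂ † ⊙ q ⊙ κ₂ ⊕ κ₃ † ⊙ e ⊙ κ₁ ⇒
              (κ₁ † ⊙ c ⊕ κ₂ † ⊙ q ⊙ b ⊕ κ₃ † ⊙ S † ⊙ a) ⊙ (a † ⊙ S ⊙ κ₁ ⊕ b † ⊙ κ₂ ⊕ c † ⊙ κ₃))
          (κ₁ , κ₂ , κ₃ , a , b , c , q , S t , e t , _)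
          (aaᴴ , bbᴴ , ccᴴ , abᴴ , acᴴ , bcᴴ , e≋SᴴS t , _))
      ; EF≋𝟏 = ≋-trans (solve (m ∷ r ∷ n ∷ toℕ t ∷ ρ ∷ [])
          ((0F , 2F) ∷ (1F , 2F) ∷ (0F , 2F) ∷ (3F , 4F) ∷ (1F , 4F) ∷ (0F , 4F) ∷ (1F , 1F) ∷ (1F , 1F) ∷ (3F , 0F) ∷ [])
          (λ κ₁ κ₂ κ₃ a b c q q⁻¹ S → (κ₁ ⊙ κ₁ † ⇒ 𝕀) ∷ (κ₂ ⊙ κ₂ † ⇒ 𝕀) ∷ (κ₃ ⊙ κ₃ † ⇒ 𝕀) ∷
            (κ₁ ⊙ κ₂ † ⇒ 𝟘) ∷ (κ₁ ⊙ κ₃ † ⇒ 𝟘) ∷ (κ₂ ⊙ κ₃ † ⇒ 𝟘) ∷ (q⁻¹ ⊙ q ⇒ 𝕀) ∷ (S ⊙ S † ⇒ 𝕀) ∷ []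
            ⊢ (c † ⊙ κ₁ ⊕ b † ⊙ q⁻¹ ⊙ κ₂ ⊕ a † ⊙ S ⊙ κ₃) ⊙ (κ₁ † ⊙ c ⊕ κ₂ † ⊙ q ⊙ b ⊕ κ₃ † ⊙ S † ⊙ a)
            ⇒ a † ⊙ a ⊕ b † ⊙ b ⊕ c † ⊙ c)
          (κ₁ , κ₂ , κ₃ , a , b , c , q , q⁻¹ , S t , _)
          (κ₁κ₁ᴴ , κ₂κ₂ᴴ , κ₃κ₃ᴴ , κ₁κ₂ᴴ , κ₁κ₃ᴴ , κ₂κ₃ᴴ , q⁻¹q , SSᴴ t , _)) resolution
      ; GH≋𝟏 = ≋-trans (solve (m ∷ r ∷ n ∷ toℕ t ∷ ρ ∷ [])
          ((0F , 2F) ∷ (1F , 2F) ∷ (0F , 2F) ∷ (3F , 4F) ∷ (1F , 4F) ∷ (0F , 4F) ∷ (3F , 0F) ∷ [])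
          (λ κ₁ κ₂ κ₃ a b c S → (κ₁ ⊙ κ₁ † ⇒ 𝕀) ∷ (κ₂ ⊙ κ₂ † ⇒ 𝕀) ∷ (κ₃ ⊙ κ₃ † ⇒ 𝕀) ∷
            (κ₁ ⊙ κ₂ † ⇒ 𝟘) ∷ (κ₁ ⊙ κ₃ † ⇒ 𝟘) ∷ (κ₂ ⊙ κ₃ † ⇒ 𝟘) ∷ (S ⊙ S † ⇒ 𝕀) ∷ []
            ⊢ (a † ⊙ S ⊙ κ₁ ⊕ b † ⊙ κ₂ ⊕ c † ⊙ κ₃) ⊙ (κ₁ † ⊙ S † ⊙ a ⊕ κ₂ † ⊙ b ⊕ κ₃ † ⊙ c)
            ⇒ a † ⊙ a ⊕ b † ⊙ b ⊕ c † ⊙ c)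
          (κ₁ , κ₂ , κ₃ , a , b , c , S t , _)
          (κ₁κ₁ᴴ , κ₂κ₂ᴴ , κ₃κ₃ᴴ , κ₁κ₂ᴴ , κ₁κ₃ᴴ , κ₂κ₃ᴴ , SSᴴ t , _)) resolution }
      where
      ρ : ℕ
      ρ = toℕ t ℕ.+ (r ℕ.+ m)
      open Triples 𝓡 involution (toℕ t) r m using () renaming
        ( κ₁ to a; κ₂ to b; κ₃ to c; κ₁κ₁ᴴ to aaᴴ; κ₂κ₂ᴴ to bbᴴ; κ₃κ₃ᴴ to ccᴴ
        ; κ₁κ₂ᴴ to abᴴ; κ₁κ₃ᴴ to acᴴ; κ₂κ₃ᴴ to bcᴴ; κ-resolution to resolution)
      q⁻¹ : Mat r r
      q⁻¹ = ⊟ (z⁻¹ · (𝟏 ⊞ 𝟏))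
      q⁻¹q : q⁻¹ · q ≋ 𝟏
      q⁻¹q = ≋-trans (solve (r ∷ []) ((0F , 0F) ∷ (0F , 0F) ∷ (0F , 0F) ∷ (0F , 0F) ∷ [])
          (λ q h z i → (q ⇒ ⊝ (h ⊙ z)) ∷ [] ⊢ (⊝ (i ⊙ (𝕀 ⊕ 𝕀))) ⊙ q ⇒ i ⊙ (h ⊕ h) ⊙ z)
          (q , h , z , z⁻¹ , _) (≋-trans (scalar-neg (½ * ζ)) (⊟-cong (≋-sym (scalar-· ½ ζ))) , _))
        (≋-trans (·-congʳ z (·-congˡ z⁻¹ h+h)) (≋-trans (·-congʳ z (·-𝟏 z⁻¹)) z⁻¹z))

    module _ (anisotropic : Anisotropic (scalar {r} ζ)) where

      Φ≋ : Φ ≋ κ₂ ᴴ · z⁻¹ · κ₂ ⊞ κ₁ ᴴ · κ₃ ⊞ ⊟ (κ₃ ᴴ · κ₁)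
      Φ≋ = ≋-refl {X = Φ}

      witt-index : ∀ {k} {P : Mat k n} {P′ : Mat n k} → P · P′ ≋ 𝟏 → P · Φ · P ᴴ ≋ 𝟎 → k ≤ m
      witt-index = isotropic-rank form {A = κ₃} {κ₃ ᴴ} κ₃κ₃ᴴ
        (solve (m ∷ r ∷ n ∷ []) ((0F , 2F) ∷ (1F , 2F) ∷ (0F , 2F) ∷ (1F , 1F) ∷ (2F , 2F) ∷ [])
          (λ κ₁ κ₂ κ₃ i Φ → (Φ ⇒ κ₂ † ⊙ i ⊙ κ₂ ⊕ κ₁ † ⊙ κ₃ ⊖ κ₃ † ⊙ κ₁) ∷ (κ₁ ⊙ κ₃ † ⇒ 𝟘) ∷ (κ₂ ⊙ κ₃ † ⇒ 𝟘) ∷ []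
            ⊢ κ₃ ⊙ Φ ⊙ κ₃ † ⇒ 𝟘) (κ₁ , κ₂ , κ₃ , z⁻¹ , Φ , _) (Φ≋ , κ₁κ₃ᴴ , κ₂κ₃ᴴ , _))
        maximal
        where
        maximal : ∀ (v : Mat 1 n) → κ₃ · Φ · v ᴴ ≋ 𝟎 → v · Φ · v ᴴ ≋ 𝟎 → Σ (Mat 1 m) λ c → v ≋ c · κ₃
        maximal v κv vv = v · κ₃ ᴴ , ≋-trans (≋-sym (·-𝟏 v)) (≋-trans (·-congˡ v (≋-sym κ-resolution))
          (solve (m ∷ r ∷ n ∷ 1 ∷ []) ((0F , 2F) ∷ (1F , 2F) ∷ (0F , 2F) ∷ (3F , 2F) ∷ [])
            (λ κ₁ κ₂ κ₃ v → (κ₁ ⊙ v † ⇒ 𝟘) ∷ (κ₂ ⊙ v † ⇒ 𝟘) ∷ []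
              ⊢ v ⊙ (κ₁ † ⊙ κ₁ ⊕ κ₂ † ⊙ κ₂ ⊕ κ₃ † ⊙ κ₃) ⇒ (v ⊙ κ₃ †) ⊙ κ₃)
            (κ₁ , κ₂ , κ₃ , v , _) (κ₁v , κ₂v , _)))
          where
          κ₁v : κ₁ · v ᴴ ≋ 𝟎
          κ₁v = ≋-trans (solve (m ∷ r ∷ n ∷ 1 ∷ [])
              ((0F , 2F) ∷ (1F , 2F) ∷ (0F , 2F) ∷ (1F , 1F) ∷ (2F , 2F) ∷ (3F , 2F) ∷ [])
            (λ κ₁ κ₂ κ₃ i Φ v → (Φ ⇒ κ₂ † ⊙ i ⊙ κ₂ ⊕ κ₁ † ⊙ κ₃ ⊖ κ₃ † ⊙ κ₁) ∷
              (κ₃ ⊙ κ₃ † ⇒ 𝕀) ∷ (κ₁ ⊙ κ₃ † ⇒ 𝟘) ∷ (κ₂ ⊙ κ₃ † ⇒ 𝟘) ∷ []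
              ⊢ κ₁ ⊙ v † ⇒ ⊝ (κ₃ ⊙ Φ ⊙ v †)) (κ₁ , κ₂ , κ₃ , z⁻¹ , Φ , v , _) (Φ≋ , κ₃κ₃ᴴ , κ₁κ₃ᴴ , κ₂κ₃ᴴ , _))
            (≋-trans (⊟-cong κv) (solve (m ∷ 1 ∷ []) [] ([] ⊢ ⊝ (𝟘 {i = 0F} {1F}) ⇒ 𝟘) _ _))
          x : Mat r 1
          x = z⁻¹ · κ₂ · v ᴴ
          xzx : x ᴴ · z · x ≋ 𝟎
          xzx = ≋-trans (solve (m ∷ r ∷ n ∷ 1 ∷ [])
              ((0F , 2F) ∷ (1F , 2F) ∷ (0F , 2F) ∷ (1F , 1F) ∷ (1F , 1F) ∷ (2F , 2F) ∷ (3F , 2F) ∷ [])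
            (λ κ₁ κ₂ κ₃ z i Φ v → (Φ ⇒ κ₂ † ⊙ i ⊙ κ₂ ⊕ κ₁ † ⊙ κ₃ ⊖ κ₃ † ⊙ κ₁) ∷
              (i † ⇒ ⊝ i) ∷ (z ⊙ i ⇒ 𝕀) ∷ (κ₁ ⊙ v † ⇒ 𝟘) ∷ []
              ⊢ (i ⊙ κ₂ ⊙ v †) † ⊙ z ⊙ (i ⊙ κ₂ ⊙ v †) ⇒ ⊝ (v ⊙ Φ ⊙ v †))
            (κ₁ , κ₂ , κ₃ , z , z⁻¹ , Φ , v , _) (Φ≋ , z⁻¹ᴴ , zz⁻¹ , κ₁v , _))
            (≋-trans (⊟-cong vv) (solve (1 ∷ []) [] ([] ⊢ ⊝ (𝟘 {i = 0F} {0F}) ⇒ 𝟘) _ _))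
          κ₂v : κ₂ · v ᴴ ≋ 𝟎
          κ₂v = ≋-trans (solve (r ∷ n ∷ 1 ∷ []) ((0F , 1F) ∷ (0F , 0F) ∷ (0F , 0F) ∷ (2F , 1F) ∷ [])
              (λ κ₂ z i v → (z ⊙ i ⇒ 𝕀) ∷ [] ⊢ κ₂ ⊙ v † ⇒ z ⊙ (i ⊙ κ₂ ⊙ v †)) (κ₂ , z , z⁻¹ , v , _) (zz⁻¹ , _))
            (≋-trans (·-congˡ z (anisotropic x xzx)) (·-𝟎 z))

      double-coset-representative : ∀ g → g ∈ Isom J → ∃! _≡_ (λ t → τ t ∼ g)
      double-coset-representative g g∈GN =
        let ρ , f = factorize n (left g)
            k , ρ+k≡n , normal = lagrangian-normalForm L f
        in found k normal
        where
        L : Lagrangian (left g) (right g)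
        L = lagrangian g∈GN
        unique : ∀ {t s} → τ t ∼ g → τ s ∼ g → t ≡ s
        unique {t} {s} t∼g s∼g = Finₚ.toℕ-injective (ℕₚ.+-cancelʳ-≡ (r ℕ.+ m) (toℕ t) (toℕ s) (rank-unique
          (same-coset⇒equal-rank doubling≋ (toSameCoset t∼g) (factorization-τ t))
          (same-coset⇒equal-rank doubling≋ (toSameCoset s∼g) (factorization-τ s))))
        found : ∀ k → NormalForm (left g) (right g) k → ∃! _≡_ (λ t → τ t ∼ g)
        found k normal =
          let k′ , ρ+k′≡n , normal′ = lagrangian-normalForm (lagrangian (τ-isom t)) (factorization-τ t)
              t∼g = fromSameCoset (equal-rank⇒same-coset doubling≋ g∈GN (τ-isom t) normal
                      (subst (NormalForm _ _) (k′≡k ρ+k′≡n) normal′))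
          in t , t∼g , unique t∼g
          where
          k≤m : k ≤ m
          k≤m = witt-index (NormalForm.PP′≋𝟏 normal) (NormalForm.PΦPᴴ≋𝟎 normal)
          t : Fin (suc m)
          t = Fin.fromℕ< (s≤s (ℕₚ.m∸n≤m m k))
          k′≡k : ∀ {k′} → toℕ t ℕ.+ (r ℕ.+ m) ℕ.+ k′ ≡ n → k′ ≡ k
          k′≡k {k′} eq = ℕₚ.+-cancelˡ-≡ (m ℕ.∸ k ℕ.+ (r ℕ.+ m)) k′ k (trans
            (subst (λ t → t ℕ.+ (r ℕ.+ m) ℕ.+ k′ ≡ n) (Finₚ.toℕ-fromℕ< (s≤s (ℕₚ.m∸n≤m m k))) eq)
            (sym (trans (ℕₚ.+-assoc (m ℕ.∸ k) (r ℕ.+ m) k) (trans (cong (m ℕ.∸ k ℕ.+_) (ℕₚ.+-comm (r ℕ.+ m) k))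
              (trans (sym (ℕₚ.+-assoc (m ℕ.∸ k) k (r ℕ.+ m))) (cong (ℕ._+ (r ℕ.+ m)) (ℕₚ.m∸n+n≡m k≤m)))))))

square-positive : ∀ p → ¬ p ≡ 0ℚ → ℚ.Positive (p ℚ.* p)
square-positive p p≢0 with ℚₚ.<-cmp p 0ℚ
... | tri< p<0 _ _ = ℚₚ.neg*neg⇒pos p {{ℚ.negative p<0}} p {{ℚ.negative p<0}}
... | tri≈ _ p≡0 _ = ⊥-elim (p≢0 p≡0)
... | tri> _ _ p>0 = ℚₚ.pos*pos⇒pos p {{ℚ.positive p>0}} p {{ℚ.positive p>0}}

weighted-square-positive : ∀ w p → ℚ.Positive w → ¬ p ≡ 0ℚ → ℚ.Positive (w ℚ.* (p ℚ.* p))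
weighted-square-positive w p w>0 p≢0 = ℚₚ.pos*pos⇒pos w {{w>0}} (p ℚ.* p) {{square-positive p p≢0}}

weighted-square-nonNegative : ∀ w p → ℚ.Positive w → ℚ.NonNegative (w ℚ.* (p ℚ.* p))
weighted-square-nonNegative w p w>0 with p ℚₚ.≟ 0ℚ
... | yes refl = subst ℚ.NonNegative (sym (ℚₚ.*-zeroʳ w)) _
... | no p≢0   = ℚₚ.pos⇒nonNeg (w ℚ.* (p ℚ.* p)) {{weighted-square-positive w p w>0 p≢0}}

negated-positive : ∀ a .{{_ : Negative a}} → ℚ.Positive (ℚ.- (a ℚ./ 1))
negated-positive ℤ.-[1+ k ] = subst (λ p → ℚ.Positive (ℚ.- p))
  (sym (ℚₚ.↥p/↧p≡p (ℚ.mkℚ ℤ.-[1+ k ] 0 (Coprime.sym (Coprime.1-coprimeTo (suc k)))))) _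

quaternary-positive : ∀ {s t u : ℚ} → ℚ.Positive s → ℚ.Positive t → ℚ.Positive u →
  ∀ a b c d → ¬ (a ≡ 0ℚ × b ≡ 0ℚ × c ≡ 0ℚ × d ≡ 0ℚ) →
  ℚ.Positive ((1ℚ ℚ.* (a ℚ.* a) ℚ.+ s ℚ.* (b ℚ.* b)) ℚ.+ (t ℚ.* (c ℚ.* c) ℚ.+ u ℚ.* (d ℚ.* d)))
quaternary-positive {s} {t} {u} s>0 t>0 u>0 a b c d ≢0 = go (a ℚₚ.≟ 0ℚ) (b ℚₚ.≟ 0ℚ) (c ℚₚ.≟ 0ℚ) (d ℚₚ.≟ 0ℚ)
  where
  p q v w : ℚ
  p = 1ℚ ℚ.* (a ℚ.* a)
  q = s ℚ.* (b ℚ.* b)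
  v = t ℚ.* (c ℚ.* c)
  w = u ℚ.* (d ℚ.* d)
  instance
    p≥0 : ℚ.NonNegative p
    p≥0 = weighted-square-nonNegative 1ℚ a _
    q≥0 : ℚ.NonNegative q
    q≥0 = weighted-square-nonNegative s b s>0
    v≥0 : ℚ.NonNegative v
    v≥0 = weighted-square-nonNegative t c t>0
    w≥0 : ℚ.NonNegative w
    w≥0 = weighted-square-nonNegative u d u>0
    v+w≥0 : ℚ.NonNegative (v ℚ.+ w)
    v+w≥0 = ℚₚ.nonNeg+nonNeg⇒nonNeg v w
    p+q≥0 : ℚ.NonNegative (p ℚ.+ q)
    p+q≥0 = ℚₚ.nonNeg+nonNeg⇒nonNeg p q
  go : Dec (a ≡ 0ℚ) → Dec (b ≡ 0ℚ) → Dec (c ≡ 0ℚ) → Dec (d ≡ 0ℚ) → ℚ.Positive ((p ℚ.+ q) ℚ.+ (v ℚ.+ w))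
  go (no a≢0) _ _ _ = ℚₚ.pos+nonNeg⇒pos (p ℚ.+ q)
    {{ℚₚ.pos+nonNeg⇒pos p {{weighted-square-positive 1ℚ a _ a≢0}} q}} (v ℚ.+ w)
  go _ (no b≢0) _ _ = ℚₚ.pos+nonNeg⇒pos (p ℚ.+ q)
    {{ℚₚ.nonNeg+pos⇒pos p q {{weighted-square-positive s b s>0 b≢0}}}} (v ℚ.+ w)
  go _ _ (no c≢0) _ = ℚₚ.nonNeg+pos⇒pos (p ℚ.+ q) (v ℚ.+ w)
    {{ℚₚ.pos+nonNeg⇒pos v {{weighted-square-positive t c t>0 c≢0}} w}}
  go _ _ _ (no d≢0) = ℚₚ.nonNeg+pos⇒pos (p ℚ.+ q) (v ℚ.+ w)
    {{ℚₚ.nonNeg+pos⇒pos v w {{weighted-square-positive u d u>0 d≢0}}}}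
  go (yes a≡0) (yes b≡0) (yes c≡0) (yes d≡0) = ⊥-elim (≢0 (a≡0 , b≡0 , c≡0 , d≡0))

module DefiniteQuaternions (α β : ℤ) .{{_ : Negative α}} .{{_ : Negative β}} where

  open Quaternion α β
  open +-*-Solver

  private
    A B : ℚ
    A = α ℚ./ 1
    B = β ℚ./ 1

    module _ {n} (A B a b c d a′ b′ c′ d′ : Polynomial n) where
      product₀ product₁ product₂ product₃ : Polynomial n
      product₀ = a :* a′ :+ A :* (b :* b′) :+ B :* (c :* c′) :- A :* B :* (d :* d′)
      product₁ = a :* b′ :+ b :* a′ :+ B :* (d :* c′ :- c :* d′)
      product₂ = a :* c′ :+ c :* a′ :+ A :* (b :* d′ :- d :* b′)
      product₃ = a :* d′ :+ d :* a′ :+ b :* c′ :- c :* b′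

    norm : ℚ → ℚ → ℚ → ℚ → ℚ
    norm a b c d = (1ℚ ℚ.* (a ℚ.* a) ℚ.+ (ℚ.- A) ℚ.* (b ℚ.* b)) ℚ.+
                   ((ℚ.- B) ℚ.* (c ℚ.* c) ℚ.+ ((ℚ.- A) ℚ.* (ℚ.- B)) ℚ.* (d ℚ.* d))

    normᵖ : ∀ {n} (A B a b c d : Polynomial n) → Polynomial n
    normᵖ A B a b c d = (con 1ℚ :* (a :* a) :+ (:- A) :* (b :* b)) :+
                        ((:- B) :* (c :* c) :+ ((:- A) :* (:- B)) :* (d :* d))

    norm-positive : ∀ a b c d → ¬ quat a b c d ≡ 0# → ℚ.Positive (norm a b c d)
    norm-positive a b c d x≢0 = quaternary-positive {ℚ.- A} {ℚ.- B} {(ℚ.- A) ℚ.* (ℚ.- B)} (negated-positive α) (negated-positive β)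
      (ℚₚ.pos*pos⇒pos (ℚ.- A) {{negated-positive α}} (ℚ.- B) {{negated-positive β}}) a b c d
      (λ { (refl , refl , refl , refl) → x≢0 refl })

    ⁻⁻ : ∀ p → ℚ.- (ℚ.- p) ≡ p
    ⁻⁻ = solve 1 (λ p → :- (:- p) := p) refl

  conj-* : ∀ x y → conj (x * y) ≡ conj y * conj x
  conj-* (quat a b c d) (quat a′ b′ c′ d′) = quat-cong
    (solve 10 (λ A B a b c d a′ b′ c′ d′ → product₀ A B a b c d a′ b′ c′ d′ :=
      product₀ A B a′ (:- b′) (:- c′) (:- d′) a (:- b) (:- c) (:- d)) refl A B a b c d a′ b′ c′ d′)
    (solve 10 (λ A B a b c d a′ b′ c′ d′ → :- product₁ A B a b c d a′ b′ c′ d′ :=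
      product₁ A B a′ (:- b′) (:- c′) (:- d′) a (:- b) (:- c) (:- d)) refl A B a b c d a′ b′ c′ d′)
    (solve 10 (λ A B a b c d a′ b′ c′ d′ → :- product₂ A B a b c d a′ b′ c′ d′ :=
      product₂ A B a′ (:- b′) (:- c′) (:- d′) a (:- b) (:- c) (:- d)) refl A B a b c d a′ b′ c′ d′)
    (solve 10 (λ A B a b c d a′ b′ c′ d′ → :- product₃ A B a b c d a′ b′ c′ d′ :=
      product₃ A B a′ (:- b′) (:- c′) (:- d′) a (:- b) (:- c) (:- d)) refl A B a b c d a′ b′ c′ d′)

  involution : Involution 𝔹-ring
  involution = record
    { conj = conj
    ; conj-cong = cong conj
    ; conj-involutive = λ { (quat a b c d) → quat-cong refl
        (⁻⁻ b) (⁻⁻ c) (⁻⁻ d) }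
    ; conj-+ = λ { (quat a b c d) (quat a′ b′ c′ d′) → quat-cong refl
        (ℚₚ.neg-distrib-+ b b′) (ℚₚ.neg-distrib-+ c c′) (ℚₚ.neg-distrib-+ d d′) }
    ; conj-* = conj-* }

  private
    quat-injective : ∀ {a b c d a′ b′ c′ d′} → quat a b c d ≡ quat a′ b′ c′ d′ → a ≡ a′ × b ≡ b′ × c ≡ c′ × d ≡ d′
    quat-injective refl = refl , refl , refl , refl

    _≟_ : (x y : 𝔹) → Dec (x ≡ y)
    quat a b c d ≟ quat a′ b′ c′ d′ with a ℚₚ.≟ a′ | b ℚₚ.≟ b′ | c ℚₚ.≟ c′ | d ℚₚ.≟ d′
    ... | yes refl | yes refl | yes refl | yes refl = yes refl
    ... | no ≢ | _ | _ | _ = no (λ e → ≢ (proj₁ (quat-injective e)))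
    ... | _ | no ≢ | _ | _ = no (λ e → ≢ (proj₁ (proj₂ (quat-injective e))))
    ... | _ | _ | no ≢ | _ = no (λ e → ≢ (proj₁ (proj₂ (proj₂ (quat-injective e)))))
    ... | _ | _ | _ | no ≢ = no (λ e → ≢ (proj₂ (proj₂ (proj₂ (quat-injective e)))))

    inverse : ∀ x → ¬ x ≡ 0# → ∃[ y ] (x * y ≡ 1#) × (y * x ≡ 1#)
    inverse (quat a b c d) x≢0 =
      quat (a ℚ.* i) ((ℚ.- b) ℚ.* i) ((ℚ.- c) ℚ.* i) ((ℚ.- d) ℚ.* i) ,
      quat-cong
        (trans (solve 7 (λ A B a b c d i → product₀ A B a b c d (a :* i) ((:- b) :* i) ((:- c) :* i) ((:- d) :* i) :=
          normᵖ A B a b c d :* i) refl A B a b c d i) Ni)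
        (solve 7 (λ A B a b c d i → product₁ A B a b c d (a :* i) ((:- b) :* i) ((:- c) :* i) ((:- d) :* i) := con 0ℚ)
          refl A B a b c d i)
        (solve 7 (λ A B a b c d i → product₂ A B a b c d (a :* i) ((:- b) :* i) ((:- c) :* i) ((:- d) :* i) := con 0ℚ)
          refl A B a b c d i)
        (solve 7 (λ A B a b c d i → product₃ A B a b c d (a :* i) ((:- b) :* i) ((:- c) :* i) ((:- d) :* i) := con 0ℚ)
          refl A B a b c d i) ,
      quat-cong
        (trans (solve 7 (λ A B a b c d i → product₀ A B (a :* i) ((:- b) :* i) ((:- c) :* i) ((:- d) :* i) a b c d :=
          normᵖ A B a b c d :* i) refl A B a b c d i) Ni)
        (solve 7 (λ A B a b c d i → product₁ A B (a :* i) ((:- b) :* i) ((:- c) :* i) ((:- d) :* i) a b c d := con 0ℚ)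
          refl A B a b c d i)
        (solve 7 (λ A B a b c d i → product₂ A B (a :* i) ((:- b) :* i) ((:- c) :* i) ((:- d) :* i) a b c d := con 0ℚ)
          refl A B a b c d i)
        (solve 7 (λ A B a b c d i → product₃ A B (a :* i) ((:- b) :* i) ((:- c) :* i) ((:- d) :* i) a b c d := con 0ℚ)
          refl A B a b c d i)
      where
      instance
        N≢0 : ℚ.NonZero (norm a b c d)
        N≢0 = ℚₚ.pos⇒nonZero (norm a b c d) {{norm-positive a b c d x≢0}}
      i : ℚ
      i = ℚ.1/ norm a b c d
      Ni : norm a b c d ℚ.* i ≡ 1ℚ
      Ni = ℚₚ.*-inverseʳ (norm a b c d)

    double-zero : ∀ a → a ≡ ℚ.- a → a ≡ 0ℚ
    double-zero a e = trans (solve 1 (λ a → a := con ℚ.½ :* (a :+ a)) refl a)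
      (trans (cong (λ b → ℚ.½ ℚ.* (a ℚ.+ b)) e) (solve 1 (λ a → con ℚ.½ :* (a :+ (:- a)) := con 0ℚ) refl a))

    skew-half : ∀ x → conj x ≡ - x → ∃[ z ] (¬ z ≡ 0#) × (z ≡ x + conj z)
    skew-half (quat a b c d) e = quat 1ℚ (ℚ.½ ℚ.* b) (ℚ.½ ℚ.* c) (ℚ.½ ℚ.* d) , (λ ()) ,
      quat-cong (cong (ℚ._+ 1ℚ) (sym (double-zero a (proj₁ (quat-injective e))))) (half b) (half c) (half d)
      where
      half : ∀ b → ℚ.½ ℚ.* b ≡ b ℚ.+ (ℚ.- (ℚ.½ ℚ.* b))
      half = solve 1 (λ b → con ℚ.½ :* b := b :+ (:- (con ℚ.½ :* b))) refl

  division : IsDivision 𝔹-ring involution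
  division = record { _≈?_ = _≟_ ; 1≉0 = λ () ; inverse = inverse ; skew-half = skew-half }

module QuaternionDoubling (α β : ℤ) .{{_ : Negative α}} .{{_ : Negative β}} where

  open Quaternion α β
  open DefiniteQuaternions α β public

  scalars : DoublingScalars 𝔹-ring involution
  scalars = record
    { ζ = ζ ; ζ⁻¹ = ζ⁻¹ ; ½ = ⟨ ℚ.½ ⟩ ; ζζ⁻¹≈1 = ζζ⁻¹≡1 ; ζ⁻¹ζ≈1 = ζ⁻¹ζ≡1
    ; conj-ζ = refl ; ½+½≈1 = refl ; conj-½ = refl }

proposition4p3 : (α β : ℤ) .{{_ : Negative α}} .{{_ : Negative β}} →
    SquareFree α → SquareFree β →
    (m r : ℕ) → 1 < m →
    let open Doubling α β m r in
    Anisotropic (scalar {r} ζ) →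
    (∀ (t : Fin (suc m)) → τ t ∈ GN) ×
    (∀ (g : Mat N N) → g ∈ GN → ∃! _≡_ (λ (t : Fin (suc m)) → τ t ∼ g))
proposition4p3 α β _ _ m r _ anisotropic = τ-isom , double-coset-representative anisotropic
  where
  open Quaternion α β using (𝔹-ring)
  open QuaternionDoubling α β
  open SiegelDoubling 𝔹-ring involution division scalars m r
  open Representatives (Doubling.R-inverse α β m r)
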